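{- Let $s,t\ge1$, let $\beta_1,\dotsc,\beta_s$ be positive integers, and let \[ F_{\boldsymbol\beta,q}[s;t]=\prod_{1\le i<j\le s}\Big(\frac{z_i}{z_j};q\Big)_{\beta_i}\Big(\frac{qz_j}{z_i};q\Big)_{\beta_j}\prod_{i=1}^s\prod_{j=1}^t\Big(\frac{z_i}{w_j};q\Big)_{\beta_i}^{ -1}, \] expanded as a formal series. For $\mathbf{k}=(k_1,\dotsc,k_s)\in\mathbb{Z}^s$ and $\mathbf{m}=(m_1,\dotsc,m_t)\in\mathbb{Z}_{\ge0}^t$, if the monomial $z_1^{k_1}\dotsm z_s^{k_s}w_1^{ -m_1}\dotsm w_t^{ -m_t}$ appears in the expansion of $F_{\boldsymbol\beta,q}[s;t]$, then $\mathbf{k}^+\ge\mathbf{m}^+$. Moreover, in the case that all $\beta_i$ equal a common positive integer $\beta$, if $\lambda$ is a partition with $s=t=l(\lambda)$, then the coefficient of $z_1^{\lambda_1}\dotsm z_s^{\lambda_s}w_1^{ -\lambda_1}\dotsm w_s^{ -\lambda_s}$ in $F_{\boldsymbol\beta,q}[s;t]$ is \[ c_\lambda=q^{\beta[l(\lambda)^2-\sum_{i\ge1}m_i(\lambda)^2]/2}\prod_{i\ge1}\frac{(q^\beta;q^\beta)_{m_i(\lambda)}}{(1-q^\beta)^{m_i(\lambda)}}\prod_{i=1}^{l(\lambda)}\frac{(q^\beta;q)_{\lambda_i+(s-i)\beta}}{(q;q)_{\lambda_i+(s-i)\beta}}. \]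
   Context: $(z;q)_n=(1-z)(1-qz)\dotsm(1-q^{n-1}z)$, $(z;q)_0=1$. The expansion is obtained by expanding each factor $(1-q^bz_i/w_j)^{ -1}$ as $\sum_{m\ge0}(q^bz_i/w_j)^m$ (the region $|q^bz_i/w_j|<1$). For a partition $\lambda$, $l(\lambda)$ is its number of nonzero parts and $m_i(\lambda)$ the multiplicity of $i$ in $\lambda$. For $a\in\mathbb{Z}^n$, $a^+$ denotes the vector obtained by rearranging $a_1,\dotsc,a_n$ in weakly decreasing order; for $a\in\mathbb{Z}^n$, $b\in\mathbb{Z}^m$, write $a\ge b$ if $a_1+\dotsb+a_i\ge b_1+\dotsb+b_i$ for all $i\ge1$, where vectors are padded with zeros beyond their length. -}

module Defs where

open import Algebra.Bundles using (CommutativeRing; RawRing)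
open import Algebra.Apartness.Bundles using (HeytingCommutativeRing; HeytingField)
import Algebra.Apartness.Properties.HeytingCommutativeRing as HeytingProperties
import Algebra.Definitions.RawSemiring as RawSemiringDefs
open import Data.Bool.Base using (if_then_else_)
open import Data.Fin.Base using (Fin; toℕ)
import Data.Fin.Properties as Fin
open import Data.Integer.Base as ℤ using (ℤ; +_; 0ℤ; 1ℤ; -1ℤ)
import Data.Integer.Properties as ℤ
open import Data.List.Base as List using (List; []; _∷_; _++_; cartesianProductWith; concatMap; foldr; length; take; upTo)
open import Data.List.Relation.Unary.All using (All)
open import Data.List.Relation.Unary.Linked using (Linked)
import Data.List.Sort as Sort
open import Data.Nat.Base as ℕ using (ℕ; zero; suc)
open import Data.Nat.DivMod using () renaming (_/_ to _÷_)
import Data.Nat.ListAction as ℕ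
import Data.Nat.Properties as ℕ
open import Data.Product.Base using (_×_; _,_; proj₁)
open import Data.Vec.Base as Vec using (Vec; []; _∷_; lookup; replicate; toList; zipWith; _[_]≔_)
open import Data.Vec.Functional as Vector using (Vector)
open import Data.Vec.Properties using (≡-dec)
open import Relation.Binary.Construct.Flip.EqAndOrd using (decTotalOrder)
open import Relation.Nullary.Decidable using (⌊_⌋)

infix 8 _⁺
_⁺ : ∀ {n} → Vec ℤ n → List ℤ
a ⁺ = sort (toList a)
  where open Sort (decTotalOrder ℤ.≤-decTotalOrder)

-- `take i` past the end of a list returns the whole list, so these partial
-- sums are those of the vectors padded with zeros.
partialSum : ℕ → List ℤ → ℤ
partialSum i a = foldr ℤ._+_ 0ℤ (take i a)

infix 4 _⊵_
_⊵_ : List ℤ → List ℤ → Set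
a ⊵ b = ∀ i → partialSum i a ℤ.≥ partialSum i b

record Partition : Set where
  field
    parts      : List ℕ
    decreasing : Linked ℕ._≥_ parts
    positive   : All (1 ℕ.≤_) parts

  ℓ : ℕ
  ℓ = length parts

  mult : ℕ → ℕ
  mult i = length (List.filter (i ℕ.≟_) parts)

  -- The part λ_{i+1}: indices start at 0, and parts beyond the length are 0.
  part : ℕ → ℕ
  part = go parts
    where
    go : List ℕ → ℕ → ℕ
    go []       _       = 0
    go (x ∷ _)  zero    = x
    go (_ ∷ xs) (suc i) = go xs i

  firstParts : ∀ n → Vec ℕ n
  firstParts n = Vec.tabulate (λ i → part (toℕ i))

-- (z;q)_n = (1 - z)(1 - qz) ⋯ (1 - qⁿ⁻¹z)
module QPochhammer {c ℓ} (R : RawRing c ℓ) where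
  open RawRing R
  open RawSemiringDefs rawSemiring using (_^_)

  qPoch : Carrier → Carrier → ℕ → Carrier
  qPoch z q zero    = 1#
  qPoch z q (suc n) = qPoch z q n * (1# + - (q ^ n * z))

module FormalSeries {c ℓ} (R : RawRing c ℓ) where
  open RawRing R
  open RawSemiringDefs rawSemiring using (_^_)

  -- Laurent polynomials in z_1,…,z_s: finite sums of terms (c , k), each
  -- standing for c z^k.  Exponents may repeat.
  Laurent : ℕ → Set c
  Laurent s = List (Carrier × Vec ℤ s)

  coeffᴸ : ∀ {s} → Vec ℤ s → Laurent s → Carrier
  coeffᴸ k []            = 0#
  coeffᴸ k ((a , e) ∷ p) = if ⌊ ≡-dec ℤ._≟_ e k ⌋ then a + coeffᴸ k p else coeffᴸ k p

  constᴸ : ∀ {s} → Carrier → Laurent s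
  constᴸ {s} a = (a , replicate s 0ℤ) ∷ []

  _*ᴸ_ : ∀ {s} → Laurent s → Laurent s → Laurent s
  _*ᴸ_ = cartesianProductWith λ (a , e) (b , f) → a * b , zipWith ℤ._+_ e f

  laurent : ℕ → RawRing c ℓ
  laurent s = record
    { Carrier = Laurent s
    ; _≈_     = λ p r → ∀ k → coeffᴸ k p ≈ coeffᴸ k r
    ; _+_     = _++_
    ; _*_     = _*ᴸ_
    ; -_      = List.map λ (a , e) → - a , e
    ; 0#      = []
    ; 1#      = constᴸ 1#
    }

  z z⁻¹ : ∀ {s} → Fin s → Laurent s
  z   {s} i = (1# , (replicate s 0ℤ [ i ]≔ 1ℤ)) ∷ []
  z⁻¹ {s} i = (1# , (replicate s 0ℤ [ i ]≔ -1ℤ)) ∷ []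

  -- Power series in w_1⁻¹,…,w_t⁻¹ over Laurent polynomials in z_1,…,z_s;
  -- f m is the coefficient of w^{-m}.
  Series : ℕ → ℕ → Set c
  Series s t = Vec ℕ t → Laurent s

  coeff : ∀ {s t} → Vec ℤ s → Vec ℕ t → Series s t → Carrier
  coeff k m f = coeffᴸ k (f m)

  -- All pairs (a , b) with a + b = m.
  splits : ∀ {t} → Vec ℕ t → List (Vec ℕ t × Vec ℕ t)
  splits []       = ([] , []) ∷ []
  splits (m ∷ ms) = cartesianProductWith (λ i (a , b) → i ∷ a , (m ℕ.∸ i) ∷ b) (upTo (suc m)) (splits ms)

  constˢ : ∀ {s t} → Laurent s → Series s t
  constˢ {t = t} p m = if ⌊ ≡-dec ℕ._≟_ m (replicate t 0) ⌋ then p else []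

  infixl 7 _*ˢ_
  _*ˢ_ : ∀ {s t} → Series s t → Series s t → Series s t
  (f *ˢ g) m = concatMap (λ (a , b) → f a *ᴸ g b) (splits m)

  Πˢ : ∀ {s t n} → Vector (Series s t) n → Series s t
  Πˢ = Vector.foldr _*ˢ_ (constˢ (constᴸ 1#))

  -- Expansion of (1 - a z_i / w_j)⁻¹ as Σ_r aʳ z_iʳ w_j⁻ʳ: the coefficient of
  -- w^{-m} is aʳ z_iʳ when m is supported at j with m_j = r, and 0 otherwise.
  geometric : ∀ {s t} → Carrier → Fin s → Fin t → Series s t
  geometric {s} {t} a i j m =
    if ⌊ ≡-dec ℕ._≟_ m (replicate t 0 [ j ]≔ r) ⌋
    then (a ^ r , (replicate s 0ℤ [ i ]≔ + r)) ∷ []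
    else []
    where r = lookup m j

module QDyson {c ℓ} (R : RawRing c ℓ) (q : RawRing.Carrier R) where
  open RawSemiringDefs (RawRing.rawSemiring R) using (_^_)
  open FormalSeries R

  -- ∏_{i<j} (z_i/z_j ; q)_{β_i} (q z_j/z_i ; q)_{β_j}
  numerator : ∀ {s} → Vec ℕ s → Laurent s
  numerator {s} β = product λ i → product λ j →
    if ⌊ i Fin.<? j ⌋
    then qPoch (z i * z⁻¹ j) (constᴸ q) (lookup β i)
         * qPoch (constᴸ q * (z j * z⁻¹ i)) (constᴸ q) (lookup β j)
    else 1#
    where
    open RawRing (laurent s)
    open RawSemiringDefs rawSemiring using (product)
    open QPochhammer (laurent s)

  -- Expansion of (z_i/w_j ; q)_n⁻¹.
  qPochInverse : ∀ {s t} → Fin s → Fin t → ℕ → Series s t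
  qPochInverse i j n = Πˢ {n = n} λ b → geometric (q ^ toℕ b) i j

  F : ∀ s t → Vec ℕ s → Series s t
  F s t β = constˢ (numerator β) *ˢ Πˢ λ i → Πˢ λ j → qPochInverse i j (lookup β i)

module Coefficient {c ℓ₁ ℓ₂} (K : HeytingField c ℓ₁ ℓ₂) (q : HeytingField.Carrier K) where
  open HeytingField K
  open HeytingProperties heytingCommutativeRing using (1#0; x#0y#0→xy#0; x-0≈x; #-congʳ; invertibleˡ⇒#)
  open CommutativeRing (HeytingCommutativeRing.commutativeRing heytingCommutativeRing) public using (rawRing)
  open RawSemiringDefs (RawRing.rawSemiring rawRing) public using (_^_; product)
  open QPochhammer rawRing public using (qPoch)

  NotRootOfUnity : Set ℓ₂
  NotRootOfUnity = ∀ n → 1 ℕ.≤ n → 1# # q ^ n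

  -- #⇒invertible inverts y - 0#, which is ≈ y.
  infixl 7 _/_[_]
  _/_[_] : (x y : Carrier) → y # 0# → Carrier
  x / y [ y#0 ] = x * proj₁ (#⇒invertible y#0)

  x#y⇒x-y#0 : ∀ {x y} → x # y → x - y # 0#
  x#y⇒x-y#0 {x} {y} x#y with #⇒invertible x#y
  ... | (u , u*[x-y]≈1 , _) = invertibleˡ⇒# (u , trans (*-congˡ (x-0≈x (x - y))) u*[x-y]≈1)

  ^-#0 : ∀ {x} n → x # 0# → x ^ n # 0#
  ^-#0 zero    x#0 = 1#0
  ^-#0 (suc n) x#0 = x#0y#0→xy#0 x#0 (^-#0 n x#0)

  module _ (nru : NotRootOfUnity) where

    qPoch-#0 : ∀ n → qPoch q q n # 0#
    qPoch-#0 zero    = 1#0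
    qPoch-#0 (suc n) = x#0y#0→xy#0 (qPoch-#0 n)
      (#-congʳ (+-congˡ (-‿cong (*-comm q (q ^ n)))) (x#y⇒x-y#0 (nru (suc n) (ℕ.s≤s ℕ.z≤n))))

    -- Since m_i(λ) = 0 for i > λ_1, sums and products over i ≥ 1 run over
    -- 1 ≤ i ≤ λ_1.  The number l(λ)² - Σ m_i(λ)² is nonnegative and even, as
    -- Σ m_i(λ) = l(λ), so ∸ and ÷ are exact.
    c-λ : (λ′ : Partition) (β : ℕ) → 1 ℕ.≤ β → Carrier
    c-λ λ′ β 1≤β =
        q ^ ((β ℕ.* (ℓ ℕ.* ℓ ℕ.∸ ℕ.sum (List.map (λ i → mult (suc i) ℕ.* mult (suc i)) (upTo (part 0))))) ÷ 2)
      * product {part 0} (λ i → let m = mult (suc (toℕ i)) in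
          qPoch (q ^ β) (q ^ β) m / (1# - q ^ β) ^ m [ ^-#0 m (x#y⇒x-y#0 (nru β 1≤β)) ])
      * product {ℓ} (λ i → let n = part (toℕ i) ℕ.+ (ℓ ℕ.∸ suc (toℕ i)) ℕ.* β in
          qPoch (q ^ β) q n / qPoch q q n [ qPoch-#0 n ])
      where open Partition λ′

{-# OPTIONS --safe #-}
module Submission where

-- Write h_m for the complete homogeneous symmetric polynomial in the elements
-- y(i,b) = q^b z_i (b < β_i), and N for the numerator of F.  The coefficient of
-- w^{-m} in F is N ∏_l h_{m_l}.  Expanding ∏ (1 - y X)⁻¹ in partial fractions
-- writes N h_t as a combination of the terms y(i,b)^t ∏_{j≠i} p_{ijb}(z_i/z_j) N_i,
-- where N_i is the numerator without z_i and the p_{ijb} are polynomials, because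
-- the pole at y(i,b) cancels against the factors of N that involve z_i.
-- Each step thus takes z_i^t out of N h_t and moves further degree only towards
-- z_i, and by induction on the number of variables any n of the m_l are dominated
-- by n entries of k.  For k = m = λ and t = λ_1 all this further degree
-- has to vanish, so p_{ijb} may be replaced by p_{ijb}(0), which gives the recursion
-- c_λ = (Σ_{i : λ_i = t} q^{β #{j > i}}) (q^β;q)_n/(q;q)_n c_{λ∖t} with n = t + (s-1)β.
-- Partial fractions need distinct nodes, so all this is done for an indeterminate
-- q and then specialised.

open import Defs
open import Algebra.Apartness.Bundles using (HeytingCommutativeRing; HeytingField)
import Algebra.Apartness.Properties.HeytingCommutativeRing as HeytingProperties
open import Algebra.Bundles using (CommutativeMonoid; CommutativeRing; RawRing)
import Algebra.Definitions.RawSemiring as RawSemiringDefs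
import Algebra.Properties.AbelianGroup as AbelianGroupProperties
import Algebra.Properties.CommutativeSemiring.Exp as CExp
import Algebra.Properties.Ring as RingProperties
import Algebra.Properties.Semiring.Exp as Exp
import Algebra.Properties.Semiring.Mult.TCOptimised as Mult
import Algebra.Solver.Ring as RingSolver
open import Algebra.Solver.Ring.AlmostCommutativeRing using (fromCommutativeRing; _-Raw-AlmostCommutative⟶_)
open import Algebra.Structures using (IsCommutativeMonoid)
open import Data.Bool.Base using (Bool; true; false; if_then_else_)
open import Data.Empty using (⊥-elim)
open import Data.Fin.Base as Fin using (Fin)
import Data.Fin.Properties as Fin
open import Data.Integer.Base as ℤ using (ℤ; +_; -[1+_]; 0ℤ; 1ℤ; -1ℤ)
import Data.Integer.Properties as ℤ
open import Data.List.Base as List using (List; []; _∷_; _++_; allFin; applyUpTo; cartesianProductWith; concatMap; filter; length; upTo)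
open import Data.List.Membership.Propositional using (_∈_; _∉_)
open import Data.List.Membership.Propositional.Properties using (∈-allFin; ∈-map⁻; ∈-map⁺; ∈-++⁻; ∈-++⁺ˡ; ∈-upTo⁻; ∈-upTo⁺; ∈-filter⁻; ∈-filter⁺; ∈-∃++)
import Data.List.Properties as List
open import Data.List.Relation.Binary.Permutation.Propositional as Perm using (_↭_; prep; swap; ↭-refl; ↭-sym; ↭-trans; ↭-reflexive; ↭⇒↭ₛ)
open import Data.List.Relation.Binary.Permutation.Propositional.Properties as Perm using (shifts; drop-∷; ∈-resp-↭; filter-↭; ↭-length; ∷↭∷ʳ)
import Data.List.Relation.Binary.Permutation.Setoid.Properties as PermSetoid
open import Data.List.Relation.Binary.Pointwise as Pointwise using (Pointwise; []; _∷_)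
open import Data.List.Relation.Unary.All as All using (All; []; _∷_)
import Data.List.Relation.Unary.All.Properties as All
open import Data.List.Relation.Unary.AllPairs as AllPairs using (AllPairs; []; _∷_)
import Data.List.Relation.Unary.AllPairs.Properties as AllPairs
open import Data.List.Relation.Unary.Any using (here; there)
open import Data.List.Relation.Unary.Linked using (Linked)
open import Data.List.Relation.Unary.Linked.Properties using (Linked⇒AllPairs)
open import Data.List.Relation.Unary.Unique.Propositional using (Unique)
import Data.List.Relation.Unary.Unique.Propositional.Properties as Unique
import Data.List.Sort as Sort
import Data.Maybe.Base as Maybe
open import Data.Nat.Base as ℕ using (ℕ; zero; suc; _≤_)
open import Data.Nat.DivMod using (m*n/n≡m) renaming (_/_ to _÷_)
open import Data.Nat.Induction using (<-rec)
import Data.Nat.ListAction as ListAction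
import Data.Nat.Properties as ℕ
import Data.Nat.Tactic.RingSolver as ℕSolver
open import Data.Product.Base using (_×_; _,_; proj₁; proj₂; ∃)
open import Data.Sum.Base using (_⊎_; inj₁; inj₂; [_,_]′)
open import Data.Vec.Base as Vec using (Vec; lookup; map; replicate; zipWith; _[_]≔_)
open import Data.Vec.Functional as Vector using (Vector)
import Data.Vec.Properties as Vec
open import Function.Base using (_∘_)
open import Level using (Level; _⊔_)
open import Relation.Binary.Construct.Flip.EqAndOrd using (decTotalOrder)
open import Relation.Binary.Core using (REL)
open import Relation.Binary.Definitions using (DecidableEquality; tri<; tri≈; tri>)
open import Relation.Binary.PropositionalEquality as ≡ using (_≡_; _≢_)
import Relation.Binary.Reasoning.Setoid as SetoidReasoning
open import Relation.Nullary using (¬_)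
open import Relation.Nullary.Decidable using (Dec; ⌊_⌋; yes; no; ¬?; dec⇒maybe; decidable-stable)

-- Commutative rings

-- The nodes q^b z_i may coincide when q is 0 or a root of unity, and the dominance statement
-- assumes nothing about q; hence the passage to an indeterminate. Even there q and the differences
-- of its powers are not units. Every partial fraction identity is therefore multiplied by powers of
-- E = (q;q)_n̂, with n̂ a common bound of the β_i, and these are then cancelled as
-- non-zero-divisors. Specialisation is possible because F is built from ring operations without
-- ever inspecting a coefficient.
--
-- After z_i^t has been taken out, the remaining factors h_m still involve z_i. They are expanded in
-- powers of the q^b z_i: each step lowers m by one and raises the exponent of z_i by one, so
-- nothing is lost as long as z_i is counted among the chosen variables. Likewise a factor z_i/z_j
-- costs the other chosen entries at most what z_i gains.
--
-- Equality in K need not be decidable. A support condition is thus the vanishing of all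
-- coefficients outside a set, and the inequality of the theorem is recovered from the decidable
-- order on the integers.

module IntegerSolver {c ℓ} (R : CommutativeRing c ℓ) where
  open CommutativeRing R hiding (zero)
  open RingProperties ring using (-‿distribˡ-*; -‿involutive; -0#≈0#)
  open AbelianGroupProperties +-abelianGroup using (⁻¹-∙-comm)
  open Mult semiring using (1+×; ×-homo-+; ×1-homo-*) renaming (_×_ to _·_)
  open SetoidReasoning setoid

  private
    fromℤ : ℤ → Carrier
    fromℤ (+ n)    = n · 1#
    fromℤ -[1+ n ] = - (suc n · 1#)

    fromℤ-⊖ : ∀ m n → fromℤ (m ℤ.⊖ n) ≈ m · 1# - n · 1#
    fromℤ-⊖ m       zero    = sym (trans (+-congˡ -0#≈0#) (+-identityʳ _))
    fromℤ-⊖ zero    (suc n) = sym (+-identityˡ _)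
    fromℤ-⊖ (suc m) (suc n) = begin
      fromℤ (suc m ℤ.⊖ suc n)                ≡⟨ ≡.cong fromℤ (ℤ.[1+m]⊖[1+n]≡m⊖n m n) ⟩
      fromℤ (m ℤ.⊖ n)                        ≈⟨ fromℤ-⊖ m n ⟩
      m · 1# - n · 1#                        ≈⟨ +-congʳ (+-identityʳ _) ⟨
      m · 1# + 0# - n · 1#                   ≈⟨ +-congʳ (+-congˡ (-‿inverseʳ 1#)) ⟨
      m · 1# + (1# - 1#) - n · 1#            ≈⟨ +-congʳ (+-assoc _ _ _) ⟨
      m · 1# + 1# - 1# - n · 1#              ≈⟨ +-assoc _ _ _ ⟩
      m · 1# + 1# + (- 1# - n · 1#)          ≈⟨ +-cong (+-comm _ _) (⁻¹-∙-comm _ _) ⟩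
      1# + m · 1# - (1# + n · 1#)            ≈⟨ +-cong (1+× m 1#) (-‿cong (1+× n 1#)) ⟨
      suc m · 1# - suc n · 1#                ∎

    fromℤ-+ : ∀ i j → fromℤ (i ℤ.+ j) ≈ fromℤ i + fromℤ j
    fromℤ-+ (+ m)    (+ n)    = ×-homo-+ 1# m n
    fromℤ-+ (+ m)    -[1+ n ] = fromℤ-⊖ m (suc n)
    fromℤ-+ -[1+ m ] (+ n)    = trans (fromℤ-⊖ n (suc m)) (+-comm _ _)
    fromℤ-+ -[1+ m ] -[1+ n ] = begin
      - (suc (suc (m ℕ.+ n)) · 1#)      ≡⟨ ≡.cong (λ i → - (suc i · 1#)) (ℕ.+-suc m n) ⟨
      - ((suc m ℕ.+ suc n) · 1#)        ≈⟨ -‿cong (×-homo-+ 1# (suc m) (suc n)) ⟩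
      - (suc m · 1# + suc n · 1#)       ≈⟨ ⁻¹-∙-comm _ _ ⟨
      - (suc m · 1#) - suc n · 1#       ∎

    fromℤ-neg : ∀ i → fromℤ (ℤ.- i) ≈ - fromℤ i
    fromℤ-neg (+ zero)  = sym -0#≈0#
    fromℤ-neg (+ suc n) = refl
    fromℤ-neg -[1+ n ]  = sym (-‿involutive _)

    fromℤ-* : ∀ i j → fromℤ (i ℤ.* j) ≈ fromℤ i * fromℤ j
    fromℤ-*-pos : ∀ m j → fromℤ (+ m ℤ.* j) ≈ fromℤ (+ m) * fromℤ j
    fromℤ-*-pos m (+ n) = trans (reflexive (≡.cong fromℤ (≡.sym (ℤ.pos-* m n)))) (×1-homo-* m n)
    fromℤ-*-pos m -[1+ n ] = begin
      fromℤ (+ m ℤ.* -[1+ n ])     ≡⟨ ≡.cong fromℤ (ℤ.neg-distribʳ-* (+ m) (+ suc n)) ⟨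
      fromℤ (ℤ.- (+ m ℤ.* + suc n)) ≈⟨ fromℤ-neg (+ m ℤ.* + suc n) ⟩
      - fromℤ (+ m ℤ.* + suc n)    ≈⟨ -‿cong (fromℤ-*-pos m (+ suc n)) ⟩
      - (m · 1# * (suc n · 1#))    ≈⟨ RingProperties.-‿distribʳ-* ring _ _ ⟩
      m · 1# * - (suc n · 1#)      ∎
    fromℤ-* (+ m)    j = fromℤ-*-pos m j
    fromℤ-* -[1+ m ] j = begin
      fromℤ (-[1+ m ] ℤ.* j)      ≡⟨ ≡.cong fromℤ (ℤ.neg-distribˡ-* (+ suc m) j) ⟨
      fromℤ (ℤ.- (+ suc m ℤ.* j)) ≈⟨ fromℤ-neg (+ suc m ℤ.* j) ⟩
      - fromℤ (+ suc m ℤ.* j)     ≈⟨ -‿cong (fromℤ-*-pos (suc m) j) ⟩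
      - (suc m · 1# * fromℤ j)    ≈⟨ -‿distribˡ-* _ _ ⟩
      - (suc m · 1#) * fromℤ j    ∎

    morphism : CommutativeRing.rawRing ℤ.+-*-commutativeRing -Raw-AlmostCommutative⟶ fromCommutativeRing R
    morphism = record
      { ⟦_⟧    = fromℤ
      ; +-homo = fromℤ-+
      ; *-homo = fromℤ-*
      ; -‿homo = fromℤ-neg
      ; 0-homo = refl
      ; 1-homo = refl
      }

  open RingSolver (CommutativeRing.rawRing ℤ.+-*-commutativeRing) (fromCommutativeRing R) morphism
    (λ i j → Maybe.map (reflexive ∘ ≡.cong fromℤ) (dec⇒maybe (i ℤ.≟ j))) public
    using (solve; _:+_; _:*_; _:-_; :-_; con; _:=_)

-- Finite sums and products over lists

module BigOperator {c ℓ} (M : CommutativeMonoid c ℓ) where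
  open CommutativeMonoid M
  open SetoidReasoning setoid

  big : ∀ {a} {A : Set a} → List A → (A → Carrier) → Carrier
  big []       f = ε
  big (x ∷ xs) f = f x ∙ big xs f

  private
    variable
      a b : Level
      A : Set a
      B : Set b

  exchange : ∀ w x y z → (w ∙ x) ∙ (y ∙ z) ≈ (w ∙ y) ∙ (x ∙ z)
  exchange w x y z = begin
    (w ∙ x) ∙ (y ∙ z) ≈⟨ assoc _ _ _ ⟩
    w ∙ (x ∙ (y ∙ z)) ≈⟨ ∙-congˡ (trans (sym (assoc _ _ _)) (trans (∙-congʳ (comm _ _)) (assoc _ _ _))) ⟩
    w ∙ (y ∙ (x ∙ z)) ≈⟨ assoc _ _ _ ⟨
    (w ∙ y) ∙ (x ∙ z) ∎

  big-cong-∈ : ∀ (xs : List A) {f g : A → Carrier} → (∀ {x} → x ∈ xs → f x ≈ g x) → big xs f ≈ big xs g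
  big-cong-∈ []       f≈g = refl
  big-cong-∈ (x ∷ xs) f≈g = ∙-cong (f≈g (here ≡.refl)) (big-cong-∈ xs (f≈g ∘ there))

  big-cong : ∀ (xs : List A) {f g : A → Carrier} → (∀ x → f x ≈ g x) → big xs f ≈ big xs g
  big-cong xs f≈g = big-cong-∈ xs (λ {x} _ → f≈g x)

  big-ε : ∀ (xs : List A) → big xs (λ _ → ε) ≈ ε
  big-ε []       = refl
  big-ε (x ∷ xs) = trans (identityˡ _) (big-ε xs)

  big-++ : ∀ (xs ys : List A) (f : A → Carrier) → big (xs ++ ys) f ≈ big xs f ∙ big ys f
  big-++ []       ys f = sym (identityˡ _)
  big-++ (x ∷ xs) ys f = trans (∙-congˡ (big-++ xs ys f)) (sym (assoc _ _ _))

  big-↭ : ∀ {xs ys : List A} (f : A → Carrier) → xs ↭ ys → big xs f ≈ big ys f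
  big-↭ f Perm.refl          = refl
  big-↭ f (prep x p)         = ∙-congˡ (big-↭ f p)
  big-↭ f (swap x y p)       = begin
    f x ∙ (f y ∙ _) ≈⟨ assoc _ _ _ ⟨
    (f x ∙ f y) ∙ _ ≈⟨ ∙-cong (comm _ _) (big-↭ f p) ⟩
    (f y ∙ f x) ∙ _ ≈⟨ assoc _ _ _ ⟩
    f y ∙ (f x ∙ _) ∎
  big-↭ f (Perm.trans p₁ p₂) = trans (big-↭ f p₁) (big-↭ f p₂)

  big-∙ : ∀ (xs : List A) (f g : A → Carrier) → big xs (λ x → f x ∙ g x) ≈ big xs f ∙ big xs g
  big-∙ []       f g = sym (identityˡ ε)
  big-∙ (x ∷ xs) f g = trans (∙-congˡ (big-∙ xs f g)) (exchange _ _ _ _)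

  big-map : ∀ (xs : List A) (g : A → B) (f : B → Carrier) → big (List.map g xs) f ≈ big xs (f ∘ g)
  big-map []       g f = refl
  big-map (x ∷ xs) g f = ∙-congˡ (big-map xs g f)

  big-concatMap : ∀ (xs : List A) (g : A → List B) (f : B → Carrier) →
                  big (List.concatMap g xs) f ≈ big xs (λ x → big (g x) f)
  big-concatMap []       g f = refl
  big-concatMap (x ∷ xs) g f = trans (big-++ (g x) (List.concatMap g xs) f) (∙-congˡ (big-concatMap xs g f))

module BigRing {c ℓ} (R : CommutativeRing c ℓ) where
  open CommutativeRing R hiding (zero)
  open RingProperties ring
  open Exp semiring using (_^_)
  open SetoidReasoning setoid

  private
    variable
      a b : Level
      A : Set a
      B : Set b

  open BigOperator +-commutativeMonoid public renaming
    ( big to Σ[]; big-cong to Σ-cong; big-cong-∈ to Σ-cong-∈; big-ε to Σ-0; big-++ to Σ-++; big-↭ to Σ-↭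
    ; big-∙ to Σ-+; big-map to Σ-map; big-concatMap to Σ-concatMap; exchange to +-exchange)
  open BigOperator *-commutativeMonoid public renaming
    ( big to Π[]; big-cong to Π-cong; big-cong-∈ to Π-cong-∈; big-ε to Π-1; big-++ to Π-++; big-↭ to Π-↭
    ; big-∙ to Π-*; big-map to Π-map; big-concatMap to Π-concatMap; exchange to *-exchange)

  *-Σ : ∀ (xs : List A) x (f : A → Carrier) → x * Σ[] xs f ≈ Σ[] xs (λ y → x * f y)
  *-Σ []       x f = zeroʳ x
  *-Σ (y ∷ ys) x f = trans (distribˡ _ _ _) (+-congˡ (*-Σ ys x f))

  Σ-* : ∀ (xs : List A) x (f : A → Carrier) → Σ[] xs f * x ≈ Σ[] xs (λ y → f y * x)
  Σ-* xs x f = trans (*-comm _ _) (trans (*-Σ xs x f) (Σ-cong xs (λ _ → *-comm _ _)))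

  Σ*Σ : ∀ (xs : List A) (ys : List B) f g →
        Σ[] xs f * Σ[] ys g ≈ Σ[] xs (λ x → Σ[] ys (λ y → f x * g y))
  Σ*Σ xs ys f g = trans (Σ-* xs _ f) (Σ-cong xs (λ x → *-Σ ys (f x) g))

  Π-const : ∀ (xs : List A) x → Π[] xs (λ _ → x) ≈ x ^ length xs
  Π-const []       x = refl
  Π-const (y ∷ ys) x = *-congˡ (Π-const ys x)

  -- Cancelling non-zero-divisors takes the place of dividing by differences of nodes and by E.
  Regular : Carrier → Set (c ⊔ ℓ)
  Regular x = ∀ y → x * y ≈ 0# → y ≈ 0#

  Regular-resp : ∀ {x y} → x ≈ y → Regular x → Regular y
  Regular-resp x≈y reg z yz≈0 = reg z (trans (*-congʳ x≈y) yz≈0)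

  Regular-1 : Regular 1#
  Regular-1 y 1y≈0 = trans (sym (*-identityˡ y)) 1y≈0

  Regular-* : ∀ {x y} → Regular x → Regular y → Regular (x * y)
  Regular-* rx ry z xyz≈0 = ry z (rx _ (trans (sym (*-assoc _ _ _)) xyz≈0))

  Regular-^ : ∀ {x} n → Regular x → Regular (x ^ n)
  Regular-^ zero    reg = Regular-1
  Regular-^ (suc n) reg = Regular-* reg (Regular-^ n reg)

  Regular-neg : ∀ {x} → Regular x → Regular (- x)
  Regular-neg {x} reg z eq = reg z (begin
    x * z          ≈⟨ -‿involutive _ ⟨
    - (- (x * z))  ≈⟨ -‿cong (-‿distribˡ-* x z) ⟩
    - (- x * z)    ≈⟨ -‿cong eq ⟩
    - 0#           ≈⟨ -0#≈0# ⟩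
    0#             ∎)

  open AbelianGroupProperties +-abelianGroup public using () renaming (x∙y⁻¹≈ε⇒x≈y to x-y≈0⇒x≈y)

  Regular-cancel : ∀ {x y z} → Regular x → x * y ≈ x * z → y ≈ z
  Regular-cancel {x} {y} {z} reg eq = x-y≈0⇒x≈y y z (reg (y - z) (begin
    x * (y - z)    ≈⟨ x[y-z]≈xy-xz x y z ⟩
    x * y - x * z  ≈⟨ +-congʳ eq ⟩
    x * z - x * z  ≈⟨ -‿inverseʳ _ ⟩
    0#             ∎))

  1^ : ∀ n → 1# ^ n ≈ 1#
  1^ zero    = refl
  1^ (suc n) = trans (*-identityˡ _) (1^ n)

-- Partial fractions

module CompleteHomogeneous {c ℓ} (R : CommutativeRing c ℓ) where
  open CommutativeRing R hiding (zero)
  open BigRing R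
  open Exp semiring using (_^_; ^-homo-*)
  open RingProperties ring using (x[y-z]≈xy-xz)
  open IntegerSolver R
  open SetoidReasoning setoid

  private
    variable
      a : Level
      A : Set a

  -- The coefficient of Xᵐ in ∏_{x∈xs} (1 - y x X)⁻¹.
  h : List A → (A → Carrier) → ℕ → Carrier
  h []       y zero    = 1#
  h []       y (suc m) = 0#
  h (x ∷ xs) y zero    = h xs y zero
  h (x ∷ xs) y (suc m) = h xs y (suc m) + y x * h (x ∷ xs) y m

  h-0 : ∀ (xs : List A) y → h xs y 0 ≡ 1#
  h-0 []       y = ≡.refl
  h-0 (x ∷ xs) y = h-0 xs y

  h-prep : ∀ x {xs ys : List A} y → (∀ m → h xs y m ≈ h ys y m) → ∀ m → h (x ∷ xs) y m ≈ h (x ∷ ys) y m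
  h-prep x y eq zero    = eq zero
  h-prep x y eq (suc m) = +-cong (eq (suc m)) (*-congˡ (h-prep x y eq m))

  -- Unfolding the recursion in both orders of the two nodes gives the same terms except for a mixed
  -- one, so the cases `suc m` and `m` together give `suc (suc m)`.
  h-swap : ∀ x x′ (xs : List A) y m → h (x ∷ x′ ∷ xs) y m ≈ h (x′ ∷ x ∷ xs) y m
  h-swap x x′ xs y zero    = refl
  h-swap x x′ xs y (suc zero) =
    solve 4 (λ w p r t → (w :+ p :* t) :+ r :* t := (w :+ r :* t) :+ p :* t) refl
      (h xs y 1) (y x′) (y x) (h xs y 0)
  h-swap x x′ xs y (suc (suc m)) = begin
    (h xs y (2 ℕ.+ m) + p * (h xs y (suc m) + p * h (x′ ∷ xs) y m)) + r * h (x ∷ x′ ∷ xs) y (suc m)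
      ≈⟨ +-congˡ (*-congˡ (h-swap x x′ xs y (suc m))) ⟩
    (h xs y (2 ℕ.+ m) + p * (h xs y (suc m) + p * h (x′ ∷ xs) y m))
      + r * ((h xs y (suc m) + r * h (x ∷ xs) y m) + p * h (x′ ∷ x ∷ xs) y m)
      ≈⟨ solve 7 (λ w p r t g k l →
           (w :+ p :* (t :+ p :* g)) :+ r :* ((t :+ r :* k) :+ p :* l)
           := (w :+ r :* (t :+ r :* k)) :+ p :* ((t :+ p :* g) :+ r :* l)) refl
           (h xs y (2 ℕ.+ m)) p r (h xs y (suc m)) (h (x′ ∷ xs) y m) (h (x ∷ xs) y m) (h (x′ ∷ x ∷ xs) y m) ⟩
    (h xs y (2 ℕ.+ m) + r * (h xs y (suc m) + r * h (x ∷ xs) y m))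
      + p * ((h xs y (suc m) + p * h (x′ ∷ xs) y m) + r * h (x′ ∷ x ∷ xs) y m)
      ≈⟨ +-congˡ (*-congˡ (+-congˡ (*-congˡ (h-swap x x′ xs y m)))) ⟨
    (h xs y (2 ℕ.+ m) + r * (h xs y (suc m) + r * h (x ∷ xs) y m))
      + p * ((h xs y (suc m) + p * h (x′ ∷ xs) y m) + r * h (x ∷ x′ ∷ xs) y m)
      ≈⟨ +-congˡ (*-congˡ (h-swap x x′ xs y (suc m))) ⟩
    h (x′ ∷ x ∷ xs) y (2 ℕ.+ m) ∎
    where
    p = y x′
    r = y x

  h-↭ : ∀ {xs ys : List A} y → xs ↭ ys → ∀ m → h xs y m ≈ h ys y m
  h-↭ y Perm.refl           m = refl
  h-↭ y (prep x p)          m = h-prep x y (h-↭ y p) m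
  h-↭ y (swap x x′ p)       m = trans (h-swap x x′ _ y m) (h-prep x′ y (h-prep x y (h-↭ y p)) m)
  h-↭ y (Perm.trans p₁ p₂)  m = trans (h-↭ y p₁ m) (h-↭ y p₂ m)

  h-singleton : ∀ (x : A) y m → h (x ∷ []) y m ≈ y x ^ m
  h-singleton x y zero    = refl
  h-singleton x y (suc m) = trans (+-identityˡ _) (*-congˡ (h-singleton x y m))

  Σ-applyUpTo : ∀ (g : ℕ → A) n (f : A → Carrier) → Σ[] (applyUpTo g n) f ≈ Σ[] (upTo n) (f ∘ g)
  Σ-applyUpTo g zero    f = refl
  Σ-applyUpTo g (suc n) f = +-congˡ (begin
    Σ[] (applyUpTo (g ∘ suc) n) f    ≈⟨ Σ-applyUpTo (g ∘ suc) n f ⟩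
    Σ[] (upTo n) (f ∘ g ∘ suc)       ≈⟨ Σ-applyUpTo suc n (f ∘ g) ⟨
    Σ[] (applyUpTo suc n) (f ∘ g)    ∎)

  Σ-upTo-suc : ∀ n (f : ℕ → Carrier) → Σ[] (upTo (suc n)) f ≈ f 0 + Σ[] (upTo n) (f ∘ suc)
  Σ-upTo-suc n f = +-congˡ (Σ-applyUpTo suc n f)

  h-++ : ∀ (xs ys : List A) y m →
         h (xs ++ ys) y m ≈ Σ[] (upTo (suc m)) (λ i → h xs y i * h ys y (m ℕ.∸ i))
  h-++ [] ys y m = sym (begin
    Σ[] (upTo (suc m)) (λ i → h [] y i * h ys y (m ℕ.∸ i))
      ≈⟨ Σ-upTo-suc m _ ⟩
    1# * h ys y m + Σ[] (upTo m) (λ i → 0# * h ys y (m ℕ.∸ suc i))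
      ≈⟨ +-cong (*-identityˡ _) (trans (Σ-cong (upTo m) (λ _ → zeroˡ _)) (Σ-0 (upTo m))) ⟩
    h ys y m + 0#
      ≈⟨ +-identityʳ _ ⟩
    h ys y m ∎)
  h-++ (x ∷ xs) ys y zero    = h-++ xs ys y zero
  h-++ (x ∷ xs) ys y (suc m) = begin
    h (xs ++ ys) y (suc m) + y x * h (x ∷ xs ++ ys) y m
      ≈⟨ +-cong (trans (h-++ xs ys y (suc m)) (Σ-upTo-suc (suc m) _))
                (trans (*-congˡ (h-++ (x ∷ xs) ys y m)) (*-Σ (upTo (suc m)) _ _)) ⟩
    (first + Σ[] (upTo (suc m)) (λ i → h xs y (suc i) * h ys y (m ℕ.∸ i)))
      + Σ[] (upTo (suc m)) (λ i → y x * (h (x ∷ xs) y i * h ys y (m ℕ.∸ i)))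
      ≈⟨ trans (+-assoc _ _ _) (+-congˡ (sym (Σ-+ (upTo (suc m)) _ _))) ⟩
    first + Σ[] (upTo (suc m)) (λ i → h xs y (suc i) * h ys y (m ℕ.∸ i) + y x * (h (x ∷ xs) y i * h ys y (m ℕ.∸ i)))
      ≈⟨ +-congˡ (Σ-cong (upTo (suc m)) (λ i → trans (+-congˡ (sym (*-assoc _ _ _))) (sym (distribʳ _ _ _)))) ⟩
    first + Σ[] (upTo (suc m)) (λ i → h (x ∷ xs) y (suc i) * h ys y (m ℕ.∸ i))
      ≈⟨ Σ-upTo-suc (suc m) _ ⟨
    Σ[] (upTo (suc (suc m))) (λ i → h (x ∷ xs) y i * h ys y (suc m ℕ.∸ i)) ∎
    where first = h xs y 0 * h ys y (suc m)

  module Lagrange {a} {A : Set a} (y : A → Carrier) (D : Carrier) where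

    -- With invertible differences this would read `B x = D (y x)^(d+r) / ∏ (y x - y x′)`, where r
    -- counts the other nodes. For d = 0 these are the partial fraction coefficients of D times the
    -- generating function of `h`. The shift d serves the induction: deleting a node multiplies the
    -- weights by a difference and keeps the exponent d + r while lowering r, so d goes up by one.
    Weights : ℕ → List A → (A → Carrier) → Set _
    Weights d xs B = ∀ x ys → xs ↭ x ∷ ys → B x * Π[] ys (λ x′ → y x - y x′) ≈ D * y x ^ (d ℕ.+ length ys)

    private
      G : List A → (A → Carrier) → ℕ → Carrier
      G xs B m = Σ[] xs (λ x → B x * y x ^ m)

      error : ℕ → List A → (A → Carrier) → ℕ → Carrier
      error d xs B m = G xs B m - D * h xs y (m ℕ.+ d)

      error-suc : ∀ d x xs B → (∀ m → G xs (λ x′ → B x′ * (y x′ - y x)) m ≈ D * h xs y (m ℕ.+ suc d)) →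
                  ∀ m → error d (x ∷ xs) B (suc m) ≈ y x * error d (x ∷ xs) B m
      error-suc d x xs B IH m = begin
        (B x * (y x * y x ^ m) + G xs B (suc m)) - D * (h xs y (suc (m ℕ.+ d)) + y x * h (x ∷ xs) y (m ℕ.+ d))
          ≈⟨ +-congʳ (+-congˡ split) ⟩
        (B x * (y x * y x ^ m) + (D * h xs y (suc (m ℕ.+ d)) + y x * G xs B m))
          - D * (h xs y (suc (m ℕ.+ d)) + y x * h (x ∷ xs) y (m ℕ.+ d))
          ≈⟨ solve 7 (λ b y₁ yᵐ d₁ h₁ g h₂ →
               (b :* (y₁ :* yᵐ) :+ (d₁ :* h₁ :+ y₁ :* g)) :- d₁ :* (h₁ :+ y₁ :* h₂)
               := y₁ :* ((b :* yᵐ :+ g) :- d₁ :* h₂)) refl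
               (B x) (y x) (y x ^ m) D (h xs y (suc (m ℕ.+ d))) (G xs B m) (h (x ∷ xs) y (m ℕ.+ d)) ⟩
        y x * ((B x * y x ^ m + G xs B m) - D * h (x ∷ xs) y (m ℕ.+ d)) ∎
        where
        split : G xs B (suc m) ≈ D * h xs y (suc (m ℕ.+ d)) + y x * G xs B m
        split = begin
          G xs B (suc m)
            ≈⟨ Σ-cong xs (λ x′ → solve 4 (λ b y₁ y₂ yᵐ →
                 b :* (y₁ :* yᵐ) := b :* (y₁ :- y₂) :* yᵐ :+ y₂ :* (b :* yᵐ)) refl (B x′) (y x′) (y x) (y x′ ^ m)) ⟩
          Σ[] xs (λ x′ → B x′ * (y x′ - y x) * y x′ ^ m + y x * (B x′ * y x′ ^ m))
            ≈⟨ Σ-+ xs _ _ ⟩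
          G xs (λ x′ → B x′ * (y x′ - y x)) m + Σ[] xs (λ x′ → y x * (B x′ * y x′ ^ m))
            ≈⟨ +-cong (trans (IH m) (*-congˡ (reflexive (≡.cong (h xs y) (ℕ.+-suc m d))))) (sym (*-Σ xs (y x) _)) ⟩
          D * h xs y (suc (m ℕ.+ d)) + y x * G xs B m ∎

      remove : ∀ {d x xs B} → Weights d (x ∷ xs) B → Weights (suc d) xs (λ x′ → B x′ * (y x′ - y x))
      remove {d} {x} {xs} {B} w x′ ys p = begin
        B x′ * (y x′ - y x) * Π[] ys (λ x″ → y x′ - y x″)   ≈⟨ *-assoc _ _ _ ⟩
        B x′ * ((y x′ - y x) * Π[] ys (λ x″ → y x′ - y x″)) ≈⟨ w x′ (x ∷ ys) (↭-trans (prep x p) (swap x x′ ↭-refl)) ⟩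
        D * y x′ ^ (d ℕ.+ suc (length ys))                  ≡⟨ ≡.cong (λ n → D * y x′ ^ n) (ℕ.+-suc d (length ys)) ⟩
        D * y x′ ^ (suc d ℕ.+ length ys)                    ∎

      go : ∀ n d x xs B → length xs ≡ n → AllPairs (λ x x′ → Regular (y x - y x′)) (x ∷ xs) →
           Weights d (x ∷ xs) B → ∀ m → G (x ∷ xs) B m ≈ D * h (x ∷ xs) y (m ℕ.+ d)
      go zero d x [] B eq reg w m = begin
        B x * y x ^ m + 0#              ≈⟨ +-identityʳ _ ⟩
        B x * y x ^ m                   ≈⟨ *-congʳ (trans (sym (*-identityʳ _)) (w x [] ↭-refl)) ⟩
        D * y x ^ (d ℕ.+ 0) * y x ^ m   ≡⟨ ≡.cong (λ n → D * y x ^ n * y x ^ m) (ℕ.+-identityʳ d) ⟩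
        D * y x ^ d * y x ^ m           ≈⟨ trans (*-assoc _ _ _) (*-congˡ (*-comm _ _)) ⟩
        D * (y x ^ m * y x ^ d)         ≈⟨ *-congˡ (^-homo-* (y x) m d) ⟨
        D * y x ^ (m ℕ.+ d)             ≈⟨ *-congˡ (h-singleton x y (m ℕ.+ d)) ⟨
        D * h (x ∷ []) y (m ℕ.+ d)      ∎
      go (suc n) d x (x′ ∷ xs) B eq ((rx ∷ rxs) ∷ rx′ ∷ rs) w m =
        x-y≈0⇒x≈y _ _ (rx _ (begin
          (y x - y x′) * err m         ≈⟨ trans (*-comm _ _) (trans (x[y-z]≈xy-xz _ _ _) (+-cong (*-comm _ _) (-‿cong (*-comm _ _)))) ⟩
          y x * err m - y x′ * err m   ≈⟨ +-cong (step₁ m) (-‿cong (step₂ m)) ⟨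
          err (suc m) - err (suc m)    ≈⟨ -‿inverseʳ _ ⟩
          0#                           ∎))
        where
        err = error d (x ∷ x′ ∷ xs) B
        swapped : x ∷ x′ ∷ xs ↭ x′ ∷ x ∷ xs
        swapped = swap x x′ ↭-refl
        err-swap : ∀ m → err m ≈ error d (x′ ∷ x ∷ xs) B m
        err-swap m = +-cong (Σ-↭ _ swapped) (-‿cong (*-congˡ (h-↭ y swapped (m ℕ.+ d))))
        step₁ : ∀ m → err (suc m) ≈ y x * err m
        step₁ = error-suc d x (x′ ∷ xs) B
          (go n (suc d) x′ xs _ (ℕ.suc-injective eq) (rx′ ∷ rs) (remove {d} {x} {x′ ∷ xs} {B} w))
        step₂ : ∀ m → err (suc m) ≈ y x′ * err m
        step₂ m = trans (err-swap (suc m)) (trans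
          (error-suc d x′ (x ∷ xs) B
            (go n (suc d) x xs _ (ℕ.suc-injective eq) (rxs ∷ rs)
              (remove {d} {x′} {x ∷ xs} {B} (λ z zs p → w z zs (↭-trans swapped p)))) m)
          (*-congˡ (sym (err-swap m))))

    -- Both sides satisfy the same recursion after any one of the nodes x is
    -- removed, so their difference is an eigenvector of the shift for each
    -- eigenvalue y x; two distinct nodes force it to vanish.
    lagrange : ∀ x xs B → AllPairs (λ x x′ → Regular (y x - y x′)) (x ∷ xs) → Weights 0 (x ∷ xs) B →
               ∀ m → Σ[] (x ∷ xs) (λ x′ → B x′ * y x′ ^ m) ≈ D * h (x ∷ xs) y m
    lagrange x xs B reg w m =
      trans (go (length xs) 0 x xs B ≡.refl reg w m) (*-congˡ (reflexive (≡.cong (h (x ∷ xs) y) (ℕ.+-identityʳ m))))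

-- Homogenised q-shifted factorials and the cancellation of poles

module QProducts {c ℓ} (R : CommutativeRing c ℓ) (q : CommutativeRing.Carrier R) where
  open CommutativeRing R hiding (zero)
  open BigRing R
  open CompleteHomogeneous R
  open QPochhammer rawRing using (qPoch)
  open Exp semiring using (_^_; ^-homo-*; ^-congˡ)
  open CExp commutativeSemiring using (^-distrib-*)
  open IntegerSolver R
  open SetoidReasoning setoid

  -- The homogenised symbol aⁿ (z/a;q)ₙ.
  pp : ℕ → Carrier → Carrier → Carrier
  pp zero    a z = 1#
  pp (suc n) a z = pp n a z * (a - q ^ n * z)

  qPoch≡pp : ∀ z n → qPoch z q n ≡ pp n 1# z
  qPoch≡pp z zero    = ≡.refl
  qPoch≡pp z (suc n) = ≡.cong (_* (1# - q ^ n * z)) (qPoch≡pp z n)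

  pp-cong : ∀ n {a a′ z z′} → a ≈ a′ → z ≈ z′ → pp n a z ≈ pp n a′ z′
  pp-cong zero    a≈ z≈ = refl
  pp-cong (suc n) a≈ z≈ = *-cong (pp-cong n a≈ z≈) (+-cong a≈ (-‿cong (*-congˡ z≈)))

  pp-head : ∀ n a z → pp (suc n) a z ≈ (a - z) * pp n a (q * z)
  pp-head zero    a z = solve 2 (λ a z → con 1ℤ :* (a :- con 1ℤ :* z) := (a :- z) :* con 1ℤ) refl a z
  pp-head (suc n) a z = begin
    pp (suc n) a z * (a - q * q ^ n * z)               ≈⟨ *-congʳ (pp-head n a z) ⟩
    (a - z) * pp n a (q * z) * (a - q * q ^ n * z)
      ≈⟨ solve 5 (λ a z p q qⁿ → (a :- z) :* p :* (a :- q :* qⁿ :* z) := (a :- z) :* (p :* (a :- qⁿ :* (q :* z)))) refl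
           a z (pp n a (q * z)) q (q ^ n) ⟩
    (a - z) * (pp n a (q * z) * (a - q ^ n * (q * z))) ∎

  pp-+ : ∀ m n a z → pp (m ℕ.+ n) a z ≈ pp m a z * pp n a (q ^ m * z)
  pp-+ zero    n a z = trans (pp-cong n refl (sym (*-identityˡ z))) (sym (*-identityˡ _))
  pp-+ (suc m) n a z = begin
    pp (suc (m ℕ.+ n)) a z                              ≈⟨ pp-head (m ℕ.+ n) a z ⟩
    (a - z) * pp (m ℕ.+ n) a (q * z)                    ≈⟨ *-congˡ (pp-+ m n a (q * z)) ⟩
    (a - z) * (pp m a (q * z) * pp n a (q ^ m * (q * z))) ≈⟨ *-assoc _ _ _ ⟨
    (a - z) * pp m a (q * z) * pp n a (q ^ m * (q * z))
      ≈⟨ *-cong (sym (pp-head m a z)) (pp-cong n refl (trans (sym (*-assoc _ _ _)) (*-congʳ (*-comm _ _)))) ⟩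
    pp (suc m) a z * pp n a (q * q ^ m * z)             ∎

  pp-scale : ∀ n w a z → pp n (w * a) (w * z) ≈ w ^ n * pp n a z
  pp-scale zero    w a z = sym (*-identityˡ 1#)
  pp-scale (suc n) w a z = begin
    pp n (w * a) (w * z) * (w * a - q ^ n * (w * z)) ≈⟨ *-congʳ (pp-scale n w a z) ⟩
    w ^ n * pp n a z * (w * a - q ^ n * (w * z))
      ≈⟨ solve 6 (λ w wⁿ p a z qⁿ → wⁿ :* p :* (w :* a :- qⁿ :* (w :* z)) := w :* wⁿ :* (p :* (a :- qⁿ :* z))) refl
           w (w ^ n) (pp n a z) a z (q ^ n) ⟩
    w * w ^ n * (pp n a z * (a - q ^ n * z))         ∎

  pp-Π : ∀ n a z → Π[] (upTo n) (λ b → a - q ^ b * z) ≈ pp n a z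
  pp-Π zero    a z = refl
  pp-Π (suc n) a z = begin
    Π[] (upTo (suc n)) f         ≡⟨ ≡.cong (λ xs → Π[] xs f) (List.applyUpTo-∷ʳ (λ i → i) n) ⟨
    Π[] (upTo n List.∷ʳ n) f     ≈⟨ Π-↭ f (∷↭∷ʳ n (upTo n)) ⟨
    f n * Π[] (upTo n) f         ≈⟨ *-comm _ _ ⟩
    Π[] (upTo n) f * f n         ≈⟨ *-congʳ (pp-Π n a z) ⟩
    pp n a z * f n               ∎
    where f = λ b → a - q ^ b * z

  -- The coefficient of Xⁿ in the q-binomial theorem for 1/(X;q)_β, and the source of the quotients
  -- (q^β;q)_n/(q;q)_n in c_λ. With the node `q ^ β` moved to the front, the recursion of `h`
  -- reduces `(suc β , suc n)` to `(β , suc n)` and `(suc β , n)`.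
  q-binomial : ∀ β n → pp n 1# q * h (upTo β) (q ^_) n ≈ pp n 1# (q ^ β)
  q-binomial β       zero    = trans (*-identityˡ _) (reflexive (h-0 (upTo β) (q ^_)))
  q-binomial zero    (suc n) = begin
    pp (suc n) 1# q * 0#          ≈⟨ zeroʳ _ ⟩
    0#                            ≈⟨ zeroˡ _ ⟨
    0# * pp n 1# (q * 1#)         ≈⟨ *-congʳ (-‿inverseʳ 1#) ⟨
    (1# - 1#) * pp n 1# (q * 1#)  ≈⟨ pp-head n 1# 1# ⟨
    pp (suc n) 1# 1#              ∎
  q-binomial (suc β) (suc n) = begin
    pp (suc n) 1# q * h (upTo (suc β)) (q ^_) (suc n)
      ≈⟨ *-congˡ (h-upTo-suc (suc n)) ⟩
    pp (suc n) 1# q * (h (upTo β) (q ^_) (suc n) + q ^ β * h (β ∷ upTo β) (q ^_) n)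
      ≈⟨ trans (distribˡ _ _ _) (+-cong (q-binomial β (suc n)) (*-congˡ (*-congˡ (sym (h-upTo-suc n))))) ⟩
    pp (suc n) 1# (q ^ β) + pp n 1# q * (1# - q ^ n * q) * (q ^ β * h (upTo (suc β)) (q ^_) n)
      ≈⟨ +-cong (pp-head n 1# (q ^ β))
           (solve 4 (λ p f q^β h → p :* f :* (q^β :* h) := f :* q^β :* (p :* h)) refl _ _ _ _) ⟩
    (1# - q ^ β) * pp n 1# (q * q ^ β) + (1# - q ^ n * q) * q ^ β * (pp n 1# q * h (upTo (suc β)) (q ^_) n)
      ≈⟨ +-congˡ (*-congˡ (q-binomial (suc β) n)) ⟩
    (1# - q ^ β) * pp n 1# (q * q ^ β) + (1# - q ^ n * q) * q ^ β * pp n 1# (q * q ^ β)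
      ≈⟨ solve 4 (λ p x qⁿ q^β → (con 1ℤ :- q^β) :* p :+ (con 1ℤ :- qⁿ :* x) :* q^β :* p
           := p :* (con 1ℤ :- qⁿ :* (x :* q^β))) refl (pp n 1# (q * q ^ β)) q (q ^ n) (q ^ β) ⟩
    pp n 1# (q * q ^ β) * (1# - q ^ n * (q * q ^ β)) ∎
    where
    h-upTo-suc : ∀ m → h (upTo (suc β)) (q ^_) m ≈ h (β ∷ upTo β) (q ^_) m
    h-upTo-suc m = trans (reflexive (≡.cong (λ xs → h xs (q ^_) m) (≡.sym (List.applyUpTo-∷ʳ (λ i → i) β))))
                         (h-↭ (q ^_) (↭-sym (∷↭∷ʳ β (upTo β))) m)

  -- The polynomials p_{ijb}, for j < i and for i < j, in u = zᵢ/zⱼ with β = βⱼ.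
  cofactor> cofactor< : Carrier → ℕ → ℕ → ℕ → Carrier
  cofactor> u β b n = pp b (q ^ β) (q * u) * pp n 1# (q ^ b * (q * u))
  cofactor< u β b n = pp (suc b) (q ^ β) u * pp n 1# (q ^ suc b * u)

  module Cancellation (u v : Carrier) (uv≈1 : u * v ≈ 1#) where

    reflect : ∀ a b → a - b * u ≈ - u * (b - a * v)
    reflect a b = begin
      a - b * u                 ≈⟨ +-congʳ (trans (sym (*-identityʳ a)) (*-congˡ (sym uv≈1))) ⟩
      a * (u * v) - b * u       ≈⟨ solve 4 (λ a b u v → a :* (u :* v) :- b :* u := :- u :* (b :- a :* v)) refl a b u v ⟩
      - u * (b - a * v)         ∎

    pp-reflect : ∀ b β → pp b 1# (q * u) * (q ^ b) ^ β * pp β 1# v ≈ pp β (q ^ b) v * pp b (q ^ β) (q * u)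
    pp-reflect zero β = begin
      1# * 1# ^ β * pp β 1# v  ≈⟨ *-congʳ (trans (*-identityˡ _) (1^ β)) ⟩
      1# * pp β 1# v           ≈⟨ *-comm _ _ ⟩
      pp β 1# v * 1#           ∎
    pp-reflect (suc b) β = begin
      pp b 1# (q * u) * (1# - X * (q * u)) * (q * X) ^ β * pp β 1# v
        ≈⟨ *-congʳ (*-congˡ (^-distrib-* q X β)) ⟩
      pp b 1# (q * u) * (1# - X * (q * u)) * (q ^ β * X ^ β) * pp β 1# v
        ≈⟨ solve 5 (λ p f q^β X^β r → p :* f :* (q^β :* X^β) :* r := (p :* X^β :* r) :* (f :* q^β)) refl _ _ _ _ _ ⟩
      pp b 1# (q * u) * X ^ β * pp β 1# v * ((1# - X * (q * u)) * q ^ β)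
        ≈⟨ *-congʳ (pp-reflect b β) ⟩
      pp β X v * pp b (q ^ β) (q * u) * ((1# - X * (q * u)) * q ^ β)
        ≈⟨ *-congˡ (*-congʳ (trans (+-congˡ (-‿cong (xqu X))) (reflect 1# (q * X)))) ⟩
      pp β X v * pp b (q ^ β) (q * u) * (- u * (q * X - 1# * v) * q ^ β)
        ≈⟨ solve 7 (λ p r u q X v q^β → p :* r :* (:- u :* (q :* X :- con 1ℤ :* v) :* q^β)
             := r :* (:- u :* ((q :* X :- v) :* (q^β :* p)))) refl _ _ _ _ _ _ _ ⟩
      pp b (q ^ β) (q * u) * (- u * ((q * X - v) * (q ^ β * pp β X v)))
        ≈⟨ *-congˡ (*-congˡ shift) ⟨
      pp b (q ^ β) (q * u) * (- u * (pp β (q * X) v * (q * X - q ^ β * v)))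
        ≈⟨ solve 6 (λ r u p x q^β v → r :* (:- u :* (p :* (x :- q^β :* v))) := p :* (r :* (:- u :* (x :- q^β :* v)))) refl
             _ _ _ _ _ _ ⟩
      pp β (q * X) v * (pp b (q ^ β) (q * u) * (- u * (q * X - q ^ β * v)))
        ≈⟨ *-congˡ (*-congˡ (trans (+-congˡ (-‿cong (xqu X))) (reflect (q ^ β) (q * X)))) ⟨
      pp β (q * X) v * (pp b (q ^ β) (q * u) * (q ^ β - X * (q * u))) ∎
      where
      X = q ^ b
      xqu : ∀ x → x * (q * u) ≈ q * x * u
      xqu x = trans (sym (*-assoc _ _ _)) (*-congʳ (*-comm _ _))
      shift : pp β (q * X) v * (q * X - q ^ β * v) ≈ (q * X - v) * (q ^ β * pp β X v)
      shift = trans (pp-head β (q * X) v) (*-congˡ (pp-scale β q X v))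

    -- The exponent e = 0, which `pp-reflect` leaves out. It is needed for i < j, where N contains
    -- (q z_j/z_i;q)_{β_j} and not (z_j/z_i;q)_{β_j}.
    pp-reflect₀ : ∀ β → (q ^ β - u) * pp β 1# v ≈ (1# - u) * pp β 1# (q * v)
    pp-reflect₀ β = begin
      (q ^ β - u) * pp β 1# v                  ≈⟨ *-congʳ (trans (+-congˡ (-‿cong (sym (*-identityˡ u)))) (reflect (q ^ β) 1#)) ⟩
      - u * (1# - q ^ β * v) * pp β 1# v       ≈⟨ trans (*-assoc _ _ _) (*-congˡ (*-comm _ _)) ⟩
      - u * (pp β 1# v * (1# - q ^ β * v))     ≈⟨ *-congˡ (pp-head β 1# v) ⟩
      - u * ((1# - v) * pp β 1# (q * v))       ≈⟨ *-assoc _ _ _ ⟨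
      - u * (1# - v) * pp β 1# (q * v)         ≈⟨ *-congʳ (*-congˡ (+-congˡ (-‿cong (sym (*-identityˡ v))))) ⟩
      - u * (1# - 1# * v) * pp β 1# (q * v)    ≈⟨ *-congʳ (reflect 1# 1#) ⟨
      (1# - 1# * u) * pp β 1# (q * v)          ≈⟨ *-congʳ (+-congˡ (-‿cong (*-identityˡ u))) ⟩
      (1# - u) * pp β 1# (q * v)               ∎

    -- For `n = β_i - b` the bracket on the right is the factor of N that belongs to j < i. The
    -- first b of its factors in `q * u` are used up by `pp-reflect`; the other n are carried along
    -- into the cofactor.
    cofactor>-spec : ∀ zᵢ β b n →
      cofactor> u β b n * pp β (zᵢ * q ^ b) (zᵢ * v) ≈ (pp β 1# v * pp (b ℕ.+ n) 1# (q * u)) * (zᵢ * q ^ b) ^ β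
    cofactor>-spec zᵢ β b n = begin
      p * r * pp β (zᵢ * q ^ b) (zᵢ * v)
        ≈⟨ *-congˡ (pp-scale β zᵢ (q ^ b) v) ⟩
      p * r * (zᵢ ^ β * pp β (q ^ b) v)
        ≈⟨ solve 4 (λ p r z s → p :* r :* (z :* s) := s :* p :* r :* z) refl _ _ _ _ ⟩
      pp β (q ^ b) v * p * r * zᵢ ^ β
        ≈⟨ *-congʳ (*-congʳ (pp-reflect b β)) ⟨
      pp b 1# (q * u) * (q ^ b) ^ β * pp β 1# v * r * zᵢ ^ β
        ≈⟨ solve 5 (λ p x s r z → p :* x :* s :* r :* z := (s :* (p :* r)) :* (z :* x)) refl _ _ _ _ _ ⟩
      (pp β 1# v * (pp b 1# (q * u) * r)) * (zᵢ ^ β * (q ^ b) ^ β)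
        ≈⟨ *-cong (*-congˡ (pp-+ b n 1# (q * u))) (^-distrib-* zᵢ (q ^ b) β) ⟨
      (pp β 1# v * pp (b ℕ.+ n) 1# (q * u)) * (zᵢ * q ^ b) ^ β ∎
      where
      p = pp b (q ^ β) (q * u)
      r = pp n 1# (q ^ b * (q * u))

    -- The same for i < j, with `n = β_i - (b + 1)`: here `pp-reflect₀` uses up one more factor in
    -- u, the one with exponent 0.
    cofactor<-spec : ∀ zᵢ β b n →
      cofactor< u β b n * pp β (zᵢ * q ^ b) (zᵢ * v) ≈ (pp (suc b ℕ.+ n) 1# u * pp β 1# (q * v)) * (zᵢ * q ^ b) ^ β
    cofactor<-spec zᵢ β b n = begin
      pp (suc b) (q ^ β) u * r * pp β (zᵢ * q ^ b) (zᵢ * v)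
        ≈⟨ *-cong (*-congʳ (pp-head b (q ^ β) u)) (pp-scale β zᵢ (q ^ b) v) ⟩
      (q ^ β - u) * p * r * (zᵢ ^ β * pp β (q ^ b) v)
        ≈⟨ solve 5 (λ f p r z s → f :* p :* r :* (z :* s) := f :* (s :* p) :* r :* z) refl _ _ _ _ _ ⟩
      (q ^ β - u) * (pp β (q ^ b) v * p) * r * zᵢ ^ β
        ≈⟨ *-congʳ (*-congʳ (*-congˡ (pp-reflect b β))) ⟨
      (q ^ β - u) * (pp b 1# (q * u) * (q ^ b) ^ β * pp β 1# v) * r * zᵢ ^ β
        ≈⟨ solve 6 (λ f p x s r z → f :* (p :* x :* s) :* r :* z := (f :* s) :* p :* r :* (z :* x)) refl _ _ _ _ _ _ ⟩
      ((q ^ β - u) * pp β 1# v) * pp b 1# (q * u) * r * (zᵢ ^ β * (q ^ b) ^ β)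
        ≈⟨ *-cong (*-congʳ (*-congʳ (pp-reflect₀ β))) (sym (^-distrib-* zᵢ (q ^ b) β)) ⟩
      ((1# - u) * pp β 1# (q * v)) * pp b 1# (q * u) * r * (zᵢ * q ^ b) ^ β
        ≈⟨ solve 5 (λ f s p r z → (f :* s) :* p :* r :* z := (f :* p :* r :* s) :* z) refl _ _ _ _ _ ⟩
      ((1# - u) * pp b 1# (q * u) * r * pp β 1# (q * v)) * (zᵢ * q ^ b) ^ β
        ≈⟨ *-congʳ (*-congʳ (trans (pp-+ (suc b) n 1# u) (*-congʳ (pp-head b 1# u)))) ⟨
      (pp (suc b ℕ.+ n) 1# u * pp β 1# (q * v)) * (zᵢ * q ^ b) ^ β ∎
      where
      p = pp b (q ^ β) (q * u)
      r = pp n 1# (q ^ suc b * u)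

-- Laurent polynomials

module MonoidRing {c ℓ} (R : CommutativeRing c ℓ) {E : Set} (_≟_ : DecidableEquality E)
                  (_∙_ : E → E → E) (ε : E) (isCM : IsCommutativeMonoid _≡_ _∙_ ε) where
  open CommutativeRing R hiding (zero)
  open RingProperties ring using (-‿distribˡ-*; -0#≈0#)
  open BigRing R using (+-exchange; x-y≈0⇒x≈y)
  open SetoidReasoning setoid
  private module M = IsCommutativeMonoid isCM

  Poly : Set c
  Poly = List (Carrier × E)

  -- The coefficients are the case φ = δ k; the ring laws are checked against
  -- an arbitrary φ, where they become identities between finite sums.
  ⟨_,_⟩ : (E → Carrier) → Poly → Carrier
  ⟨ φ , []          ⟩ = 0#
  ⟨ φ , (a , e) ∷ p ⟩ = a * φ e + ⟨ φ , p ⟩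

  δ : E → E → Carrier
  δ k e = if ⌊ e ≟ k ⌋ then 1# else 0#

  coeff : E → Poly → Carrier
  coeff k p = ⟨ δ k , p ⟩

  infix 4 _≋_
  record _≋_ (p r : Poly) : Set ℓ where
    constructor mk
    field at : ∀ k → coeff k p ≈ coeff k r
  open _≋_ public

  infixl 7 _⊛_
  _⊛_ : Poly → Poly → Poly
  _⊛_ = cartesianProductWith (λ x y → proj₁ x * proj₁ y , proj₂ x ∙ proj₂ y)

  neg : Poly → Poly
  neg = List.map (λ x → - proj₁ x , proj₂ x)

  mono : Carrier → E → Poly
  mono a e = (a , e) ∷ []

  const : Carrier → Poly
  const a = mono a ε

  δ-≡ : ∀ k → δ k k ≈ 1#
  δ-≡ k with k ≟ k
  ... | yes _   = refl
  ... | no  k≢k = ⊥-elim (k≢k ≡.refl)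

  δ-≢ : ∀ {k e} → e ≢ k → δ k e ≈ 0#
  δ-≢ {k} {e} e≢k with e ≟ k
  ... | yes e≡k = ⊥-elim (e≢k e≡k)
  ... | no  _   = refl

  ⟨⟩-cong : ∀ {φ ψ} → (∀ e → φ e ≈ ψ e) → ∀ p → ⟨ φ , p ⟩ ≈ ⟨ ψ , p ⟩
  ⟨⟩-cong φ≈ψ []            = refl
  ⟨⟩-cong φ≈ψ ((a , e) ∷ p) = +-cong (*-congˡ (φ≈ψ e)) (⟨⟩-cong φ≈ψ p)

  ⟨⟩-0 : ∀ p → ⟨ (λ _ → 0#) , p ⟩ ≈ 0#
  ⟨⟩-0 []            = refl
  ⟨⟩-0 ((a , e) ∷ p) = trans (+-cong (zeroʳ a) (⟨⟩-0 p)) (+-identityˡ 0#)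

  ⟨⟩-+ : ∀ φ ψ p → ⟨ (λ e → φ e + ψ e) , p ⟩ ≈ ⟨ φ , p ⟩ + ⟨ ψ , p ⟩
  ⟨⟩-+ φ ψ []            = sym (+-identityˡ 0#)
  ⟨⟩-+ φ ψ ((a , e) ∷ p) = trans (+-cong (distribˡ a _ _) (⟨⟩-+ φ ψ p)) (+-exchange _ _ _ _)

  ⟨⟩-* : ∀ x φ p → ⟨ (λ e → x * φ e) , p ⟩ ≈ x * ⟨ φ , p ⟩
  ⟨⟩-* x φ []            = sym (zeroʳ x)
  ⟨⟩-* x φ ((a , e) ∷ p) = begin
    a * (x * φ e) + ⟨ (λ e → x * φ e) , p ⟩ ≈⟨ +-cong (trans (sym (*-assoc _ _ _)) (trans (*-congʳ (*-comm _ _)) (*-assoc _ _ _))) (⟨⟩-* x φ p) ⟩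
    x * (a * φ e) + x * ⟨ φ , p ⟩           ≈⟨ distribˡ _ _ _ ⟨
    x * (a * φ e + ⟨ φ , p ⟩)               ∎

  ⟨⟩-++ : ∀ φ p r → ⟨ φ , p ++ r ⟩ ≈ ⟨ φ , p ⟩ + ⟨ φ , r ⟩
  ⟨⟩-++ φ []            r = sym (+-identityˡ _)
  ⟨⟩-++ φ ((a , e) ∷ p) r = trans (+-congˡ (⟨⟩-++ φ p r)) (sym (+-assoc _ _ _))

  ⟨⟩-neg : ∀ φ p → ⟨ φ , neg p ⟩ ≈ - ⟨ φ , p ⟩
  ⟨⟩-neg φ []            = sym -0#≈0#
  ⟨⟩-neg φ ((a , e) ∷ p) = trans (+-cong (sym (-‿distribˡ-* a (φ e))) (⟨⟩-neg φ p)) (⁻¹-∙-comm _ _)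
    where open import Algebra.Properties.AbelianGroup +-abelianGroup using (⁻¹-∙-comm)

  ⟨⟩-mono-⊛ : ∀ φ a e p → ⟨ φ , List.map (λ y → a * proj₁ y , e ∙ proj₂ y) p ⟩ ≈ a * ⟨ (λ f → φ (e ∙ f)) , p ⟩
  ⟨⟩-mono-⊛ φ a e []            = sym (zeroʳ a)
  ⟨⟩-mono-⊛ φ a e ((b , f) ∷ p) = trans (+-cong (*-assoc _ _ _) (⟨⟩-mono-⊛ φ a e p)) (sym (distribˡ _ _ _))

  ⟨⟩-⊛ : ∀ φ p r → ⟨ φ , p ⊛ r ⟩ ≈ ⟨ (λ e → ⟨ (λ f → φ (e ∙ f)) , r ⟩) , p ⟩
  ⟨⟩-⊛ φ []            r = refl
  ⟨⟩-⊛ φ ((a , e) ∷ p) r = trans (⟨⟩-++ φ (List.map _ r) (p ⊛ r)) (+-cong (⟨⟩-mono-⊛ φ a e r) (⟨⟩-⊛ φ p r))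

  ⟨⟩-swap : ∀ (φ : E → E → Carrier) p r → ⟨ (λ e → ⟨ φ e , r ⟩) , p ⟩ ≈ ⟨ (λ f → ⟨ (λ e → φ e f) , p ⟩) , r ⟩
  ⟨⟩-swap φ []            r = sym (⟨⟩-0 r)
  ⟨⟩-swap φ ((a , e) ∷ p) r = begin
    a * ⟨ φ e , r ⟩ + ⟨ (λ e → ⟨ φ e , r ⟩) , p ⟩
      ≈⟨ +-cong (sym (⟨⟩-* a (φ e) r)) (⟨⟩-swap φ p r) ⟩
    ⟨ (λ f → a * φ e f) , r ⟩ + ⟨ (λ f → ⟨ (λ e → φ e f) , p ⟩) , r ⟩
      ≈⟨ ⟨⟩-+ _ _ r ⟨
    ⟨ (λ f → a * φ e f + ⟨ (λ e → φ e f) , p ⟩) , r ⟩ ∎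

  -- Exponents may repeat in the list p, so its terms need not vanish one by one. The values of φ
  -- are switched off at one exponent k after another, and each time `φ k * coeff k p` splits off,
  -- which is 0 by assumption. The invariant is that every exponent of p is still to be treated or
  -- is one where φ already vanishes.
  ⟨⟩-vanish : ∀ φ p → (∀ e → coeff e p * φ e ≈ 0#) → ⟨ φ , p ⟩ ≈ 0#
  ⟨⟩-vanish φ p = go (List.map proj₂ p) φ (inj₁ ∘ ∈-map⁺ proj₂)
    where
    off : E → (E → Carrier) → E → Carrier
    off k φ e = if ⌊ e ≟ k ⌋ then 0# else φ e

    off-≡ : ∀ k φ → off k φ k ≈ 0#
    off-≡ k φ with k ≟ k
    ... | yes _   = refl
    ... | no  k≢k = ⊥-elim (k≢k ≡.refl)

    off-cases : ∀ k φ e → off k φ e ≈ 0# ⊎ off k φ e ≈ φ e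
    off-cases k φ e with e ≟ k
    ... | yes _ = inj₁ refl
    ... | no  _ = inj₂ refl

    split : ∀ k φ e → φ e ≈ φ k * δ k e + off k φ e
    split k φ e with e ≟ k
    ... | yes ≡.refl = sym (trans (+-identityʳ _) (*-identityʳ _))
    ... | no  _      = sym (trans (+-congʳ (zeroʳ _)) (+-identityˡ _))

    all-zero : ∀ φ p → (∀ {x} → x ∈ p → φ (proj₂ x) ≈ 0#) → ⟨ φ , p ⟩ ≈ 0#
    all-zero φ []      hyp = refl
    all-zero φ (x ∷ p) hyp =
      trans (+-cong (trans (*-congˡ (hyp (here ≡.refl))) (zeroʳ _)) (all-zero φ p (hyp ∘ there))) (+-identityˡ 0#)

    go : ∀ ks φ → (∀ {x} → x ∈ p → proj₂ x ∈ ks ⊎ φ (proj₂ x) ≈ 0#) →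
         (∀ e → coeff e p * φ e ≈ 0#) → ⟨ φ , p ⟩ ≈ 0#
    go []       φ cover hyp = all-zero φ p (λ x∈p → [ (λ ()) , (λ eq → eq) ]′ (cover x∈p))
    go (k ∷ ks) φ cover hyp = begin
      ⟨ φ , p ⟩                                     ≈⟨ ⟨⟩-cong (split k φ) p ⟩
      ⟨ (λ e → φ k * δ k e + off k φ e) , p ⟩       ≈⟨ ⟨⟩-+ _ _ p ⟩
      ⟨ (λ e → φ k * δ k e) , p ⟩ + ⟨ off k φ , p ⟩ ≈⟨ +-cong (⟨⟩-* (φ k) (δ k) p) (go ks (off k φ) cover′ hyp′) ⟩
      φ k * coeff k p + 0#                          ≈⟨ trans (+-identityʳ _) (*-comm _ _) ⟩
      coeff k p * φ k                               ≈⟨ hyp k ⟩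
      0#                                            ∎
      where
      hyp′ : ∀ e → coeff e p * off k φ e ≈ 0#
      hyp′ e with off-cases k φ e
      ... | inj₁ eq = trans (*-congˡ eq) (zeroʳ _)
      ... | inj₂ eq = trans (*-congˡ eq) (hyp e)
      cover′ : ∀ {x} → x ∈ p → proj₂ x ∈ ks ⊎ off k φ (proj₂ x) ≈ 0#
      cover′ {x} x∈p with cover x∈p | off-cases k φ (proj₂ x)
      ... | _                   | inj₁ eq = inj₂ eq
      ... | inj₁ (here ≡.refl)  | inj₂ _  = inj₂ (off-≡ k φ)
      ... | inj₁ (there e∈ks)   | inj₂ _  = inj₁ e∈ks
      ... | inj₂ eq             | inj₂ e₂ = inj₂ (trans e₂ eq)

  -- This makes multiplication well defined on `≋`: by `⟨⟩-⊛` a product is paired with φ one factor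
  -- at a time.
  ⟨⟩-resp : ∀ φ {p r} → p ≋ r → ⟨ φ , p ⟩ ≈ ⟨ φ , r ⟩
  ⟨⟩-resp φ {p} {r} p≋r = x-y≈0⇒x≈y _ _ (begin
    ⟨ φ , p ⟩ - ⟨ φ , r ⟩  ≈⟨ trans (⟨⟩-++ φ p (neg r)) (+-congˡ (⟨⟩-neg φ r)) ⟨
    ⟨ φ , p ++ neg r ⟩     ≈⟨ ⟨⟩-vanish φ (p ++ neg r) zero-coeff ⟩
    0#                     ∎)
    where
    zero-coeff : ∀ e → coeff e (p ++ neg r) * φ e ≈ 0#
    zero-coeff e = begin
      coeff e (p ++ neg r) * φ e      ≈⟨ *-congʳ (trans (⟨⟩-++ _ p (neg r)) (+-cong (at p≋r e) (⟨⟩-neg _ r))) ⟩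
      (coeff e r - coeff e r) * φ e   ≈⟨ *-congʳ (-‿inverseʳ _) ⟩
      0# * φ e                        ≈⟨ zeroˡ _ ⟩
      0#                              ∎

  fromPairings : ∀ {p r} → (∀ φ → ⟨ φ , p ⟩ ≈ ⟨ φ , r ⟩) → p ≋ r
  fromPairings eq = mk (λ k → eq (δ k))

  private
    ++-cong : ∀ {p p′ r r′} → p ≋ p′ → r ≋ r′ → p ++ r ≋ p′ ++ r′
    ++-cong {p} {p′} {r} {r′} p≋ r≋ =
      mk (λ k → trans (⟨⟩-++ _ p r) (trans (+-cong (at p≋ k) (at r≋ k)) (sym (⟨⟩-++ _ p′ r′))))

    ⊛-comm : ∀ p r → p ⊛ r ≋ r ⊛ p
    ⊛-comm p r = fromPairings λ φ → begin
      ⟨ φ , p ⊛ r ⟩                             ≈⟨ ⟨⟩-⊛ φ p r ⟩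
      ⟨ (λ e → ⟨ (λ f → φ (e ∙ f)) , r ⟩) , p ⟩ ≈⟨ ⟨⟩-swap (λ e f → φ (e ∙ f)) p r ⟩
      ⟨ (λ f → ⟨ (λ e → φ (e ∙ f)) , p ⟩) , r ⟩ ≈⟨ ⟨⟩-cong (λ f → ⟨⟩-cong (λ e → reflexive (≡.cong φ (M.comm e f))) p) r ⟩
      ⟨ (λ f → ⟨ (λ e → φ (f ∙ e)) , p ⟩) , r ⟩ ≈⟨ ⟨⟩-⊛ φ r p ⟨
      ⟨ φ , r ⊛ p ⟩                             ∎

    ⊛-cong : ∀ {p p′ r r′} → p ≋ p′ → r ≋ r′ → p ⊛ r ≋ p′ ⊛ r′
    ⊛-cong {p} {p′} {r} {r′} p≋ r≋ = fromPairings λ φ → begin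
      ⟨ φ , p ⊛ r ⟩                               ≈⟨ ⟨⟩-⊛ φ p r ⟩
      ⟨ (λ e → ⟨ (λ f → φ (e ∙ f)) , r ⟩) , p ⟩   ≈⟨ ⟨⟩-resp _ p≋ ⟩
      ⟨ (λ e → ⟨ (λ f → φ (e ∙ f)) , r ⟩) , p′ ⟩  ≈⟨ ⟨⟩-cong (λ e → ⟨⟩-resp _ r≋) p′ ⟩
      ⟨ (λ e → ⟨ (λ f → φ (e ∙ f)) , r′ ⟩) , p′ ⟩ ≈⟨ ⟨⟩-⊛ φ p′ r′ ⟨
      ⟨ φ , p′ ⊛ r′ ⟩                             ∎

    ⊛-assoc : ∀ p r t → (p ⊛ r) ⊛ t ≋ p ⊛ (r ⊛ t)
    ⊛-assoc p r t = fromPairings λ φ → begin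
      ⟨ φ , (p ⊛ r) ⊛ t ⟩                                             ≈⟨ ⟨⟩-⊛ φ (p ⊛ r) t ⟩
      ⟨ (λ e → ⟨ (λ f → φ (e ∙ f)) , t ⟩) , p ⊛ r ⟩                   ≈⟨ ⟨⟩-⊛ _ p r ⟩
      ⟨ (λ d → ⟨ (λ e → ⟨ (λ f → φ ((d ∙ e) ∙ f)) , t ⟩) , r ⟩) , p ⟩
        ≈⟨ ⟨⟩-cong (λ d → ⟨⟩-cong (λ e → ⟨⟩-cong (λ f → reflexive (≡.cong φ (M.assoc d e f))) t) r) p ⟩
      ⟨ (λ d → ⟨ (λ e → ⟨ (λ f → φ (d ∙ (e ∙ f))) , t ⟩) , r ⟩) , p ⟩ ≈⟨ ⟨⟩-cong (λ d → ⟨⟩-⊛ (λ g → φ (d ∙ g)) r t) p ⟨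
      ⟨ (λ d → ⟨ (λ g → φ (d ∙ g)) , r ⊛ t ⟩) , p ⟩                   ≈⟨ ⟨⟩-⊛ φ p (r ⊛ t) ⟨
      ⟨ φ , p ⊛ (r ⊛ t) ⟩                                             ∎

    ⊛-identityˡ : ∀ p → const 1# ⊛ p ≋ p
    ⊛-identityˡ p = fromPairings λ φ → begin
      ⟨ φ , const 1# ⊛ p ⟩               ≈⟨ ⟨⟩-⊛ φ (const 1#) p ⟩
      1# * ⟨ (λ f → φ (ε ∙ f)) , p ⟩ + 0# ≈⟨ trans (+-identityʳ _) (*-identityˡ _) ⟩
      ⟨ (λ f → φ (ε ∙ f)) , p ⟩          ≈⟨ ⟨⟩-cong (λ f → reflexive (≡.cong φ (M.identityˡ f))) p ⟩
      ⟨ φ , p ⟩                          ∎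

    ⊛-distribʳ : ∀ t p r → (p ++ r) ⊛ t ≋ p ⊛ t ++ r ⊛ t
    ⊛-distribʳ t p r = fromPairings λ φ → begin
      ⟨ φ , (p ++ r) ⊛ t ⟩                ≈⟨ ⟨⟩-⊛ φ (p ++ r) t ⟩
      ⟨ _ , p ++ r ⟩                      ≈⟨ ⟨⟩-++ _ p r ⟩
      ⟨ _ , p ⟩ + ⟨ _ , r ⟩               ≈⟨ +-cong (⟨⟩-⊛ φ p t) (⟨⟩-⊛ φ r t) ⟨
      ⟨ φ , p ⊛ t ⟩ + ⟨ φ , r ⊛ t ⟩       ≈⟨ ⟨⟩-++ φ (p ⊛ t) (r ⊛ t) ⟨
      ⟨ φ , p ⊛ t ++ r ⊛ t ⟩              ∎

    ≋-trans : ∀ {p r t} → p ≋ r → r ≋ t → p ≋ t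
    ≋-trans p≋r r≋t = mk (λ k → trans (at p≋r k) (at r≋t k))

    ⊛-distribˡ : ∀ t p r → t ⊛ (p ++ r) ≋ t ⊛ p ++ t ⊛ r
    ⊛-distribˡ t p r =
      ≋-trans (⊛-comm t (p ++ r)) (≋-trans (⊛-distribʳ t p r) (++-cong (⊛-comm p t) (⊛-comm r t)))

  ring⟨⟩ : CommutativeRing c ℓ
  ring⟨⟩ = record
    { Carrier = Poly
    ; _≈_ = _≋_
    ; _+_ = _++_
    ; _*_ = _⊛_
    ; -_  = neg
    ; 0#  = []
    ; 1#  = const 1#
    ; isCommutativeRing = record
      { isRing = record
        { +-isAbelianGroup = record
          { isGroup = record
            { isMonoid = record
              { isSemigroup = record
                { isMagma = record
                  { isEquivalence = record
                    { refl  = mk (λ k → refl)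
                    ; sym   = λ p≋r → mk (λ k → sym (at p≋r k))
                    ; trans = ≋-trans
                    }
                  ; ∙-cong = ++-cong
                  }
                ; assoc = λ p r t → fromPairings λ φ →
                    trans (⟨⟩-++ φ (p ++ r) t) (trans (+-congʳ (⟨⟩-++ φ p r)) (trans (+-assoc _ _ _)
                      (sym (trans (⟨⟩-++ φ p (r ++ t)) (+-congˡ (⟨⟩-++ φ r t))))))
                }
              ; identity = (λ p → mk (λ k → refl)) , λ p → fromPairings λ φ → trans (⟨⟩-++ φ p []) (+-identityʳ _)
              }
            ; inverse = (λ p → fromPairings λ φ →
                           trans (⟨⟩-++ φ (neg p) p) (trans (+-congʳ (⟨⟩-neg φ p)) (-‿inverseˡ _)))
                      , (λ p → fromPairings λ φ →
                           trans (⟨⟩-++ φ p (neg p)) (trans (+-congˡ (⟨⟩-neg φ p)) (-‿inverseʳ _)))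
            ; ⁻¹-cong = λ {p} {r} p≋r → mk (λ k → trans (⟨⟩-neg _ p) (trans (-‿cong (at p≋r k)) (sym (⟨⟩-neg _ r))))
            }
          ; comm = λ p r → fromPairings λ φ → trans (⟨⟩-++ φ p r) (trans (+-comm _ _) (sym (⟨⟩-++ φ r p)))
          }
        ; *-cong = ⊛-cong
        ; *-assoc = ⊛-assoc
        ; *-identity = ⊛-identityˡ , λ p → ≋-trans (⊛-comm p (const 1#)) (⊛-identityˡ p)
        ; distrib = ⊛-distribˡ , ⊛-distribʳ
        }
      ; *-comm = ⊛-comm
      }
    }

  private module P = CommutativeRing ring⟨⟩

  mono-cong : ∀ {a b e f} → a ≈ b → e ≡ f → mono a e ≋ mono b f
  mono-cong a≈b ≡.refl = mk (λ k → +-congʳ (*-congʳ a≈b))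

  mono-+ : ∀ a b e → mono (a + b) e ≋ mono a e ++ mono b e
  mono-+ a b e = fromPairings λ φ → begin
    (a + b) * φ e + 0#               ≈⟨ +-identityʳ _ ⟩
    (a + b) * φ e                    ≈⟨ distribʳ _ _ _ ⟩
    a * φ e + b * φ e                ≈⟨ +-congˡ (+-identityʳ _) ⟨
    a * φ e + (b * φ e + 0#)         ∎

  mono-0 : ∀ e → mono 0# e ≋ []
  mono-0 e = fromPairings λ φ → trans (+-identityʳ _) (zeroˡ _)

  coeff-++ : ∀ k p r → coeff k (p ++ r) ≈ coeff k p + coeff k r
  coeff-++ k = ⟨⟩-++ (δ k)

  δ-shift : ∀ {k k′ d} → (∀ e → d ∙ e ≡ k → e ≡ k′) → d ∙ k′ ≡ k → ∀ e → δ k (d ∙ e) ≈ δ k′ e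
  δ-shift {k} {k′} to from e with e ≟ k′
  ... | yes ≡.refl rewrite from = δ-≡ k
  ... | no  e≢k′   = δ-≢ (e≢k′ ∘ to e)

  coeff-mono-⊛ : ∀ {k k′ d} → (∀ e → d ∙ e ≡ k → e ≡ k′) → d ∙ k′ ≡ k → ∀ a p → coeff k (mono a d ⊛ p) ≈ a * coeff k′ p
  coeff-mono-⊛ {k} {k′} {d} to from a p =
    trans (⟨⟩-⊛ (δ k) (mono a d) p) (trans (+-identityʳ _) (*-congˡ (⟨⟩-cong (δ-shift to from) p)))

  coeff-mono-⊛-0 : ∀ {k d} → (∀ e → d ∙ e ≢ k) → ∀ a p → coeff k (mono a d ⊛ p) ≈ 0#
  coeff-mono-⊛-0 {k} {d} never a p =
    trans (⟨⟩-⊛ (δ k) (mono a d) p) (trans (+-identityʳ _)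
      (trans (*-congˡ (trans (⟨⟩-cong (λ e → δ-≢ (never e)) p) (⟨⟩-0 p))) (zeroʳ a)))

-- Lists without repetitions and the removal of an element

Unique-resp-↭ : ∀ {a} {A : Set a} {xs ys : List A} → xs ↭ ys → Unique xs → Unique ys
Unique-resp-↭ {A = A} p = PermSetoid.Unique-resp-↭ (≡.setoid A) (↭⇒↭ₛ p)

concatMap-↭ : ∀ {a b} {A : Set a} {B : Set b} (f : A → List B) {xs ys} → xs ↭ ys → concatMap f xs ↭ concatMap f ys
concatMap-↭ f Perm.refl          = ↭-refl
concatMap-↭ f (prep x p)         = Perm.++⁺ˡ (f x) (concatMap-↭ f p)
concatMap-↭ f (swap x y p)       = ↭-trans (shifts (f x) (f y)) (Perm.++⁺ˡ (f y) (Perm.++⁺ˡ (f x) (concatMap-↭ f p)))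
concatMap-↭ f (Perm.trans p₁ p₂) = ↭-trans (concatMap-↭ f p₁) (concatMap-↭ f p₂)

module Removal {A : Set} (_≟_ : DecidableEquality A) where

  infixl 6 _∖_
  _∖_ : List A → A → List A
  xs ∖ x = filter (λ x′ → ¬? (x′ ≟ x)) xs

  ∖-∉ : ∀ {x xs} → x ∉ xs → xs ∖ x ≡ xs
  ∖-∉ {x} x∉xs = List.filter-all (λ x′ → ¬? (x′ ≟ x)) (All.tabulate (λ { x′∈xs ≡.refl → x∉xs x′∈xs }))

  ∖-here : ∀ {x xs} → x ∉ xs → (x ∷ xs) ∖ x ≡ xs
  ∖-here {x} x∉xs = ≡.trans (List.filter-reject (λ x′ → ¬? (x′ ≟ x)) (λ x≢x → x≢x ≡.refl)) (∖-∉ x∉xs)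

  ∖-there : ∀ {x y xs} → y ≢ x → (y ∷ xs) ∖ x ≡ y ∷ (xs ∖ x)
  ∖-there {x} y≢x = List.filter-accept (λ x′ → ¬? (x′ ≟ x)) y≢x

  Unique-∉ : ∀ {x} {xs : List A} → Unique (x ∷ xs) → x ∉ xs
  Unique-∉ (x≢xs ∷ _) x∈xs = All.lookup x≢xs x∈xs ≡.refl

  Unique-∖ : ∀ {xs} x → Unique xs → Unique (xs ∖ x)
  Unique-∖ x = Unique.filter⁺ (λ x′ → ¬? (x′ ≟ x))

  ∉-∖ : ∀ xs x → x ∉ xs ∖ x
  ∉-∖ xs x x∈ = proj₂ (∈-filter⁻ (λ x′ → ¬? (x′ ≟ x)) {xs = xs} x∈) ≡.refl

  ∖-↭ : ∀ {x xs ys} → Unique xs → xs ↭ x ∷ ys → xs ∖ x ↭ ys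
  ∖-↭ {x} uxs p = ↭-trans (filter-↭ (λ x′ → ¬? (x′ ≟ x)) p)
    (↭-reflexive (∖-here (Unique-∉ (Unique-resp-↭ p uxs))))

  ↭-∖ : ∀ {x xs} → Unique xs → x ∈ xs → xs ↭ x ∷ (xs ∖ x)
  ↭-∖ {x} {xs} uxs x∈xs with ys , zs , ≡.refl ← ∈-∃++ x∈xs =
    ↭-trans p (prep x (↭-sym (∖-↭ uxs p)))
    where p = Perm.shift x ys zs

-- Exponent vectors

infixl 6 _⊕_ _⊖_
_⊕_ _⊖_ : ∀ {s} → Vec ℤ s → Vec ℤ s → Vec ℤ s
_⊕_ = zipWith ℤ._+_
_⊖_ = zipWith ℤ._-_

lookup-ext : ∀ {a} {A : Set a} {n} {xs ys : Vec A n} → (∀ i → lookup xs i ≡ lookup ys i) → xs ≡ ys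
lookup-ext {xs = xs} {ys} eq =
  ≡.trans (≡.sym (Vec.tabulate∘lookup xs)) (≡.trans (Vec.tabulate-cong eq) (Vec.tabulate∘lookup ys))

0⃗ : ∀ {s} → Vec ℤ s
0⃗ {s} = replicate s 0ℤ

_·ε_ : ∀ {s} → ℤ → Fin s → Vec ℤ s
c ·ε i = 0⃗ [ i ]≔ c

lookup-·ε : ∀ {s} c (i : Fin s) → lookup (c ·ε i) i ≡ c
lookup-·ε c i = Vec.lookup∘update i 0⃗ c

lookup-·ε-≢ : ∀ {s} c {i j : Fin s} → j ≢ i → lookup (c ·ε i) j ≡ 0ℤ
lookup-·ε-≢ c {i} {j} j≢i = ≡.trans (Vec.lookup∘update′ j≢i 0⃗ c) (Vec.lookup-replicate j 0ℤ)

lookup-⊕ : ∀ {s} (i : Fin s) k l → lookup (k ⊕ l) i ≡ lookup k i ℤ.+ lookup l i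
lookup-⊕ = Vec.lookup-zipWith ℤ._+_

lookup-⊖ : ∀ {s} (i : Fin s) k l → lookup (k ⊖ l) i ≡ lookup k i ℤ.- lookup l i
lookup-⊖ = Vec.lookup-zipWith ℤ._-_

⊕-⊖ : ∀ {s} (k l : Vec ℤ s) → (k ⊕ l) ⊖ l ≡ k
⊕-⊖ k l = lookup-ext λ i → ≡.trans (lookup-⊖ i (k ⊕ l) l) (≡.trans (≡.cong (ℤ._- lookup l i) (lookup-⊕ i k l))
  (≡.trans (ℤ.+-assoc (lookup k i) _ _) (≡.trans (≡.cong (ℤ._+_ (lookup k i)) (ℤ.+-inverseʳ (lookup l i))) (ℤ.+-identityʳ _))))

⊖-0⃗ : ∀ {s} (k : Vec ℤ s) → k ⊖ 0⃗ ≡ k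
⊖-0⃗ k = lookup-ext λ i → ≡.trans (lookup-⊖ i k 0⃗)
  (≡.trans (≡.cong (ℤ._-_ (lookup k i)) (Vec.lookup-replicate i 0ℤ)) (ℤ.+-identityʳ _))

-- Arguing from an interface keeps products of Laurent polynomials from unfolding
-- to lists of terms.
record LaurentRing {c ℓ} (R : CommutativeRing c ℓ) (s : ℕ) : Set (Level.suc (c ⊔ ℓ)) where
  private module R = CommutativeRing R
  field
    ring : CommutativeRing c ℓ
  open CommutativeRing ring using (Carrier; _≈_; _+_; _*_; 0#; 1#)
  field
    mono         : R.Carrier → Vec ℤ s → Carrier
    coeff        : Vec ℤ s → Carrier → R.Carrier
    mono-cong    : ∀ {a b e} → a R.≈ b → mono a e ≈ mono b e
    mono-1       : mono R.1# 0⃗ ≈ 1#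
    mono-0       : ∀ e → mono R.0# e ≈ 0#
    mono-+       : ∀ a b e → mono (a R.+ b) e ≈ mono a e + mono b e
    mono-*       : ∀ a b e f → mono (a R.* b) (e ⊕ f) ≈ mono a e * mono b f
    coeff-cong   : ∀ {k p r} → p ≈ r → coeff k p R.≈ coeff k r
    coeff-ext    : ∀ {p r} → (∀ k → coeff k p R.≈ coeff k r) → p ≈ r
    coeff-0      : ∀ k → coeff k 0# R.≈ R.0#
    coeff-+      : ∀ k p r → coeff k (p + r) R.≈ coeff k p R.+ coeff k r
    coeff-1      : coeff 0⃗ 1# R.≈ R.1#
    coeff-1-≢    : ∀ {k} → k ≢ 0⃗ → coeff k 1# R.≈ R.0#
    coeff-mono-* : ∀ k a d p → coeff k (mono a d * p) R.≈ a R.* coeff (k ⊖ d) p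
    -- The coefficient of a product is a sum over e; the interface records only that it vanishes if
    -- each of its terms does.
    coeff-*-0    : ∀ k p r → (∀ e → coeff e p R.≈ R.0# ⊎ coeff (k ⊖ e) r R.≈ R.0#) → coeff k (p * r) R.≈ R.0#
    bounded      : ∀ p i → ∃ λ N → ∀ k → N ℤ.< lookup k i → coeff k p R.≈ R.0#

module Laurent {c ℓ} {R : CommutativeRing c ℓ} {s : ℕ} (LR : LaurentRing R s) where
  private
    module R where
      open CommutativeRing R public
      open BigRing R public
      open Exp semiring public
  open LaurentRing LR public
  open CommutativeRing ring public hiding (zero; ring)
  open CommutativeRing ring using () renaming (ring to ring′)
  open BigRing ring public
  open Exp semiring public using (_^_; ^-congˡ; ^-homo-*; ^-assocʳ)
  open CExp commutativeSemiring public using (^-distrib-*)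
  open RingProperties ring′ public using (-‿distribˡ-*; -‿distribʳ-*; -0#≈0#; -‿involutive; x[y-z]≈xy-xz)
  open SetoidReasoning setoid

  const : R.Carrier → Carrier
  const a = mono a 0⃗

  z z⁻¹ : Fin s → Carrier
  z   i = mono R.1# (1ℤ ·ε i)
  z⁻¹ i = mono R.1# (-1ℤ ·ε i)

  mono-cong₂ : ∀ {a b e f} → a R.≈ b → e ≡ f → mono a e ≈ mono b f
  mono-cong₂ a≈b ≡.refl = mono-cong a≈b

  0⃗⊕ : ∀ (e : Vec ℤ s) → 0⃗ ⊕ e ≡ e
  0⃗⊕ e = Vec.zipWith-identityˡ ℤ.+-identityˡ e

  const-* : ∀ a b → const (a R.* b) ≈ const a * const b
  const-* a b = trans (mono-cong₂ R.refl (≡.sym (0⃗⊕ 0⃗))) (mono-* a b 0⃗ 0⃗)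

  const-*-mono : ∀ a b e → mono (a R.* b) e ≈ const a * mono b e
  const-*-mono a b e = trans (mono-cong₂ R.refl (≡.sym (0⃗⊕ e))) (mono-* a b 0⃗ e)

  const-^ : ∀ a n → const (a R.^ n) ≈ const a ^ n
  const-^ a zero    = mono-1
  const-^ a (suc n) = trans (const-* a _) (*-congˡ (const-^ a n))

  mono-neg : ∀ a e → mono (R.- a) e ≈ - mono a e
  mono-neg a e = AbelianGroupProperties.inverseˡ-unique +-abelianGroup _ _
    (trans (sym (mono-+ (R.- a) a e)) (trans (mono-cong (R.-‿inverseˡ a)) (mono-0 e)))

  const-sub : ∀ a b → const (a R.- b) ≈ const a - const b
  const-sub a b = trans (mono-+ a (R.- b) 0⃗) (+-congˡ (mono-neg b 0⃗))

  const-Π : ∀ {a} {A : Set a} (xs : List A) f → const (R.Π[] xs f) ≈ Π[] xs (const ∘ f)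
  const-Π []       f = mono-1
  const-Π (x ∷ xs) f = trans (const-* _ _) (*-congˡ (const-Π xs f))

  zz⁻¹≈1 : ∀ i → z i * z⁻¹ i ≈ 1#
  zz⁻¹≈1 i = begin
    z i * z⁻¹ i                                ≈⟨ mono-* _ _ _ _ ⟨
    mono (R.1# R.* R.1#) ((1ℤ ·ε i) ⊕ (-1ℤ ·ε i)) ≈⟨ mono-cong₂ (R.*-identityˡ _) (lookup-ext zero-sum) ⟩
    mono R.1# 0⃗                                ≈⟨ mono-1 ⟩
    1#                                         ∎
    where
    zero-sum : ∀ j → lookup ((1ℤ ·ε i) ⊕ (-1ℤ ·ε i)) j ≡ lookup 0⃗ j
    zero-sum j with j Fin.≟ i
    ... | yes ≡.refl = ≡.trans (lookup-⊕ j (1ℤ ·ε j) (-1ℤ ·ε j)) (≡.trans (≡.cong₂ ℤ._+_ (lookup-·ε 1ℤ j) (lookup-·ε -1ℤ j)) (≡.sym (Vec.lookup-replicate j 0ℤ)))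
    ... | no  j≢i    = ≡.trans (lookup-⊕ j (1ℤ ·ε i) (-1ℤ ·ε i)) (≡.trans (≡.cong₂ ℤ._+_ (lookup-·ε-≢ 1ℤ j≢i) (lookup-·ε-≢ -1ℤ j≢i)) (≡.sym (Vec.lookup-replicate j 0ℤ)))

  mono-^ : ∀ a i t → mono a (1ℤ ·ε i) ^ t ≈ mono (a R.^ t) ((+ t) ·ε i)
  mono-^ a i zero    = trans (sym mono-1) (mono-cong₂ R.refl (lookup-ext zeros))
    where
    zeros : ∀ j → lookup 0⃗ j ≡ lookup (0ℤ ·ε i) j
    zeros j with j Fin.≟ i
    ... | yes ≡.refl = ≡.trans (Vec.lookup-replicate j 0ℤ) (≡.sym (lookup-·ε 0ℤ j))
    ... | no  j≢i    = ≡.trans (Vec.lookup-replicate j 0ℤ) (≡.sym (lookup-·ε-≢ 0ℤ j≢i))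
  mono-^ a i (suc t) = trans (*-congˡ (mono-^ a i t)) (trans (sym (mono-* _ _ _ _)) (mono-cong₂ R.refl (lookup-ext sums)))
    where
    sums : ∀ j → lookup ((1ℤ ·ε i) ⊕ ((+ t) ·ε i)) j ≡ lookup ((+ suc t) ·ε i) j
    sums j with j Fin.≟ i
    ... | yes ≡.refl = ≡.trans (lookup-⊕ j (1ℤ ·ε j) ((+ t) ·ε j))
      (≡.trans (≡.cong₂ ℤ._+_ (lookup-·ε 1ℤ j) (lookup-·ε (+ t) j)) (≡.sym (lookup-·ε (+ suc t) j)))
    ... | no  j≢i    = ≡.trans (lookup-⊕ j (1ℤ ·ε i) ((+ t) ·ε i))
      (≡.trans (≡.cong₂ ℤ._+_ (lookup-·ε-≢ 1ℤ j≢i) (lookup-·ε-≢ (+ t) j≢i)) (≡.sym (lookup-·ε-≢ (+ suc t) j≢i)))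

  coeff-const-* : ∀ k a p → coeff k (const a * p) R.≈ a R.* coeff k p
  coeff-const-* k a p = R.trans (coeff-mono-* k a 0⃗ p) (R.*-congˡ (R.reflexive (≡.cong (λ k → coeff k p) (⊖-0⃗ k))))

  coeff-Σ : ∀ {a} {A : Set a} k (xs : List A) f → coeff k (Σ[] xs f) R.≈ R.Σ[] xs (coeff k ∘ f)
  coeff-Σ k []       f = coeff-0 k
  coeff-Σ k (x ∷ xs) f = R.trans (coeff-+ k _ _) (R.+-congˡ (coeff-Σ k xs f))

  Regular-const : ∀ {a} → R.Regular a → Regular (const a)
  Regular-const {a} reg f eq = coeff-ext λ k → R.trans
    (reg _ (R.trans (R.sym (coeff-const-* k a f)) (R.trans (coeff-cong eq) (coeff-0 k))))
    (R.sym (coeff-0 k))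

  Regular-unit : ∀ {x x⁻¹} → x * x⁻¹ ≈ 1# → Regular x
  Regular-unit {x} {x⁻¹} inv y xy≈0 = begin
    y              ≈⟨ *-identityˡ y ⟨
    1# * y         ≈⟨ *-congʳ (trans (*-comm _ _) inv) ⟨
    x⁻¹ * x * y    ≈⟨ *-assoc _ _ _ ⟩
    x⁻¹ * (x * y)  ≈⟨ *-congˡ xy≈0 ⟩
    x⁻¹ * 0#       ≈⟨ zeroʳ _ ⟩
    0#             ∎

  -- If the product with f is 0, then a times the coefficient of f at k equals b times the one at
  -- `k + ε_i - ε_j`. Iterating raises the exponent of z_i until it exceeds the bound N, where f has
  -- no terms; regularity of a then leads back to k. The number of iterations `suc ∣N - k_i∣` is
  -- enough to pass N.
  Regular-diff : ∀ {a b i j} → i ≢ j → R.Regular a → Regular (mono a (1ℤ ·ε i) - mono b (1ℤ ·ε j))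
  Regular-diff {a} {b} {i} {j} i≢j reg f eq = coeff-ext λ k → R.trans (go (ℕ.suc ℤ.∣ N ℤ.- lookup k i ∣) k (far k)) (R.sym (coeff-0 k))
    where
    N = proj₁ (bounded f i)
    next : Vec ℤ s → Vec ℤ s
    next k = (k ⊕ (1ℤ ·ε i)) ⊖ (1ℤ ·ε j)

    next-i : ∀ k → lookup (next k) i ≡ lookup k i ℤ.+ 1ℤ
    next-i k = ≡.trans (lookup-⊖ i (k ⊕ (1ℤ ·ε i)) (1ℤ ·ε j)) (≡.trans (≡.cong₂ ℤ._-_ (≡.trans (lookup-⊕ i k (1ℤ ·ε i))
      (≡.cong (ℤ._+_ (lookup k i)) (lookup-·ε 1ℤ i))) (lookup-·ε-≢ 1ℤ i≢j)) (ℤ.+-identityʳ _))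

    balance : mono a (1ℤ ·ε i) * f ≈ mono b (1ℤ ·ε j) * f
    balance = x-y≈0⇒x≈y _ _ (trans (sym (trans (distribʳ _ _ _) (+-congˡ (sym (-‿distribˡ-* _ _))))) eq)

    step : ∀ k → a R.* coeff k f R.≈ b R.* coeff (next k) f
    step k = R.trans (R.*-congˡ (R.reflexive (≡.cong (λ k → coeff k f) (≡.sym (⊕-⊖ k _)))))
      (R.trans (R.sym (coeff-mono-* (k ⊕ (1ℤ ·ε i)) a _ f)) (R.trans (coeff-cong balance) (coeff-mono-* _ b _ f)))

    far : ∀ k → N ℤ.< lookup k i ℤ.+ + suc ℤ.∣ N ℤ.- lookup k i ∣
    far k = ≡.subst (ℤ._< lookup k i ℤ.+ + suc ℤ.∣ N ℤ.- lookup k i ∣) back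
      (ℤ.+-monoʳ-< (lookup k i) (ℤ.≤-<-trans (i≤∣i∣ (N ℤ.- lookup k i)) (ℤ.+<+ (ℕ.n<1+n _))))
      where
      i≤∣i∣ : ∀ i → i ℤ.≤ + ℤ.∣ i ∣
      i≤∣i∣ (+ n)        = ℤ.≤-refl
      i≤∣i∣ ℤ.-[1+ n ]   = ℤ.-≤+
      back : lookup k i ℤ.+ (N ℤ.- lookup k i) ≡ N
      back = ≡.trans (ℤ.+-comm (lookup k i) _) (≡.trans (ℤ.+-assoc N _ _)
        (≡.trans (≡.cong (ℤ._+_ N) (ℤ.+-inverseˡ (lookup k i))) (ℤ.+-identityʳ N)))

    go : ∀ n k → N ℤ.< lookup k i ℤ.+ + n → coeff k f R.≈ R.0#
    go zero    k N< = proj₂ (bounded f i) k (≡.subst (N ℤ.<_) (ℤ.+-identityʳ _) N<)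
    go (suc n) k N< = reg _ (R.trans (step k) (R.trans (R.*-congˡ (go n (next k) (≡.subst (N ℤ.<_) shift-one N<))) (R.zeroʳ b)))
      where
      shift-one : lookup k i ℤ.+ + suc n ≡ lookup (next k) i ℤ.+ + n
      shift-one = ≡.trans (≡.sym (ℤ.+-assoc (lookup k i) 1ℤ (+ n))) (≡.cong (ℤ._+ + n) (≡.sym (next-i k)))

-- Elimination of one variable

-- These conditions make distinct powers of q differ by a non-zero-divisor, since
-- `q^b - q^(b+n+1) = q^b (1 - q^(n+1))`.
record Generic {c ℓ} (R : CommutativeRing c ℓ) (q : CommutativeRing.Carrier R) : Set (c ⊔ ℓ) where
  open CommutativeRing R using (_-_; 1#; semiring)
  open BigRing R using (Regular)
  open Exp semiring using (_^_)
  field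
    reg-q   : Regular q
    reg-1-q : ∀ n → Regular (1# - q ^ suc n)

module ScalarWeights {c ℓ} (R : CommutativeRing c ℓ) (q : CommutativeRing.Carrier R) (gen : Generic R q)
  (n̂ : ℕ) where
  open Generic gen
  open CommutativeRing R hiding (zero)
  open BigRing R
  open CompleteHomogeneous R
  open QProducts R q
  open Exp semiring using (_^_; ^-homo-*)
  open CExp commutativeSemiring using (^-distrib-*)
  open IntegerSolver R
  open Removal ℕ._≟_
  open SetoidReasoning setoid

  q^-diff : ∀ b n → q ^ b - q ^ (b ℕ.+ n) ≈ q ^ b * (1# - q ^ n)
  q^-diff b n = trans (+-congˡ (-‿cong (^-homo-* q b n)))
    (solve 2 (λ x y → x :- x :* y := x :* (con 1ℤ :- y)) refl (q ^ b) (q ^ n))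

  neg-diff : ∀ x y → x - y ≈ - (y - x)
  neg-diff x y = solve 2 (λ x y → x :- y := :- (y :- x)) refl x y

  Regular-q-diff : ∀ {b b′} → b ≢ b′ → Regular (q ^ b - q ^ b′)
  Regular-q-diff {b} {b′} b≢b′ with ℕ.<-cmp b b′
  ... | tri≈ _ b≡b′ _ = ⊥-elim (b≢b′ b≡b′)
  ... | tri< b<b′ _ _ with n , ≡.refl ← ℕ.m≤n⇒∃[o]m+o≡n b<b′ =
    Regular-resp (trans (sym (q^-diff b (suc n))) (reflexive (≡.cong (λ m → q ^ b - q ^ m) (ℕ.+-suc b n))))
      (Regular-* (Regular-^ b reg-q) (reg-1-q n))
  ... | tri> _ _ b′<b with n , ≡.refl ← ℕ.m≤n⇒∃[o]m+o≡n b′<b =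
    Regular-resp (trans (-‿cong (trans (sym (q^-diff b′ (suc n))) (reflexive (≡.cong (λ m → q ^ b′ - q ^ m) (ℕ.+-suc b′ n)))))
                        (sym (neg-diff _ _)))
      (Regular-neg (Regular-* (Regular-^ b′ reg-q) (reg-1-q n)))

  E : Carrier
  E = pp n̂ 1# q

  Regular-E : Regular E
  Regular-E = go n̂
    where
    go : ∀ n → Regular (pp n 1# q)
    go zero    = Regular-1
    go (suc n) = Regular-* (go n) (Regular-resp (+-congˡ (-‿cong (*-comm q (q ^ n)))) (reg-1-q n))

  private
    quotient : ∀ {n e} → e ℕ.< n → ∃ λ d → d * (1# - q ^ suc e) ≈ pp n 1# q
    quotient {suc n} {e} e<1+n with ℕ.m<1+n⇒m<n∨m≡n e<1+n
    ... | inj₂ ≡.refl = pp n 1# q , *-congˡ (+-congˡ (-‿cong (*-comm q (q ^ n))))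
    ... | inj₁ e<n with d , d-spec ← quotient e<n = d * (1# - q ^ n * q) , (begin
      d * (1# - q ^ n * q) * (1# - q ^ suc e) ≈⟨ solve 3 (λ d x y → d :* x :* y := d :* y :* x) refl _ _ _ ⟩
      d * (1# - q ^ suc e) * (1# - q ^ n * q) ≈⟨ *-congʳ d-spec ⟩
      pp n 1# q * (1# - q ^ n * q)            ∎)

    -- The number g is E / (1 - q^{b′-b}); E is a multiple of every 1 - q^{e+1} with e < n̂. The
    -- conditions on b and b′ stand inside the existential, so that g depends on b and b′ alone; 0
    -- is a default value in the cases that they exclude.
    weight : ∀ b b′ → ∃ λ g → b ≢ b′ → b ℕ.< n̂ → b′ ℕ.< n̂ → g * (q ^ b - q ^ b′) ≈ E * q ^ b
    weight b b′ with ℕ.<-cmp b b′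
    ... | tri≈ _ b≡b′ _ = 0# , λ b≢b′ → ⊥-elim (b≢b′ b≡b′)
    ... | tri< b<b′ _ _ with n , ≡.refl ← ℕ.m≤n⇒∃[o]m+o≡n b<b′ with n ℕ.<? n̂
    ...   | no  n≮n̂ = 0# , λ _ _ b′<n̂ → ⊥-elim (n≮n̂ (ℕ.≤-<-trans (ℕ.m≤n+m n (suc b)) b′<n̂))
    ...   | yes n<n̂ with d , d-spec ← quotient n<n̂ = d , λ _ _ _ → begin
      d * (q ^ b - q ^ (suc b ℕ.+ n))  ≡⟨ ≡.cong (λ m → d * (q ^ b - q ^ m)) (ℕ.+-suc b n) ⟨
      d * (q ^ b - q ^ (b ℕ.+ suc n))  ≈⟨ *-congˡ (q^-diff b (suc n)) ⟩
      d * (q ^ b * (1# - q ^ suc n))   ≈⟨ solve 3 (λ d x y → d :* (x :* y) := d :* y :* x) refl _ _ _ ⟩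
      d * (1# - q ^ suc n) * q ^ b     ≈⟨ *-congʳ d-spec ⟩
      E * q ^ b                        ∎
    weight b b′ | tri> _ _ b′<b with n , ≡.refl ← ℕ.m≤n⇒∃[o]m+o≡n b′<b with n ℕ.<? n̂
    ...   | no  n≮n̂ = 0# , λ _ b<n̂ _ → ⊥-elim (n≮n̂ (ℕ.≤-<-trans (ℕ.m≤n+m n (suc b′)) b<n̂))
    ...   | yes n<n̂ with d , d-spec ← quotient n<n̂ = - (q ^ suc n * d) , λ _ _ _ → begin
      - (q ^ suc n * d) * (q ^ (suc b′ ℕ.+ n) - q ^ b′)
        ≡⟨ ≡.cong (λ m → - (q ^ suc n * d) * (q ^ m - q ^ b′)) (ℕ.+-suc b′ n) ⟨
      - (q ^ suc n * d) * (q ^ (b′ ℕ.+ suc n) - q ^ b′)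
        ≈⟨ *-congˡ (trans (neg-diff _ _) (-‿cong (q^-diff b′ (suc n)))) ⟩
      - (q ^ suc n * d) * - (q ^ b′ * (1# - q ^ suc n))
        ≈⟨ solve 4 (λ x d y f → :- (x :* d) :* :- (y :* f) := d :* f :* (y :* x)) refl _ _ _ _ ⟩
      d * (1# - q ^ suc n) * (q ^ b′ * q ^ suc n)
        ≈⟨ *-cong d-spec (sym (^-homo-* q b′ (suc n))) ⟩
      E * q ^ (b′ ℕ.+ suc n)
        ≡⟨ ≡.cong (λ m → E * q ^ m) (ℕ.+-suc b′ n) ⟩
      E * q ^ (suc b′ ℕ.+ n) ∎

  -- E^β times the coefficient ∏_{b′≠b} (1 - q^{b′-b})⁻¹ of (1 - q^b X)⁻¹ in the
  -- partial fraction expansion of 1/(X;q)_β; the powers of E clear denominators.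
  α : ℕ → ℕ → Carrier
  α β b = E * Π[] (upTo β ∖ b) (λ b′ → proj₁ (weight b b′))

  -- Only β - 1 other exponents contribute a factor E. The additional E in `α` completes the power
  -- to `E ^ β`.
  α-spec : ∀ {β b bs} → β ℕ.≤ n̂ → upTo β ↭ b ∷ bs →
           α β b * Π[] bs (λ b′ → q ^ b - q ^ b′) ≈ E ^ β * (q ^ b) ^ length bs
  α-spec {β} {b} {bs} β≤n̂ p = begin
    E * Π[] (upTo β ∖ b) g * Π[] bs (λ b′ → q ^ b - q ^ b′)
      ≈⟨ *-congʳ (*-congˡ (Π-↭ g (∖-↭ (Unique.upTo⁺ β) p))) ⟩
    E * Π[] bs g * Π[] bs (λ b′ → q ^ b - q ^ b′)
      ≈⟨ trans (*-assoc _ _ _) (*-congˡ (sym (Π-* bs _ _))) ⟩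
    E * Π[] bs (λ b′ → g b′ * (q ^ b - q ^ b′))
      ≈⟨ *-congˡ (Π-cong-∈ bs (λ {b′} b′∈bs → proj₂ (weight b b′)
           (λ { ≡.refl → Unique-∉ (Unique-resp-↭ p (Unique.upTo⁺ β)) b′∈bs })
           (bound (here ≡.refl)) (bound (there b′∈bs)))) ⟩
    E * Π[] bs (λ b′ → E * q ^ b)
      ≈⟨ *-congˡ (trans (Π-const bs _) (^-distrib-* E (q ^ b) (length bs))) ⟩
    E * (E ^ length bs * (q ^ b) ^ length bs)
      ≈⟨ *-assoc _ _ _ ⟨
    E ^ suc (length bs) * (q ^ b) ^ length bs
      ≡⟨ ≡.cong (λ n → E ^ n * (q ^ b) ^ length bs) (≡.trans (≡.sym (↭-length p)) (List.length-upTo β)) ⟩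
    E ^ β * (q ^ b) ^ length bs ∎
    where
    g = λ b′ → proj₁ (weight b b′)
    bound : ∀ {b′} → b′ ∈ b ∷ bs → b′ ℕ.< n̂
    bound b′∈ = ℕ.<-≤-trans (∈-upTo⁻ (∈-resp-↭ (↭-sym p) b′∈)) β≤n̂

  -- Partial fractions of 1/(X;q)_β. They evaluate the sum over b that is left in the leading
  -- coefficient once z_i has been split off.
  Σα : ∀ β n → 1 ℕ.≤ β → β ℕ.≤ n̂ → Σ[] (upTo β) (λ b → α β b * (q ^ b) ^ n) ≈ E ^ β * h (upTo β) (q ^_) n
  Σα (suc β) n 1≤β β≤n̂ = lagrange 0 _ (α (suc β))
    (AllPairs.map Regular-q-diff (Unique.upTo⁺ (suc β)))
    (λ b bs p → α-spec β≤n̂ p) n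
    where open Lagrange (q ^_) (E ^ suc β)

module Factors {c ℓ} {R : CommutativeRing c ℓ} {s : ℕ} (LR : LaurentRing R s) (q : CommutativeRing.Carrier R) (β : Fin s → ℕ) where
  private module R = Exp (CommutativeRing.semiring R)
  open Laurent LR
  open QPochhammer rawRing using (qPoch)

  Index : Set
  Index = Fin s × ℕ

  W : List (Fin s) → List Index
  W = concatMap (λ i → List.map (i ,_) (upTo (β i)))

  y : Index → Carrier
  y (i , b) = mono (q R.^ b) (1ℤ ·ε i)

  pair pair⁼ : Fin s → Fin s → Carrier
  pair i j = qPoch (z i * z⁻¹ j) (const q) (β i) * qPoch (const q * (z j * z⁻¹ i)) (const q) (β j)
  pair⁼ i j = if ⌊ i Fin.<? j ⌋ then pair i j else pair j i

  -- The value 1 outside i < j turns the numerator into a product over all ordered pairs, which is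
  -- visibly invariant under permutations of I.
  pair₁ : Fin s → Fin s → Carrier
  pair₁ i j = if ⌊ i Fin.<? j ⌋ then pair i j else 1#

  N : List (Fin s) → Carrier
  N I = Π[] I (λ i → Π[] I (pair₁ i))

module Recursion {c ℓ} {R : CommutativeRing c ℓ} {s : ℕ} (LR : LaurentRing R s) (q : CommutativeRing.Carrier R) (gen : Generic R q)
  (β : Fin s → ℕ) (1≤β : ∀ i → 1 ℕ.≤ β i) (n̂ : ℕ) (β≤n̂ : ∀ i → β i ℕ.≤ n̂) where
  private
    module R where
      open CommutativeRing R public
      open BigRing R public
      open Exp semiring public
      open ScalarWeights R q gen n̂ public
  open Generic gen
  open Laurent LR
  open IntegerSolver ring
  open CompleteHomogeneous ring
  open QProducts ring (const q)
  open Factors LR q β public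
  open Removal (Fin._≟_ {s})
  open Removal ℕ._≟_ using () renaming (_∖_ to _∖ᴺ_; ↭-∖ to ↭-∖ᴺ)
  open SetoidReasoning setoid

  y≈ : ∀ i b → y (i , b) ≈ z i * const q ^ b
  y≈ i b = begin
    mono (q R.^ b) (1ℤ ·ε i)          ≈⟨ mono-cong (R.*-identityʳ _) ⟨
    mono (q R.^ b R.* R.1#) (1ℤ ·ε i) ≈⟨ const-*-mono _ _ _ ⟩
    const (q R.^ b) * z i             ≈⟨ trans (*-comm _ _) (*-congˡ (const-^ q b)) ⟩
    z i * const q ^ b                 ∎

  -- The truncated differences are exact for b < β_i, the range in which `cofactor-spec` holds.
  cofactor : Fin s → Fin s → ℕ → Carrier
  cofactor i j b = if ⌊ i Fin.<? j ⌋
    then cofactor< (z i * z⁻¹ j) (β j) b (β i ℕ.∸ suc b)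
    else cofactor> (z i * z⁻¹ j) (β j) b (β i ℕ.∸ b)

  cofactor-spec : ∀ i j b → b ℕ.< β i →
    cofactor i j b * Π[] (upTo (β j)) (λ b′ → y (i , b) - y (j , b′)) ≈ pair⁼ i j * y (i , b) ^ β j
  cofactor-spec i j b b<βi = begin
    cofactor i j b * Π[] (upTo (β j)) (λ b′ → y (i , b) - y (j , b′))
      ≈⟨ *-congˡ (trans (Π-cong (upTo (β j)) (λ b′ → +-cong (y≈ i b) (-‿cong (trans (y≈ j b′) (*-comm _ _))))) (pp-Π (β j) _ (z j))) ⟩
    cofactor i j b * pp (β j) (z i * const q ^ b) (z j)
      ≈⟨ *-congˡ (pp-cong (β j) refl zv) ⟨
    cofactor i j b * pp (β j) (z i * const q ^ b) (z i * v)
      ≈⟨ cases ⟩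
    pair⁼ i j * (z i * const q ^ b) ^ β j
      ≈⟨ *-congˡ (^-congˡ (β j) (y≈ i b)) ⟨
    pair⁼ i j * y (i , b) ^ β j ∎
    where
    u = z i * z⁻¹ j
    v = z j * z⁻¹ i
    zv : z i * v ≈ z j
    zv = begin
      z i * (z j * z⁻¹ i) ≈⟨ solve 3 (λ x y w → x :* (y :* w) := y :* (x :* w)) refl _ _ _ ⟩
      z j * (z i * z⁻¹ i) ≈⟨ *-congˡ (zz⁻¹≈1 i) ⟩
      z j * 1#            ≈⟨ *-identityʳ _ ⟩
      z j                 ∎
    uv : u * v ≈ 1#
    uv = begin
      (z i * z⁻¹ j) * (z j * z⁻¹ i) ≈⟨ solve 4 (λ x y w t → (x :* y) :* (w :* t) := (x :* t) :* (w :* y)) refl _ _ _ _ ⟩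
      (z i * z⁻¹ i) * (z j * z⁻¹ j) ≈⟨ *-cong (zz⁻¹≈1 i) (zz⁻¹≈1 j) ⟩
      1# * 1#                       ≈⟨ *-identityˡ _ ⟩
      1#                            ∎
    open Cancellation u v uv
    cases : cofactor i j b * pp (β j) (z i * const q ^ b) (z i * v) ≈ pair⁼ i j * (z i * const q ^ b) ^ β j
    cases with i Fin.<? j
    ... | yes _ = trans (cofactor<-spec (z i) (β j) b (β i ℕ.∸ suc b)) (*-congʳ (*-cong
      (reflexive (≡.trans (≡.cong (λ n → pp n 1# u) (ℕ.m+[n∸m]≡n b<βi)) (≡.sym (qPoch≡pp u (β i)))))
      (reflexive (≡.sym (qPoch≡pp (const q * v) (β j))))))
    ... | no  _ = trans (cofactor>-spec (z i) (β j) b (β i ℕ.∸ b)) (*-congʳ (*-cong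
      (reflexive (≡.sym (qPoch≡pp v (β j))))
      (reflexive (≡.trans (≡.cong (λ n → pp n 1# (const q * u)) (ℕ.m+[n∸m]≡n (ℕ.<⇒≤ b<βi))) (≡.sym (qPoch≡pp (const q * u) (β i)))))))

  pair₁-irrefl : ∀ i → pair₁ i i ≈ 1#
  pair₁-irrefl i with i Fin.<? i
  ... | yes i<i = ⊥-elim (Fin.<-irrefl ≡.refl i<i)
  ... | no  _   = refl

  pair₁-sym : ∀ {i j} → i ≢ j → pair₁ i j * pair₁ j i ≈ pair⁼ i j
  pair₁-sym {i} {j} i≢j with i Fin.<? j | j Fin.<? i
  ... | yes i<j | yes j<i = ⊥-elim (Fin.<-asym i<j j<i)
  ... | yes _   | no  _   = *-identityʳ _
  ... | no  _   | yes _   = *-identityˡ _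
  ... | no  i≮j | no  j≮i with Fin.<-cmp i j
  ...   | tri< i<j _ _ = ⊥-elim (i≮j i<j)
  ...   | tri≈ _ i≡j _ = ⊥-elim (i≢j i≡j)
  ...   | tri> _ _ j<i = ⊥-elim (j≮i j<i)

  N-↭ : ∀ {I J} → I ↭ J → N I ≈ N J
  N-↭ {I} {J} p = trans (Π-↭ _ p) (Π-cong J (λ i → Π-↭ _ p))

  N-∷ : ∀ {i I} → i ∉ I → N (i ∷ I) ≈ Π[] I (pair⁼ i) * N I
  N-∷ {i} {I} i∉I = begin
    (pair₁ i i * Π[] I (pair₁ i)) * Π[] I (λ j → pair₁ j i * Π[] I (pair₁ j))
      ≈⟨ *-cong (trans (*-congʳ (pair₁-irrefl i)) (*-identityˡ _)) (Π-* I _ _) ⟩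
    Π[] I (pair₁ i) * (Π[] I (λ j → pair₁ j i) * N I)
      ≈⟨ *-assoc _ _ _ ⟨
    Π[] I (pair₁ i) * Π[] I (λ j → pair₁ j i) * N I
      ≈⟨ *-congʳ (Π-* I _ _) ⟨
    Π[] I (λ j → pair₁ i j * pair₁ j i) * N I
      ≈⟨ *-congʳ (Π-cong-∈ I (λ j∈I → pair₁-sym (λ { ≡.refl → i∉I j∈I }))) ⟩
    Π[] I (pair⁼ i) * N I ∎

  Eᴵ : List (Fin s) → R.Carrier
  Eᴵ I = R.Π[] I (λ i → R.E R.^ β i)

  Regular-Eᴵ : ∀ I → R.Regular (Eᴵ I)
  Regular-Eᴵ []      = R.Regular-1
  Regular-Eᴵ (i ∷ I) = R.Regular-* (R.Regular-^ (β i) R.Regular-E) (Regular-Eᴵ I)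

  -- This is `Eᴵ I` times the coefficient of 1/(1 - y(i,b) X) in the partial fraction expansion of
  -- N(I) ∏ (1 - y X)⁻¹.
  B : List (Fin s) → Index → Carrier
  B I (i , b) = const (R.α (β i) b R.* Eᴵ (I ∖ i)) * (Π[] (I ∖ i) (λ j → cofactor i j b) * N (I ∖ i))

  ∈-W : ∀ I {i b} → (i , b) ∈ W I → i ∈ I × b ℕ.< β i
  ∈-W (j ∷ I) ib∈ with ∈-++⁻ (List.map (j ,_) (upTo (β j))) ib∈
  ... | inj₂ ib∈W with i∈I , b<β ← ∈-W I ib∈W = there i∈I , b<β
  ... | inj₁ ib∈  with b , b∈ , ≡.refl ← ∈-map⁻ (j ,_) ib∈ = here ≡.refl , ∈-upTo⁻ b∈

  Unique-W : ∀ {I} → Unique I → Unique (W I)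
  Unique-W []           = []
  Unique-W {i ∷ I} uI@(_ ∷ uI′) = Unique.++⁺ (Unique.map⁺ (λ { ≡.refl → ≡.refl }) (Unique.upTo⁺ (β i))) (Unique-W uI′)
    (λ { (ib∈ , ib∈W) → Unique-∉ uI (disjoint ib∈ ib∈W) })
    where
    disjoint : ∀ {x} → x ∈ List.map (i ,_) (upTo (β i)) → x ∈ W I → i ∈ I
    disjoint ib∈ ib∈W with b , _ , ≡.refl ← ∈-map⁻ (i ,_) ib∈ = proj₁ (∈-W I ib∈W)

  Regular-y : ∀ {x x′} → x ≢ x′ → Regular (y x - y x′)
  Regular-y {i , b} {j , b′} x≢x′ with i Fin.≟ j
  ... | no  i≢j    = Regular-diff i≢j (R.Regular-^ b reg-q)
  ... | yes ≡.refl = Regular-resp (begin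
    z i * const (q R.^ b R.- q R.^ b′)                ≈⟨ *-congˡ (const-sub _ _) ⟩
    z i * (const (q R.^ b) - const (q R.^ b′))        ≈⟨ *-congˡ (+-cong (const-^ q b) (-‿cong (const-^ q b′))) ⟩
    z i * (const q ^ b - const q ^ b′)                ≈⟨ x[y-z]≈xy-xz _ _ _ ⟩
    z i * const q ^ b - z i * const q ^ b′            ≈⟨ +-cong (y≈ i b) (-‿cong (y≈ i b′)) ⟨
    y (i , b) - y (i , b′)                            ∎)
    (Regular-* (Regular-unit (zz⁻¹≈1 i)) (Regular-const (R.Regular-q-diff {b} {b′} (λ { ≡.refl → x≢x′ ≡.refl }))))

  block-Π : ∀ {i b bs} → upTo (β i) ↭ b ∷ bs →
    const (R.α (β i) b) * Π[] bs (λ b′ → y (i , b) - y (i , b′)) ≈ const (R.E R.^ β i) * Π[] bs (λ _ → y (i , b))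
  block-Π {i} {b} {bs} p = begin
    const (R.α (β i) b) * Π[] bs (λ b′ → y (i , b) - y (i , b′))
      ≈⟨ *-congˡ (Π-cong bs (λ b′ → trans (+-cong (y≈ i b) (-‿cong (y≈ i b′))) (trans (sym (x[y-z]≈xy-xz _ _ _))
           (*-congˡ (sym (trans (const-sub _ _) (+-cong (const-^ q b) (-‿cong (const-^ q b′))))))))) ⟩
    const (R.α (β i) b) * Π[] bs (λ b′ → z i * const (q R.^ b R.- q R.^ b′))
      ≈⟨ *-congˡ (Π-* bs _ _) ⟩
    const (R.α (β i) b) * (Π[] bs (λ _ → z i) * Π[] bs (λ b′ → const (q R.^ b R.- q R.^ b′)))
      ≈⟨ solve 3 (λ a x y → a :* (x :* y) := (a :* y) :* x) refl _ _ _ ⟩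
    (const (R.α (β i) b) * Π[] bs (λ b′ → const (q R.^ b R.- q R.^ b′))) * Π[] bs (λ _ → z i)
      ≈⟨ *-congʳ (trans (*-congˡ (sym (const-Π bs _))) (sym (const-* _ _))) ⟩
    const (R.α (β i) b R.* R.Π[] bs (λ b′ → q R.^ b R.- q R.^ b′)) * Π[] bs (λ _ → z i)
      ≈⟨ *-congʳ (trans (mono-cong (R.α-spec (β≤n̂ i) p)) (const-* _ _)) ⟩
    const (R.E R.^ β i) * const ((q R.^ b) R.^ length bs) * Π[] bs (λ _ → z i)
      ≈⟨ *-congʳ (*-congˡ (trans (mono-cong (R.sym (R.Π-const bs _))) (trans (const-Π bs _) (Π-cong bs (λ _ → const-^ q b))))) ⟩
    const (R.E R.^ β i) * Π[] bs (λ _ → const q ^ b) * Π[] bs (λ _ → z i)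
      ≈⟨ trans (*-assoc _ _ _) (*-congˡ (trans (*-comm _ _) (sym (Π-* bs _ _)))) ⟩
    const (R.E R.^ β i) * Π[] bs (λ _ → z i * const q ^ b)
      ≈⟨ *-congˡ (Π-cong bs (λ _ → y≈ i b)) ⟨
    const (R.E R.^ β i) * Π[] bs (λ _ → y (i , b)) ∎

  -- The nodes other than (i , b) form two groups. Those with the same i differ from it by z_i times
  -- a scalar and are matched by `α`; those of a block j ≠ i are matched by the cofactor, which
  -- leaves `pair⁼ i j`. Together with N of I without i, the latter make up N(I).
  weights : ∀ {I} → Unique I → Lagrange.Weights y (const (Eᴵ I) * N I) 0 (W I) (B I)
  weights {I} uI (i , b) W′ p = begin
    const (R.α (β i) b R.* Eᴵ I′) * (C * N I′) * Π[] W′ (λ x → Y - y x)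
      ≈⟨ *-cong (*-congʳ (const-* _ _)) (trans (Π-↭ _ W′↭) (split (λ x → Y - y x))) ⟩
    const (R.α (β i) b) * const (Eᴵ I′) * (C * N I′)
      * (Π[] bs (λ b′ → Y - y (i , b′)) * Π[] I′ (λ j → Π[] (upTo (β j)) (λ b′ → Y - y (j , b′))))
      ≈⟨ solve 6 (λ a e c n x₁ x₂ → a :* e :* (c :* n) :* (x₁ :* x₂) := e :* n :* (a :* x₁) :* (c :* x₂)) refl _ _ _ _ _ _ ⟩
    const (Eᴵ I′) * N I′ * (const (R.α (β i) b) * Π[] bs (λ b′ → Y - y (i , b′)))
      * (C * Π[] I′ (λ j → Π[] (upTo (β j)) (λ b′ → Y - y (j , b′))))
      ≈⟨ *-cong (*-congˡ (block-Π (↭-∖ᴺ (Unique.upTo⁺ (β i)) (∈-upTo⁺ b<βi))))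
                (trans (sym (Π-* I′ _ _)) (trans (Π-cong I′ (λ j → trans (cofactor-spec i j b b<βi) (*-congˡ (sym (Π-upTo j))))) (Π-* I′ _ _))) ⟩
    const (Eᴵ I′) * N I′ * (const (R.E R.^ β i) * Π[] bs (λ _ → Y))
      * (Π[] I′ (pair⁼ i) * Π[] I′ (λ j → Π[] (upTo (β j)) (λ _ → Y)))
      ≈⟨ solve 6 (λ e n e′ x₁ p x₂ → e :* n :* (e′ :* x₁) :* (p :* x₂) := (e′ :* e) :* (p :* n) :* (x₁ :* x₂)) refl _ _ _ _ _ _ ⟩
    const (R.E R.^ β i) * const (Eᴵ I′) * (Π[] I′ (pair⁼ i) * N I′)
      * (Π[] bs (λ _ → Y) * Π[] I′ (λ j → Π[] (upTo (β j)) (λ _ → Y)))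
      ≈⟨ *-cong (*-cong (trans (sym (const-* _ _)) (mono-cong (R.sym (R.Π-↭ _ I↭))))
                        (trans (sym (N-∷ (∉-∖ I i))) (sym (N-↭ I↭))))
                (trans (sym (split (λ _ → Y))) (trans (sym (Π-↭ _ W′↭)) (Π-const W′ Y))) ⟩
    const (Eᴵ I) * N I * Y ^ length W′ ∎
    where
    I′ = I ∖ i
    bs = upTo (β i) ∖ᴺ b
    Y  = y (i , b)
    C  = Π[] I′ (λ j → cofactor i j b)
    ib∈W = ∈-resp-↭ (↭-sym p) (here ≡.refl)
    b<βi = proj₂ (∈-W I ib∈W)
    I↭ : I ↭ i ∷ I′
    I↭ = ↭-∖ uI (proj₁ (∈-W I ib∈W))
    W′↭ : W′ ↭ List.map (i ,_) bs ++ W I′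
    W′↭ = drop-∷ (↭-trans (↭-sym p) (↭-trans (concatMap-↭ _ I↭)
      (Perm.++⁺ʳ (W I′) (Perm.map⁺ (i ,_) (↭-∖ᴺ (Unique.upTo⁺ (β i)) (∈-upTo⁺ b<βi))))))
    split : ∀ f → Π[] (List.map (i ,_) bs ++ W I′) f
              ≈ Π[] bs (λ b′ → f (i , b′)) * Π[] I′ (λ j → Π[] (upTo (β j)) (λ b′ → f (j , b′)))
    split f = trans (Π-++ (List.map (i ,_) bs) (W I′) f) (*-cong (Π-map bs _ f)
      (trans (Π-concatMap I′ _ f) (Π-cong I′ (λ j → Π-map (upTo (β j)) _ f))))
    Π-upTo : ∀ j → Π[] (upTo (β j)) (λ _ → Y) ≈ Y ^ β j
    Π-upTo j = trans (Π-const (upTo (β j)) Y) (reflexive (≡.cong (Y ^_) (List.length-upTo (β j))))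

  recursion : ∀ {i I} → Unique (i ∷ I) → ∀ t →
    const (Eᴵ (i ∷ I)) * N (i ∷ I) * h (W (i ∷ I)) y t
      ≈ Σ[] (i ∷ I) (λ j → Σ[] (upTo (β j)) (λ b → B (i ∷ I) (j , b) * y (j , b) ^ t))
  recursion {i} {I} uI t = begin
    const (Eᴵ (i ∷ I)) * N (i ∷ I) * h (W (i ∷ I)) y t   ≈⟨ nonempty (W (i ∷ I)) ≡.refl ⟨
    Σ[] (W (i ∷ I)) (λ x → B (i ∷ I) x * y x ^ t)        ≈⟨ Σ-concatMap (i ∷ I) (λ j → List.map (j ,_) (upTo (β j))) _ ⟩
    Σ[] (i ∷ I) (λ j → Σ[] (List.map (j ,_) (upTo (β j))) (λ x → B (i ∷ I) x * y x ^ t))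
      ≈⟨ Σ-cong (i ∷ I) (λ j → Σ-map (upTo (β j)) _ _) ⟩
    Σ[] (i ∷ I) (λ j → Σ[] (upTo (β j)) (λ b → B (i ∷ I) (j , b) * y (j , b) ^ t)) ∎
    where
    open Lagrange y (const (Eᴵ (i ∷ I)) * N (i ∷ I))
    nonempty : ∀ xs → W (i ∷ I) ≡ xs →
      Σ[] xs (λ x → B (i ∷ I) x * y x ^ t) ≈ const (Eᴵ (i ∷ I)) * N (i ∷ I) * h xs y t
    -- Interpolation requires at least one node; β_i ≥ 1 supplies it.
    nonempty [] eq with () ← ≡.trans (≡.sym eq) (≡.cong (λ n → List.map (i ,_) (upTo n) ++ W I) (≡.sym (ℕ.m+[n∸m]≡n (1≤β i))))
    nonempty (x ∷ xs) eq = lagrange x xs (B (i ∷ I))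
      (AllPairs.map Regular-y (≡.subst Unique eq (Unique-W uI)))
      (≡.subst (λ ws → Weights 0 ws (B (i ∷ I))) eq (weights uI)) t

-- Dominance

module SumsOfExponents where
  open BigOperator ℤ.+-0-commutativeMonoid public

  sumAt : ∀ {s} → List (Fin s) → Vec ℤ s → ℤ
  sumAt S k = big S (lookup k)

  sumAt-⊕ : ∀ {s} (S : List (Fin s)) k l → sumAt S (k ⊕ l) ≡ sumAt S k ℤ.+ sumAt S l
  sumAt-⊕ S k l = ≡.trans (big-cong S (λ i → lookup-⊕ i k l)) (big-∙ S (lookup k) (lookup l))

  sumAt-·ε-∉ : ∀ {s} c {i : Fin s} S → i ∉ S → sumAt S (c ·ε i) ≡ 0ℤ
  sumAt-·ε-∉ c {i} S i∉S =
    ≡.trans (big-cong-∈ S (λ {j} j∈S → lookup-·ε-≢ c {i} {j} (λ { ≡.refl → i∉S j∈S }))) (big-ε S)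

  -- A list without repetitions meets i at most once.
  sumAt-neg-·ε : ∀ {s} (i : Fin s) S → Unique S → -1ℤ ℤ.≤ sumAt S (-1ℤ ·ε i)
  sumAt-neg-·ε i []      _ = ℤ.-≤+
  sumAt-neg-·ε i (j ∷ S) (j≢S ∷ uS) with j Fin.≟ i
  ... | yes ≡.refl = ℤ.≤-reflexive (≡.sym (≡.cong₂ ℤ._+_ (lookup-·ε -1ℤ j)
    (sumAt-·ε-∉ -1ℤ S (λ j∈S → All.lookup j≢S j∈S ≡.refl))))
  ... | no  j≢i    = ≡.subst (-1ℤ ℤ.≤_) (≡.sym (≡.trans (≡.cong (ℤ._+ sumAt S (-1ℤ ·ε i)) (lookup-·ε-≢ -1ℤ j≢i)) (ℤ.+-identityˡ _)))
    (sumAt-neg-·ε i S uS)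

⊖-⊕ : ∀ {s} (k l : Vec ℤ s) → (k ⊖ l) ⊕ l ≡ k
⊖-⊕ k l = lookup-ext λ i → ≡.trans (lookup-⊕ i (k ⊖ l) l) (≡.trans (≡.cong (ℤ._+ lookup l i) (lookup-⊖ i k l))
  (≡.trans (ℤ.+-assoc (lookup k i) _ _) (≡.trans (≡.cong (ℤ._+_ (lookup k i)) (ℤ.+-inverseˡ (lookup l i))) (ℤ.+-identityʳ _))))

-- Supports of Laurent polynomials and reduction modulo a variable

module Supports {c ℓ} {R : CommutativeRing c ℓ} {s : ℕ} (LR : LaurentRing R s) where
  private
    module R where
      open CommutativeRing R public
      open BigRing R public
  open Laurent LR

  Supp : (Vec ℤ s → Set) → Carrier → Set _
  Supp P p = ∀ k → ¬ P k → coeff k p R.≈ R.0#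

  coeff-neg : ∀ k p → coeff k (- p) R.≈ R.- coeff k p
  coeff-neg k p = AbelianGroupProperties.inverseˡ-unique R.+-abelianGroup _ _
    (R.trans (R.sym (coeff-+ k (- p) p)) (R.trans (coeff-cong (-‿inverseˡ p)) (coeff-0 k)))

  Supp-resp : ∀ {P p r} → p ≈ r → Supp P p → Supp P r
  Supp-resp p≈r sp k ¬Pk = R.trans (coeff-cong (sym p≈r)) (sp k ¬Pk)

  Supp-⊆ : ∀ {P Q : Vec ℤ s → Set} {p} → (∀ k → P k → Q k) → Supp P p → Supp Q p
  Supp-⊆ P⊆Q sp k ¬Qk = sp k (¬Qk ∘ P⊆Q k)

  Supp-0 : ∀ {P} → Supp P 0#
  Supp-0 k _ = coeff-0 k

  Supp-+ : ∀ {P p r} → Supp P p → Supp P r → Supp P (p + r)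
  Supp-+ sp sr k ¬Pk = R.trans (coeff-+ k _ _) (R.trans (R.+-cong (sp k ¬Pk) (sr k ¬Pk)) (R.+-identityˡ _))

  Supp-neg : ∀ {P p} → Supp P p → Supp P (- p)
  Supp-neg {p = p} sp k ¬Pk = R.trans (coeff-neg k p) (R.trans (R.-‿cong (sp k ¬Pk)) -0≈0)
    where open RingProperties R.ring using () renaming (-0#≈0# to -0≈0)

  Supp-Σ : ∀ {a} {A : Set a} {P} (xs : List A) {f} → (∀ {x} → x ∈ xs → Supp P (f x)) → Supp P (Σ[] xs f)
  Supp-Σ []       sf = Supp-0
  Supp-Σ (x ∷ xs) sf = Supp-+ (sf (here ≡.refl)) (Supp-Σ xs (sf ∘ there))

  Supp-mono : ∀ {P Q : Vec ℤ s → Set} {a d p} → (∀ k → P k → Q (k ⊕ d)) → Supp P p → Supp Q (mono a d * p)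
  Supp-mono {Q = Q} {a} {d} {p} shift sp k ¬Qk = R.trans (coeff-mono-* k a d p)
    (R.trans (R.*-congˡ (sp (k ⊖ d) (λ Pk → ¬Qk (≡.subst Q (⊖-⊕ k d) (shift (k ⊖ d) Pk))))) (R.zeroʳ a))

  Supp-cancel : ∀ {P a p} → R.Regular a → Supp P (const a * p) → Supp P p
  Supp-cancel {a = a} {p} reg sp k ¬Pk = reg _ (R.trans (R.sym (coeff-const-* k a p)) (sp k ¬Pk))

  -- The elements by which the submodule of elements supported in P is
  -- closed under multiplication; they form a subring.
  Stable : (Vec ℤ s → Set) → Carrier → Set _
  Stable P x = ∀ {p} → Supp P p → Supp P (x * p)

  Stable-resp : ∀ {P x x′} → x ≈ x′ → Stable P x → Stable P x′
  Stable-resp x≈x′ st sp = Supp-resp (*-congʳ x≈x′) (st sp)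

  Stable-mono : ∀ {P : Vec ℤ s → Set} a d → (∀ k → P k → P (k ⊕ d)) → Stable P (mono a d)
  Stable-mono a d shift = Supp-mono shift

  Stable-const : ∀ {P} a → Stable P (const a)
  Stable-const {P} a = Stable-mono a 0⃗ (λ k → ≡.subst P (≡.sym (Vec.zipWith-identityʳ ℤ.+-identityʳ k)))

  Stable-+ : ∀ {P x x′} → Stable P x → Stable P x′ → Stable P (x + x′)
  Stable-+ sx sx′ sp = Supp-resp (sym (distribʳ _ _ _)) (Supp-+ (sx sp) (sx′ sp))

  Stable-neg : ∀ {P x} → Stable P x → Stable P (- x)
  Stable-neg sx sp = Supp-resp (-‿distribˡ-* _ _) (Supp-neg (sx sp))

  Stable-* : ∀ {P x x′} → Stable P x → Stable P x′ → Stable P (x * x′)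
  Stable-* sx sx′ sp = Supp-resp (sym (*-assoc _ _ _)) (sx (sx′ sp))

  Stable-0 : ∀ {P} → Stable P 0#
  Stable-0 sp = Supp-resp (sym (zeroˡ _)) Supp-0

  Stable-1 : ∀ {P} → Stable P 1#
  Stable-1 sp = Supp-resp (sym (*-identityˡ _)) sp

  Stable-^ : ∀ {P x} n → Stable P x → Stable P (x ^ n)
  Stable-^         zero    sx = Stable-1
  Stable-^ {P} {x} (suc n) sx = Stable-* {P} {x} {x ^ n} sx (Stable-^ {P} n sx)

  Stable-Π : ∀ {a} {A : Set a} {P} (xs : List A) {f} → (∀ {x} → x ∈ xs → Stable P (f x)) → Stable P (Π[] xs f)
  Stable-Π         []       sf = Stable-1
  Stable-Π {P = P} (x ∷ xs) {f} sf = Stable-* {P} {f x} {Π[] xs f} (sf (here ≡.refl)) (Stable-Π {P = P} xs {f} (sf ∘ there))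

  module _ {P : Vec ℤ s → Set} (q : R.Carrier) where
    open QProducts ring (const q)

    Stable-pp : ∀ n {a x} → Stable P a → Stable P x → Stable P (pp n a x)
    Stable-pp zero    sa sx = Stable-1
    Stable-pp (suc n) {a} {x} sa sx = Stable-* {P} {pp n a x} (Stable-pp n sa sx)
      (Stable-+ {P} {a} sa (Stable-neg {P} {const q ^ n * x} (Stable-* {P} {const q ^ n} {x} (Stable-^ {P} n (Stable-const q)) sx)))

  Stable-h : ∀ {P} {A : Set} (xs : List A) {y} → (∀ {x} → x ∈ xs → Stable P (y x)) →
             ∀ m → Stable P (CompleteHomogeneous.h ring xs y m)
  Stable-h []       sy zero    = Stable-1
  Stable-h []       sy (suc m) = Stable-0
  Stable-h {P} (x ∷ xs) sy zero    = Stable-h {P} xs (sy ∘ there) zero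
  Stable-h {P} (x ∷ xs) {y} sy (suc m) = Stable-+ {P} {h xs y (suc m)} (Stable-h {P} xs (sy ∘ there) (suc m))
    (Stable-* {P} {y x} {h (x ∷ xs) y m} (sy (here ≡.refl)) (Stable-h {P} (x ∷ xs) sy m))
    where open CompleteHomogeneous ring

  -- The elements that are polynomial in z_i, and among them the ideal generated by z_i.
  NonNeg Pos : Fin s → Carrier → Set _
  NonNeg i = Supp (λ k → 0ℤ ℤ.≤ lookup k i)
  Pos    i = Supp (λ k → 0ℤ ℤ.< lookup k i)

  NonNeg-* : ∀ i {p r} → NonNeg i p → NonNeg i r → NonNeg i (p * r)
  NonNeg-* i {p} {r} np nr k ¬0≤k = coeff-*-0 k p r cases
    where
    cases : ∀ e → coeff e p R.≈ R.0# ⊎ coeff (k ⊖ e) r R.≈ R.0#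
    cases e with 0ℤ ℤ.≤? lookup e i
    ... | no  ¬0≤e = inj₁ (np e ¬0≤e)
    ... | yes 0≤e  = inj₂ (nr (k ⊖ e) (λ 0≤k-e → ¬0≤k (≡.subst (0ℤ ℤ.≤_) (≡.cong (λ l → lookup l i) (⊖-⊕ k e))
      (≡.subst (0ℤ ℤ.≤_) (≡.sym (lookup-⊕ i (k ⊖ e) e)) (ℤ.+-mono-≤ 0≤k-e 0≤e)))))

  Pos-* : ∀ i {p r} → Pos i p → NonNeg i r → Pos i (p * r)
  Pos-* i {p} {r} np nr k ¬0<k = coeff-*-0 k p r cases
    where
    cases : ∀ e → coeff e p R.≈ R.0# ⊎ coeff (k ⊖ e) r R.≈ R.0#
    cases e with 0ℤ ℤ.<? lookup e i
    ... | no  ¬0<e = inj₁ (np e ¬0<e)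
    ... | yes 0<e  = inj₂ (nr (k ⊖ e) (λ 0≤k-e → ¬0<k (≡.subst (0ℤ ℤ.<_) (≡.cong (λ l → lookup l i) (⊖-⊕ k e))
      (≡.subst (0ℤ ℤ.<_) (≡.sym (lookup-⊕ i (k ⊖ e) e)) (ℤ.+-mono-≤-< 0≤k-e 0<e)))))

  Pos⇒NonNeg : ∀ i {p} → Pos i p → NonNeg i p
  Pos⇒NonNeg i = Supp-⊆ (λ k → ℤ.<⇒≤)

  -- Congruence modulo zᵢ among the elements that are polynomial in zᵢ.
  record Cong (i : Fin s) (p r : Carrier) : Set (c ⊔ ℓ) where
    constructor cong′
    field
      nonNegˡ : NonNeg i p
      nonNegʳ : NonNeg i r
      pos     : Pos i (p - r)
  open Cong public

  module _ {i : Fin s} where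
    open IntegerSolver ring

    Cong-refl : ∀ {p} → NonNeg i p → Cong i p p
    Cong-refl np = cong′ np np (Supp-resp (sym (-‿inverseʳ _)) Supp-0)

    Cong-resp : ∀ {p p′ r r′} → p ≈ p′ → r ≈ r′ → Cong i p r → Cong i p′ r′
    Cong-resp p≈ r≈ (cong′ np nr d) = cong′ (Supp-resp p≈ np) (Supp-resp r≈ nr) (Supp-resp (+-cong p≈ (-‿cong r≈)) d)

    Cong-+ : ∀ {p p′ r r′} → Cong i p r → Cong i p′ r′ → Cong i (p + p′) (r + r′)
    Cong-+ {p} {p′} {r} {r′} (cong′ np nr d) (cong′ np′ nr′ d′) = cong′ (Supp-+ np np′) (Supp-+ nr nr′)
      (Supp-resp (solve 4 (λ p p′ r r′ → (p :- r) :+ (p′ :- r′) := (p :+ p′) :- (r :+ r′)) refl p p′ r r′) (Supp-+ d d′))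

    Cong-neg : ∀ {p r} → Cong i p r → Cong i (- p) (- r)
    Cong-neg {p} {r} (cong′ np nr d) = cong′ (Supp-neg np) (Supp-neg nr)
      (Supp-resp (solve 2 (λ p r → :- (p :- r) := :- p :- :- r) refl p r) (Supp-neg d))

    Cong-* : ∀ {p p′ r r′} → Cong i p r → Cong i p′ r′ → Cong i (p * p′) (r * r′)
    Cong-* {p} {p′} {r} {r′} (cong′ np nr d) (cong′ np′ nr′ d′) = cong′ (NonNeg-* i np np′) (NonNeg-* i nr nr′)
      (Supp-resp (solve 4 (λ p p′ r r′ → (p :- r) :* p′ :+ (p′ :- r′) :* r := (p :* p′) :- (r :* r′)) refl p p′ r r′)
        (Supp-+ (Pos-* i d np′) (Pos-* i d′ nr)))

    Cong-mono-0 : ∀ a {d} → 0ℤ ℤ.< lookup d i → Cong i (mono a d) 0#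
    Cong-mono-0 a {d} 0<d = cong′ (Pos⇒NonNeg i pos-mono) Supp-0
      (Supp-resp (sym (trans (+-congˡ -0#≈0#) (+-identityʳ _))) pos-mono)
      where
      pos-mono : Pos i (mono a d)
      pos-mono = Supp-resp (*-identityʳ _) (Supp-mono {P = λ k → k ≡ 0⃗}
        (λ { k ≡.refl → ≡.subst (0ℤ ℤ.<_) (≡.sym (≡.trans (lookup-⊕ i 0⃗ d) (≡.trans (≡.cong (ℤ._+ lookup d i) (Vec.lookup-replicate i 0ℤ)) (ℤ.+-identityˡ _)))) 0<d })
        (λ k → coeff-1-≢))

    NonNeg-const : ∀ a → NonNeg i (const a)
    NonNeg-const a = Supp-resp (*-identityʳ _) (Stable-const a
      (λ k ¬0≤k → coeff-1-≢ (λ { ≡.refl → ¬0≤k (ℤ.≤-reflexive (≡.sym (Vec.lookup-replicate i 0ℤ))) })))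

    Cong-1 : Cong i 1# 1#
    Cong-1 = Cong-refl (Supp-resp mono-1 (NonNeg-const R.1#))

    Cong-Π : ∀ {a} {A : Set a} (xs : List A) {f g} → (∀ {x} → x ∈ xs → Cong i (f x) (g x)) → Cong i (Π[] xs f) (Π[] xs g)
    Cong-Π []       fg = Cong-1
    Cong-Π (x ∷ xs) fg = Cong-* (fg (here ≡.refl)) (Cong-Π xs (fg ∘ there))

    coeff-Cong : ∀ {p r} → Cong i p r → ∀ k → lookup k i ≡ 0ℤ → coeff k p R.≈ coeff k r
    coeff-Cong {p} {r} (cong′ _ _ d) k k≡0 = R.trans (coeff-cong (solve 2 (λ p r → p := (p :- r) :+ r) refl p r))
      (R.trans (coeff-+ k _ _) (R.trans (R.+-congʳ (d k (λ 0<k → ℤ.<-irrefl (≡.sym k≡0) 0<k))) (R.+-identityˡ _)))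

    module _ (q : R.Carrier) where
      open QProducts ring (const q)

      Cong-q^ : ∀ n → Cong i (const q ^ n) (const q ^ n)
      Cong-q^ n = Cong-refl (Supp-resp (const-^ q n) (NonNeg-const _))

      -- Modulo z_i each factor of the product reduces to a. With x a scalar multiple of z_i/z_j
      -- this evaluates the polynomials p_{ijb} at 0.
      Cong-pp : ∀ n {a x} → Cong i a a → Cong i x 0# → Cong i (pp n a x) (a ^ n)
      Cong-pp zero    ca cx = Cong-1
      Cong-pp (suc n) {a} {x} ca cx = Cong-resp refl
        (trans (*-congˡ (trans (+-congˡ (trans (-‿cong (zeroʳ _)) -0#≈0#)) (+-identityʳ a))) (*-comm _ _))
        (Cong-* (Cong-pp n ca cx) (Cong-+ ca (Cong-neg (Cong-* (Cong-q^ n) cx))))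

Unique-++⁻ˡ : ∀ {a} {A : Set a} (xs : List A) {ys} → Unique (xs ++ ys) → Unique xs
Unique-++⁻ˡ []       _          = []
Unique-++⁻ˡ (x ∷ xs) (x≢ ∷ uxs) = All.++⁻ˡ xs x≢ ∷ Unique-++⁻ˡ xs uxs

-- The flag marks those exponents m_l whose sum is to be bounded by entries of k.
wt : Bool → ℕ → ℕ
wt true  m = m
wt false m = 0

total count : List (Bool × ℕ) → ℕ
total []             = 0
total ((f , m) ∷ ms) = wt f m ℕ.+ total ms
count []             = 0
count ((f , m) ∷ ms) = wt f 1 ℕ.+ count ms

module DominanceSupport {c ℓ} {R : CommutativeRing c ℓ} {s : ℕ} (LR : LaurentRing R s) (q : CommutativeRing.Carrier R) (gen : Generic R q)
  (β : Fin s → ℕ) (1≤β : ∀ i → 1 ℕ.≤ β i) (n̂ : ℕ) (β≤n̂ : ∀ i → β i ℕ.≤ n̂) where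
  private
    module R where
      open CommutativeRing R public
      open BigRing R public
      open Exp semiring public
  open Laurent LR
  open Recursion LR q gen β 1≤β n̂ β≤n̂
  open Supports LR
  open SumsOfExponents
  open IntegerSolver ring
  open CompleteHomogeneous ring
  open QProducts ring (const q)
  open Removal (Fin._≟_ {s})
  open SetoidReasoning setoid

  hᵂ : List (Fin s) → ℕ → Carrier
  hᵂ I = h (W I) y

  u≈mono : ∀ i j → z i * z⁻¹ j ≈ mono (R.1# R.* R.1#) ((1ℤ ·ε i) ⊕ (-1ℤ ·ε j))
  u≈mono i j = sym (mono-* _ _ _ _)

  module _ {P : Vec ℤ s → Set} {i j : Fin s} (st : Stable P (z i * z⁻¹ j)) where

    private
      st-pp : ∀ n a x → Stable P x → Stable P (pp n (const q ^ a) x)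
      st-pp n a x = Stable-pp {P} q n (Stable-^ {P} a (Stable-const q))

      st-q* : ∀ n → Stable P (const q ^ n * (z i * z⁻¹ j))
      st-q* n = Stable-* {P} {const q ^ n} (Stable-^ {P} n (Stable-const q)) st

      st-q : Stable P (const q * (z i * z⁻¹ j))
      st-q = Stable-* {P} {const q} (Stable-const q) st

    Stable-cofactor : ∀ b → Stable P (cofactor i j b)
    Stable-cofactor b with i Fin.<? j
    ... | yes _ = Stable-* {P} {pp (suc b) (const q ^ β j) (z i * z⁻¹ j)}
      (st-pp (suc b) (β j) _ st) (Stable-pp {P} q (β i ℕ.∸ suc b) Stable-1 (st-q* (suc b)))
    ... | no  _ = Stable-* {P} {pp b (const q ^ β j) (const q * (z i * z⁻¹ j))}
      (st-pp b (β j) _ st-q) (Stable-pp {P} q (β i ℕ.∸ b) Stable-1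
        (Stable-* {P} {const q ^ b} (Stable-^ {P} b (Stable-const q)) st-q))

  module _ {P : Vec ℤ s → Set} (I : List (Fin s))
           (st-z : ∀ {i} c → i ∈ I → ∀ k → P k → P (k ⊕ (c ·ε i))) where

    private
      st-u : ∀ {i j} → i ∈ I → j ∈ I → Stable P (z i * z⁻¹ j)
      st-u {i} {j} i∈I j∈I = Stable-* {P} {z i} {z⁻¹ j} (Stable-mono _ _ (st-z 1ℤ i∈I)) (Stable-mono _ _ (st-z -1ℤ j∈I))

      st-qPoch : ∀ n x → Stable P x → Stable P (QPochhammer.qPoch rawRing x (const q) n)
      st-qPoch n x sx = ≡.subst (Stable P) (≡.sym (qPoch≡pp x n)) (Stable-pp {P} q n Stable-1 sx)

    Stable-N : Stable P (N I)
    Stable-N = Stable-Π {P = P} I (λ i∈I → Stable-Π {P = P} I (λ j∈I → st-pair₁ i∈I j∈I))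
      where
      st-pair₁ : ∀ {i j} → i ∈ I → j ∈ I → Stable P (pair₁ i j)
      st-pair₁ {i} {j} i∈I j∈I with i Fin.<? j
      ... | no  _ = Stable-1
      ... | yes _ = Stable-* {P} {QPochhammer.qPoch rawRing (z i * z⁻¹ j) (const q) (β i)}
        (st-qPoch (β i) _ (st-u i∈I j∈I))
        (st-qPoch (β j) _ (Stable-* {P} {const q} (Stable-const q) (st-u j∈I i∈I)))

    Stable-hᵂ : ∀ m → Stable P (hᵂ I m)
    Stable-hᵂ = Stable-h {P} (W I) (λ { {i , b} ib∈ → Stable-mono _ _ (st-z 1ℤ (proj₁ (∈-W I ib∈))) })

  module _ {i : Fin s} {I : List (Fin s)} (i∉I : i ∉ I) where

    private
      keep : ∀ {j} c → j ∈ I → ∀ k → lookup k i ≡ 0ℤ → lookup (k ⊕ (c ·ε j)) i ≡ 0ℤ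
      keep {j} c j∈I k k≡0 = ≡.trans (lookup-⊕ i k (c ·ε j))
        (≡.cong₂ ℤ._+_ k≡0 (lookup-·ε-≢ c {j} {i} (λ { ≡.refl → i∉I j∈I })))

      1-free : Supp (λ k → lookup k i ≡ 0ℤ) 1#
      1-free k k≢0 = coeff-1-≢ (λ { ≡.refl → k≢0 (Vec.lookup-replicate i 0ℤ) })

    N-free : Supp (λ k → lookup k i ≡ 0ℤ) (N I)
    N-free = Supp-resp (*-identityʳ _) (Stable-N I keep 1-free)

    hᵂ-free : ∀ m → Supp (λ k → lookup k i ≡ 0ℤ) (hᵂ I m)
    hᵂ-free m = Supp-resp (*-identityʳ _) (Stable-hᵂ I keep m 1-free)

    N-hᵂ-free : ∀ {a} {A : Set a} (ms : List A) (g : A → ℕ) → Supp (λ k → lookup k i ≡ 0ℤ) (N I * Π[] ms (hᵂ I ∘ g))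
    N-hᵂ-free ms g = Stable-N I keep (Supp-resp (*-identityʳ _)
      (Stable-Π {P = λ k → lookup k i ≡ 0ℤ} ms {hᵂ I ∘ g} (λ {m} _ → Stable-hᵂ I keep (g m)) 1-free))

  W-∖ : ∀ {i I} → Unique I → i ∈ I → W I ↭ List.map (i ,_) (upTo (β i)) ++ W (I ∖ i)
  W-∖ uI i∈I = concatMap-↭ _ (↭-∖ uI i∈I)

  -- n entries of k with indices in I (or all of them) have sum at least c.
  record Dom (I : List (Fin s)) (n c : ℕ) (k : Vec ℤ s) : Set where
    constructor dom
    field
      chosen rest : List (Fin s)
      perm  : chosen ++ rest ↭ I
      size  : length chosen ≡ n ℕ.⊓ length I
      large : + c ℤ.≤ sumAt chosen k

  module _ (i : Fin s) (I : List (Fin s)) (i∉I : i ∉ I) (uI : Unique I) (n : ℕ) where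

    -- The intermediate condition for i ∷ I: the entry at i is always counted, in addition to n
    -- entries from I. Only with i fixed in this way is the bound stable under multiplication by
    -- z_i/z_j.
    record Dom∷ (c : ℕ) (k : Vec ℤ s) : Set where
      constructor dom∷
      field
        chosen rest : List (Fin s)
        perm  : chosen ++ rest ↭ I
        size  : length chosen ≡ n ℕ.⊓ length I
        large : + c ℤ.≤ lookup k i ℤ.+ sumAt chosen k

    private
      ∉-chosen : ∀ {S S′} → S ++ S′ ↭ I → i ∉ S
      ∉-chosen p i∈S = i∉I (∈-resp-↭ p (∈-++⁺ˡ i∈S))

      lift-raise : ∀ c k → Dom∷ c k → Dom∷ (suc c) (k ⊕ (1ℤ ·ε i))
      lift-raise c k (dom∷ S S′ p sz lg) = dom∷ S S′ p sz (≡.subst (+ suc c ℤ.≤_) (≡.sym eq) (ℤ.+-mono-≤ (ℤ.≤-refl {1ℤ}) lg))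
        where
        eq : lookup (k ⊕ (1ℤ ·ε i)) i ℤ.+ sumAt S (k ⊕ (1ℤ ·ε i)) ≡ 1ℤ ℤ.+ (lookup k i ℤ.+ sumAt S k)
        eq = ≡.trans (≡.cong₂ ℤ._+_ (≡.trans (lookup-⊕ i k (1ℤ ·ε i)) (≡.cong (ℤ._+_ (lookup k i)) (lookup-·ε 1ℤ i)))
          (≡.trans (sumAt-⊕ S k (1ℤ ·ε i)) (≡.trans (≡.cong (ℤ._+_ (sumAt S k)) (sumAt-·ε-∉ 1ℤ S (∉-chosen p))) (ℤ.+-identityʳ _))))
          (≡.trans (≡.cong (ℤ._+ sumAt S k) (ℤ.+-comm (lookup k i) 1ℤ)) (ℤ.+-assoc 1ℤ (lookup k i) (sumAt S k)))

      -- The entry at i grows by one, while the sum over S drops by at most one, namely if j lies in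
      -- S.
      lift-u : ∀ {j} → j ∈ I → ∀ c k → Dom∷ c k → Dom∷ c (k ⊕ ((1ℤ ·ε i) ⊕ (-1ℤ ·ε j)))
      lift-u {j} j∈I c k (dom∷ S S′ p sz lg) = dom∷ S S′ p sz (ℤ.≤-trans lg bound)
        where
        a = lookup k i
        b = sumAt S k
        d = sumAt S (-1ℤ ·ε j)
        uS : Unique S
        uS = Unique-++⁻ˡ S (Unique-resp-↭ (↭-sym p) uI)
        j≢i : i ≢ j
        j≢i ≡.refl = i∉I j∈I
        eqᵢ : lookup (k ⊕ ((1ℤ ·ε i) ⊕ (-1ℤ ·ε j))) i ≡ a ℤ.+ 1ℤ
        eqᵢ = ≡.trans (lookup-⊕ i k ((1ℤ ·ε i) ⊕ (-1ℤ ·ε j))) (≡.cong (ℤ._+_ a)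
          (≡.trans (lookup-⊕ i (1ℤ ·ε i) (-1ℤ ·ε j)) (≡.cong₂ ℤ._+_ (lookup-·ε 1ℤ i) (lookup-·ε-≢ -1ℤ {j} {i} j≢i))))
        eqₛ : sumAt S (k ⊕ ((1ℤ ·ε i) ⊕ (-1ℤ ·ε j))) ≡ b ℤ.+ d
        eqₛ = ≡.trans (sumAt-⊕ S k ((1ℤ ·ε i) ⊕ (-1ℤ ·ε j))) (≡.cong (ℤ._+_ b)
          (≡.trans (sumAt-⊕ S (1ℤ ·ε i) (-1ℤ ·ε j)) (≡.trans (≡.cong (ℤ._+ d) (sumAt-·ε-∉ 1ℤ S (∉-chosen p))) (ℤ.+-identityˡ d))))
        bound : a ℤ.+ b ℤ.≤ lookup (k ⊕ ((1ℤ ·ε i) ⊕ (-1ℤ ·ε j))) i ℤ.+ sumAt S (k ⊕ ((1ℤ ·ε i) ⊕ (-1ℤ ·ε j)))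
        bound = ≡.subst (a ℤ.+ b ℤ.≤_) (≡.sym (≡.trans (≡.cong₂ ℤ._+_ eqᵢ eqₛ) (exchange a 1ℤ b d)))
          (≡.subst (ℤ._≤ a ℤ.+ b ℤ.+ (1ℤ ℤ.+ d)) (ℤ.+-identityʳ _)
            (ℤ.+-monoʳ-≤ (a ℤ.+ b) (ℤ.+-monoʳ-≤ 1ℤ (sumAt-neg-·ε j S uS))))

      V : ℕ → Carrier → Set _
      V c = Supp (Dom∷ c)

      V-cast : ∀ {c c′ p} → c ≡ c′ → V c p → V c′ p
      V-cast ≡.refl vp = vp

      V-suc : ∀ {c p} → V (suc c) p → V c p
      V-suc = Supp-⊆ (λ { k (dom∷ S S′ p sz lg) → dom∷ S S′ p sz (ℤ.≤-trans (ℤ.+≤+ (ℕ.n≤1+n _)) lg) })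

      V-y : ∀ {c p} b → V c p → V (suc c) (y (i , b) * p)
      V-y b = Supp-mono (lift-raise _)

      -- The recursion of `h` either drops the node (i , b) or takes out `y (i , b)` and lowers m by
      -- one. In the second case the exponent of z_i makes up for the lost unit of m if m is
      -- flagged; otherwise the gain is discarded by `V-suc`.
      expand₁ : ∀ bs Y f c X → (∀ m → V (c ℕ.+ wt f m) (X * h Y y m)) →
                ∀ m → V (c ℕ.+ wt f m) (X * h (List.map (i ,_) bs ++ Y) y m)
      expand₁ []       Y f c X hyp m       = hyp m
      expand₁ (b ∷ bs) Y f c X hyp zero    = expand₁ bs Y f c X hyp zero
      expand₁ (b ∷ bs) Y f c X hyp (suc m) = Supp-resp
        (solve 4 (λ x h₁ y h₂ → x :* h₁ :+ y :* (x :* h₂) := x :* (h₁ :+ y :* h₂)) refl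
          X (h (List.map (i ,_) bs ++ Y) y (suc m)) (y (i , b)) (h (List.map (i ,_) (b ∷ bs) ++ Y) y m))
        (Supp-+ (expand₁ bs Y f c X hyp (suc m)) (raise f (V-y b (expand₁ (b ∷ bs) Y f c X hyp m))))
        where
        raise : ∀ f {p} → V (suc (c ℕ.+ wt f m)) p → V (c ℕ.+ wt f (suc m)) p
        raise true  {p} = ≡.subst (λ c → V c p) (≡.sym (ℕ.+-suc c m))
        raise false {p} = V-suc

      -- The factors are expanded one after another, and those already expanded are collected in X
      -- with smaller arguments. The hypothesis therefore ranges over all exponents with the given
      -- flags.
      expand : ∀ bs Y ms c X → (∀ ms′ → List.map proj₁ ms′ ≡ List.map proj₁ ms → V (c ℕ.+ total ms′) (X * Π[] ms′ (h Y y ∘ proj₂))) →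
               V (c ℕ.+ total ms) (X * Π[] ms (h (List.map (i ,_) bs ++ Y) y ∘ proj₂))
      expand bs Y []             c X hyp = hyp [] ≡.refl
      expand bs Y ((f , m) ∷ ms) c X hyp = V-cast (reorder (total ms) (wt f m))
        (Supp-resp (solve 3 (λ x p h → (x :* p) :* h := x :* (h :* p)) refl X _ _)
          (expand₁ bs Y f (c ℕ.+ total ms) (X * Π[] ms (h (List.map (i ,_) bs ++ Y) y ∘ proj₂)) (λ m′ →
            V-cast (≡.sym (≡.trans (reorder (total ms) (wt f m′)) (≡.sym (ℕ.+-assoc c (wt f m′) (total ms)))))
              (Supp-resp (solve 3 (λ x h p → (x :* h) :* p := (x :* p) :* h) refl X _ _)
                (expand bs Y ms (c ℕ.+ wt f m′) (X * h Y y m′) (λ ms′ eq →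
                  V-cast (≡.sym (ℕ.+-assoc c (wt f m′) (total ms′)))
                    (Supp-resp (sym (*-assoc _ _ _)) (hyp ((f , m′) ∷ ms′) (≡.cong (f ∷_) eq))))))) m))
        where
        reorder : ∀ a b → c ℕ.+ a ℕ.+ b ≡ c ℕ.+ (b ℕ.+ a)
        reorder a b = ≡.trans (ℕ.+-assoc c a b) (≡.cong (c ℕ.+_) (ℕ.+-comm a b))

      V-y^ : ∀ {c p} b t → V c p → V (t ℕ.+ c) (y (i , b) ^ t * p)
      V-y^ b zero    vp = Supp-resp (sym (*-identityˡ _)) vp
      V-y^ b (suc t) vp = Supp-resp (sym (*-assoc _ _ _)) (V-y b (V-y^ b t vp))

    -- The smaller product N(I) ∏ h meets the bound by induction, the expansion of the nodes of
    -- block i preserves it, the power of `y (i , b)` raises it by t, and the cofactors, being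
    -- polynomials in the z_i/z_j, do not spoil it.
    term-support : ∀ ms → count ms ≡ n →
      (∀ ms′ → count ms′ ≡ n → Supp (Dom I n (total ms′)) (N I * Π[] ms′ (hᵂ I ∘ proj₂))) →
      ∀ b t a → Supp (Dom (i ∷ I) (suc n) (t ℕ.+ total ms))
        (const a * (Π[] I (λ j → cofactor i j b) * N I) * y (i , b) ^ t
          * Π[] ms (h (List.map (i ,_) (upTo (β i)) ++ W I) y ∘ proj₂))
    term-support ms cnt IH b t a = Supp-⊆ dom∷⇒dom (Supp-resp
      (solve 5 (λ a c n y p → (a :* c) :* (y :* (n :* p)) := a :* (c :* n) :* y :* p) refl
        (const a) (Π[] I (λ j → cofactor i j b)) (N I) (y (i , b) ^ t) _)
      (Stable-* {Dom∷ _} {const a} (Stable-const a) (Stable-Π {P = Dom∷ _} I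
        (λ {j} j∈I → Stable-cofactor (Stable-resp {x = mono _ _} (sym (u≈mono i j)) (Stable-mono _ _ (lift-u j∈I _))) b))
        (V-y^ b t (expand (upTo (β i)) (W I) ms 0 (N I) (λ ms′ eq → embed ms′ (IH ms′ (≡.trans (count-flags ms′ ms eq) cnt)))))))
      where
      count-flags : ∀ ms ms′ → List.map proj₁ ms ≡ List.map proj₁ ms′ → count ms ≡ count ms′
      count-flags []             []               eq = ≡.refl
      count-flags ((f , _) ∷ ms) ((f′ , _) ∷ ms′) eq with ≡.refl , eq′ ← List.∷-injective eq =
        ≡.cong (wt f 1 ℕ.+_) (count-flags ms ms′ eq′)

      -- The product does not involve z_i, so the entry at i is 0 and counting it changes nothing.
      embed : ∀ ms′ → Supp (Dom I n (total ms′)) (N I * Π[] ms′ (hᵂ I ∘ proj₂)) → V (total ms′) (N I * Π[] ms′ (hᵂ I ∘ proj₂))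
      embed ms′ sp k ¬dom∷ with lookup k i ℤ.≟ 0ℤ
      ... | no  k≢0 = N-hᵂ-free i∉I ms′ proj₂ k k≢0
      ... | yes k≡0 = sp k (λ { (dom S S′ p sz lg) → ¬dom∷ (dom∷ S S′ p sz
        (≡.subst (+ total ms′ ℤ.≤_) (≡.sym (≡.trans (≡.cong (ℤ._+ sumAt S k) k≡0) (ℤ.+-identityˡ _))) lg)) })

      dom∷⇒dom : ∀ k → Dom∷ (t ℕ.+ total ms) k → Dom (i ∷ I) (suc n) (t ℕ.+ total ms) k
      dom∷⇒dom k (dom∷ S S′ p sz lg) = dom (i ∷ S) S′ (prep i p) (≡.cong suc sz) lg

  private
    -- Any flagged exponent can play the role of t; without one, the empty choice of entries meets
    -- the bound 0.
    data Flagged (ms : List (Bool × ℕ)) : Set where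
      none : count ms ≡ 0 → total ms ≡ 0 → Flagged ms
      some : ∀ t ms′ → ms ↭ (true , t) ∷ ms′ → count ms ≡ suc (count ms′) → total ms ≡ t ℕ.+ total ms′ → Flagged ms

    flagged : ∀ ms → Flagged ms
    flagged [] = none ≡.refl ≡.refl
    flagged ((true , t) ∷ ms) = some t ms ↭-refl ≡.refl ≡.refl
    flagged ((false , m) ∷ ms) with flagged ms
    ... | none c₀ t₀ = none c₀ t₀
    ... | some t ms′ p ceq teq = some t ((false , m) ∷ ms′) (↭-trans (prep _ p) (swap _ _ ↭-refl)) ceq teq

    Dom-respʳ : ∀ {I I′ n c k} → I ↭ I′ → Dom I n c k → Dom I′ n c k
    Dom-respʳ {n = n} I↭ (dom S S′ p sz lg) = dom S S′ (↭-trans p I↭) (≡.trans sz (≡.cong (n ℕ.⊓_) (↭-length I↭))) lg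

    -- Without variables `h` is 1 in degree 0 and 0 in positive degree, so a positive flagged
    -- exponent kills the product.
    empty : ∀ ms → total ms ≡ 0 ⊎ Π[] ms (hᵂ [] ∘ proj₂) ≈ 0#
    empty [] = inj₁ ≡.refl
    empty ((f , m) ∷ ms) with empty ms
    ... | inj₂ eq = inj₂ (trans (*-congˡ eq) (zeroʳ _))
    empty ((false , m)     ∷ ms) | inj₁ eq = inj₁ eq
    empty ((true  , zero)  ∷ ms) | inj₁ eq = inj₁ eq
    empty ((true  , suc m) ∷ ms) | inj₁ eq = inj₂ (zeroˡ _)

    -- Induction on the number of variables. Each round uses up one flagged exponent and one
    -- variable, and `Eᴵ I`, with which the recursion is multiplied, is cancelled at once.
    go : ∀ l I → length I ≡ l → Unique I → ∀ ms → Supp (Dom I (count ms) (total ms)) (N I * Π[] ms (hᵂ I ∘ proj₂))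
    go zero [] eq uI ms k ¬dom with empty ms
    ... | inj₂ eq = Supp-resp {P = Dom [] (count ms) (total ms)} (sym (trans (*-congˡ eq) (zeroʳ _))) Supp-0 k ¬dom
    ... | inj₁ t₀ = ⊥-elim (¬dom (dom [] _ ↭-refl (≡.sym (ℕ.⊓-zeroʳ (count ms))) (ℤ.≤-reflexive (≡.cong +_ t₀))))
    go (suc l) I@(i₀ ∷ I₀) eq uI ms with flagged ms
    ... | none c₀ t₀ = λ k ¬dom → ⊥-elim (¬dom (dom [] _ ↭-refl (≡.sym (≡.cong (ℕ._⊓ suc (length I₀)) c₀)) (ℤ.≤-reflexive (≡.cong +_ t₀))))
    ... | some t ms′ p ceq teq rewrite ceq | teq = Supp-cancel (Regular-Eᴵ I) (Supp-resp rearrange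
          (Supp-Σ I (λ {i} i∈I → Supp-resp (sym (Σ-* (upTo (β i)) _ _)) (Supp-Σ (upTo (β i)) (λ {b} _ → term i∈I b)))))
      where
      Π′ = Π[] ms′ (hᵂ I ∘ proj₂)
      rearrange : Σ[] I (λ i → Σ[] (upTo (β i)) (λ b → B I (i , b) * y (i , b) ^ t) * Π′) ≈ const (Eᴵ I) * (N I * Π[] ms (hᵂ I ∘ proj₂))
      rearrange = begin
        Σ[] I (λ i → Σ[] (upTo (β i)) (λ b → B I (i , b) * y (i , b) ^ t) * Π′) ≈⟨ Σ-* I _ _ ⟨
        Σ[] I (λ i → Σ[] (upTo (β i)) (λ b → B I (i , b) * y (i , b) ^ t)) * Π′ ≈⟨ *-congʳ (recursion uI t) ⟨
        const (Eᴵ I) * N I * hᵂ I t * Π′ ≈⟨ solve 4 (λ e n h p → e :* n :* h :* p := e :* (n :* (h :* p))) refl _ _ _ _ ⟩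
        const (Eᴵ I) * (N I * (hᵂ I t * Π′)) ≈⟨ *-congˡ (*-congˡ (Π-↭ _ p)) ⟨
        const (Eᴵ I) * (N I * Π[] ms (hᵂ I ∘ proj₂)) ∎
      term : ∀ {i} → i ∈ I → ∀ b → Supp (Dom I (suc (count ms′)) (t ℕ.+ total ms′)) (B I (i , b) * y (i , b) ^ t * Π′)
      term {i} i∈I b = Supp-⊆ (λ k → Dom-respʳ (↭-sym I↭)) (Supp-resp
        (*-congˡ (Π-cong ms′ (λ x → sym (h-↭ y (W-∖ uI i∈I) (proj₂ x)))))
        (term-support i (I ∖ i) (∉-∖ I i) (Unique-∖ i uI) (count ms′) ms′ ≡.refl
          (λ ms″ ceq′ → ≡.subst (λ n → Supp (Dom (I ∖ i) n (total ms″)) _) ceq′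
            (go l (I ∖ i) (ℕ.suc-injective (≡.trans (≡.sym (↭-length I↭)) eq)) (Unique-∖ i uI) ms″)) b t _))
        where
        I↭ : I ↭ i ∷ (I ∖ i)
        I↭ = ↭-∖ uI i∈I

  support : ∀ {I} → Unique I → ∀ ms → Supp (Dom I (count ms) (total ms)) (N I * Π[] ms (hᵂ I ∘ proj₂))
  support {I} = go (length I) I ≡.refl

-- The leading coefficient

module Ratio {c ℓ} (R : RawRing c ℓ) (q : RawRing.Carrier R) (β : ℕ) where
  open RawRing R
  open RawSemiringDefs rawSemiring using (_^_)
  open QPochhammer R using (qPoch)

  others : ℕ → List ℕ → ℕ
  others t μ = length (filter (λ x → ¬? (t ℕ.≟ x)) μ)

  -- The coefficient c_μ is num μ / den μ; its first factor telescopes from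
  -- Σ_{i : μᵢ = t} q^{β #{j > i}} = (q^{β r} - q^{β l(μ)}) / (1 - q^β),
  -- where t = μ₁ and r is the number of parts other than t.
  den num : List ℕ → Carrier
  den []      = 1#
  den (t ∷ μ) = (1# + - (q ^ β)) * qPoch q q (t ℕ.+ length μ ℕ.* β) * den μ
  num []      = 1#
  num (t ∷ μ) = ((q ^ β) ^ others t μ + - ((q ^ β) ^ suc (length μ))) * qPoch (q ^ β) q (t ℕ.+ length μ ℕ.* β) * num μ

module LeadingCoefficient {c ℓ} {R : CommutativeRing c ℓ} {s : ℕ} (LR : LaurentRing R s) (q : CommutativeRing.Carrier R) (gen : Generic R q)
  (β : Fin s → ℕ) (1≤β : ∀ i → 1 ℕ.≤ β i) (β₀ : ℕ) (β≡β₀ : ∀ i → β i ≡ β₀) where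
  private
    n̂ = β₀
    β≤n̂ : ∀ i → β i ℕ.≤ n̂
    β≤n̂ i = ℕ.≤-reflexive (β≡β₀ i)
    module R where
      open CommutativeRing R public
      open BigRing R public
      open Exp semiring public
      open ScalarWeights R q gen n̂ public
      open CompleteHomogeneous R public
      open QProducts R q public
      open CExp commutativeSemiring public using (^-distrib-*)
    module RS = IntegerSolver R
  open Laurent LR
  open Recursion LR q gen β 1≤β n̂ β≤n̂
  open DominanceSupport LR q gen β 1≤β n̂ β≤n̂
  open Supports LR
  open CompleteHomogeneous ring
  open QProducts ring (const q)
  open Removal (Fin._≟_ {s})
  open Ratio R.rawRing q β₀

  Q : R.Carrier
  Q = q R.^ β₀

  coef : List (Fin s) → Vec ℤ s → List ℕ → R.Carrier
  coef I k μ = coeff k (N I * Π[] μ (hᵂ I))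

  after : Fin s → List (Fin s) → ℕ
  after i I = length (filter (i Fin.<?_) I)

  after-< : ∀ {i j} I → i Fin.< j → after i (j ∷ I) ≡ suc (after i I)
  after-< {i} I i<j = ≡.cong length (List.filter-accept (i Fin.<?_) {xs = I} i<j)

  after-≮ : ∀ {i j} I → ¬ i Fin.< j → after i (j ∷ I) ≡ after i I
  after-≮ {i} I i≮j = ≡.cong length (List.filter-reject (i Fin.<?_) {xs = I} i≮j)

  -- The power of q^{β_j} to which p_{ijb}(0) is equal.
  exponent : Fin s → Fin s → ℕ → ℕ
  exponent i j b = if ⌊ i Fin.<? j ⌋ then suc b else b

  module _ {i : Fin s} where

    Cong-const : ∀ a → Cong i (const a) (const a)
    Cong-const a = Cong-refl (NonNeg-const a)

    Cong-u : ∀ {j} → i ≢ j → Cong i (z i * z⁻¹ j) 0#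
    Cong-u {j} i≢j = Cong-resp (sym (u≈mono i j)) refl (Cong-mono-0 _
      (≡.subst (0ℤ ℤ.<_) (≡.sym (≡.trans (lookup-⊕ i (1ℤ ·ε i) (-1ℤ ·ε j)) (≡.cong₂ ℤ._+_ (lookup-·ε 1ℤ i) (lookup-·ε-≢ -1ℤ i≢j))))
        (ℤ.+<+ (ℕ.s≤s ℕ.z≤n))))

    Cong-scaled : ∀ {c x} → Cong i c c → Cong i x 0# → Cong i (c * x) 0#
    Cong-scaled cc cx = Cong-resp refl (zeroʳ _) (Cong-* cc cx)

    Cong-cofactor : ∀ {j} → i ≢ j → ∀ b → Cong i (cofactor i j b) (const ((q R.^ β j) R.^ exponent i j b))
    Cong-cofactor {j} i≢j b = by-cases (i Fin.<? j)
      where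
      cu = Cong-u i≢j
      target : ∀ b n → (const q ^ β j) ^ b * 1# ^ n ≈ const ((q R.^ β j) R.^ b)
      target b n = trans (*-congˡ (1^ n)) (trans (*-identityʳ _) (trans (^-congˡ b (sym (const-^ q (β j)))) (sym (const-^ _ b))))
      by-cases : (d : Dec (i Fin.< j)) → Cong i
        (if ⌊ d ⌋ then cofactor< (z i * z⁻¹ j) (β j) b (β i ℕ.∸ suc b) else cofactor> (z i * z⁻¹ j) (β j) b (β i ℕ.∸ b))
        (const ((q R.^ β j) R.^ (if ⌊ d ⌋ then suc b else b)))
      by-cases (yes _) = Cong-resp refl (target (suc b) (β i ℕ.∸ suc b)) (Cong-*
        (Cong-pp q (suc b) (Cong-q^ q (β j)) cu)
        (Cong-pp q (β i ℕ.∸ suc b) Cong-1 (Cong-scaled (Cong-q^ q (suc b)) cu)))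
      by-cases (no _) = Cong-resp refl (target b (β i ℕ.∸ b)) (Cong-*
        (Cong-pp q b (Cong-q^ q (β j)) (Cong-scaled (Cong-const q) cu))
        (Cong-pp q (β i ℕ.∸ b) Cong-1 (Cong-scaled (Cong-q^ q b) (Cong-scaled (Cong-const q) cu))))

    free⇒NonNeg : ∀ {p} → Supp (λ k → lookup k i ≡ 0ℤ) p → NonNeg i p
    free⇒NonNeg = Supp-⊆ (λ k k≡0 → ℤ.≤-reflexive (≡.sym k≡0))

    -- Every node (i , b) is a multiple of z_i, so the whole block of i disappears modulo z_i.
    Cong-h : ∀ bs {Y} → (∀ m → NonNeg i (h Y y m)) → ∀ m → Cong i (h (List.map (i ,_) bs ++ Y) y m) (h Y y m)
    Cong-h []       nn m       = Cong-refl (nn m)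
    Cong-h (b ∷ bs) nn zero    = Cong-h bs nn zero
    Cong-h (b ∷ bs) nn (suc m) = Cong-resp refl (trans (+-congˡ (zeroˡ _)) (+-identityʳ _))
      (Cong-+ (Cong-h bs nn (suc m)) (Cong-* (Cong-mono-0 _ (≡.subst (0ℤ ℤ.<_) (≡.sym (lookup-·ε 1ℤ i)) (ℤ.+<+ (ℕ.s≤s ℕ.z≤n))))
        (Cong-h (b ∷ bs) nn m)))

  module Term {I : List (Fin s)} (uI : Unique I) {i : Fin s} (i∈I : i ∈ I) (k : Vec ℤ s) (t : ℕ) (μ : List ℕ) where
    private
      I′ = I ∖ i
      k′ = k ⊖ ((+ t) ·ε i)
      i∉I′ = ∉-∖ I i

      leading : ℕ → R.Carrier
      leading b = R.Π[] I′ (λ j → (q R.^ β j) R.^ exponent i j b)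

      -- A summand of the recursion without its factor `y (i , b) ^ t`, and its value at z_i = 0.
      -- The exponent t of that factor is the shift from k to `k′`.
      X X₀ : R.Carrier → ℕ → Carrier
      X  κ b = const κ * (Π[] I′ (λ j → cofactor i j b) * N I′) * Π[] μ (hᵂ I)
      X₀ κ b = const κ * (const (leading b) * N I′) * Π[] μ (hᵂ I′)

      Cong-X : ∀ κ b → Cong i (X κ b) (X₀ κ b)
      Cong-X κ b = Cong-* (Cong-* (Cong-const κ) (Cong-*
        (Cong-resp refl (sym (const-Π I′ _)) (Cong-Π I′ (λ {j} j∈I′ → Cong-cofactor {j = j} (λ { ≡.refl → i∉I′ j∈I′ }) b)))
        (Cong-refl (free⇒NonNeg (N-free i∉I′)))))
        (Cong-Π μ (λ {m} _ → Cong-resp (sym (h-↭ y (W-∖ uI i∈I) m)) refl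
          (Cong-h (upTo (β i)) (λ m → free⇒NonNeg (hᵂ-free i∉I′ m)) m)))

      lookup-k′ : lookup k′ i ≡ lookup k i ℤ.- + t
      lookup-k′ = ≡.trans (lookup-⊖ i k ((+ t) ·ε i)) (≡.cong (ℤ._-_ (lookup k i)) (lookup-·ε (+ t) i))

      κ : ℕ → R.Carrier
      κ b = R.α (β i) b R.* Eᴵ I′

    term : ℕ → R.Carrier
    term b = coeff k (B I (i , b) * y (i , b) ^ t * Π[] μ (hᵂ I))

    private
      term≈ : ∀ b → term b R.≈ (q R.^ b) R.^ t R.* coeff k′ (X (κ b) b)
      term≈ b = R.trans (coeff-cong (trans (solve 3 (λ b y p → b :* y :* p := y :* (b :* p)) refl _ _ _)
        (*-congʳ (mono-^ (q R.^ b) i t)))) (coeff-mono-* k _ ((+ t) ·ε i) _)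
        where open IntegerSolver ring

    -- The shifted exponent of z_i is negative, whereas X is polynomial in z_i.
    term-small : lookup k i ℤ.< + t → ∀ b → term b R.≈ R.0#
    term-small k<t b = R.trans (term≈ b) (R.trans (R.*-congˡ (nonNegˡ (Cong-X (κ b) b) k′
      (λ 0≤k′ → ℤ.<⇒≱ k<t (ℤ.0≤i-j⇒j≤i (≡.subst (0ℤ ℤ.≤_) lookup-k′ 0≤k′))))) (R.zeroʳ _))

    private
      term-equal : lookup k i ≡ + t → ∀ b → term b R.≈ (q R.^ b) R.^ t R.* (κ b R.* (leading b R.* coef I′ k′ μ))
      term-equal k≡t b = R.trans (term≈ b) (R.*-congˡ (R.trans
        (coeff-Cong (Cong-X (κ b) b) k′ (≡.trans lookup-k′ (≡.trans (≡.cong (ℤ._- + t) k≡t) (ℤ.+-inverseʳ (+ t)))))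
        (R.trans (coeff-cong (solve 4 (λ a b n p → a :* (b :* n) :* p := a :* (b :* (n :* p))) refl _ _ _ _))
          (R.trans (coeff-const-* k′ _ _) (R.*-congˡ (coeff-const-* k′ _ _))))))
        where open IntegerSolver ring

      -- Each j contributes q^{βb}, and those with i < j a further factor q^β, because p_{ijb} has
      -- one more factor for them.
      leading≈ : ∀ b → leading b R.≈ (q R.^ b) R.^ (length I′ ℕ.* β₀) R.* Q R.^ after i I′
      leading≈ b = go I′
        where
        open SetoidReasoning R.setoid
        flip^ : (q R.^ β₀) R.^ b R.≈ (q R.^ b) R.^ β₀
        flip^ = R.trans (R.^-assocʳ q β₀ b) (R.trans (R.reflexive (≡.cong (q R.^_) (ℕ.*-comm β₀ b))) (R.sym (R.^-assocʳ q b β₀)))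
        go : ∀ J → R.Π[] J (λ j → (q R.^ β j) R.^ exponent i j b) R.≈ (q R.^ b) R.^ (length J ℕ.* β₀) R.* Q R.^ after i J
        go []      = R.sym (R.*-identityˡ _)
        go (j ∷ J) rewrite β≡β₀ j with i Fin.<? j
        ... | yes i<j = begin
          (Q R.* Q R.^ b) R.* R.Π[] J (λ j → (q R.^ β j) R.^ exponent i j b)
            ≈⟨ R.*-cong (R.*-congˡ flip^) (go J) ⟩
          (Q R.* (q R.^ b) R.^ β₀) R.* ((q R.^ b) R.^ (length J ℕ.* β₀) R.* Q R.^ after i J)
            ≈⟨ RS.solve 4 (λ a b c d → (a RS.:* b) RS.:* (c RS.:* d) RS.:= (b RS.:* c) RS.:* (a RS.:* d)) R.refl _ _ _ _ ⟩
          ((q R.^ b) R.^ β₀ R.* (q R.^ b) R.^ (length J ℕ.* β₀)) R.* (Q R.* Q R.^ after i J)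
            ≈⟨ R.*-congʳ (R.^-homo-* (q R.^ b) β₀ (length J ℕ.* β₀)) ⟨
          (q R.^ b) R.^ (β₀ ℕ.+ length J ℕ.* β₀) R.* Q R.^ suc (after i J)
            ≡⟨ ≡.cong (λ a → (q R.^ b) R.^ (β₀ ℕ.+ length J ℕ.* β₀) R.* Q R.^ a) (after-< J i<j) ⟨
          (q R.^ b) R.^ (β₀ ℕ.+ length J ℕ.* β₀) R.* Q R.^ after i (j ∷ J) ∎
        ... | no  i≮j = begin
          Q R.^ b R.* R.Π[] J (λ j → (q R.^ β j) R.^ exponent i j b)
            ≈⟨ R.*-cong flip^ (go J) ⟩
          (q R.^ b) R.^ β₀ R.* ((q R.^ b) R.^ (length J ℕ.* β₀) R.* Q R.^ after i J)
            ≈⟨ R.*-assoc _ _ _ ⟨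
          (q R.^ b) R.^ β₀ R.* (q R.^ b) R.^ (length J ℕ.* β₀) R.* Q R.^ after i J
            ≈⟨ R.*-congʳ (R.^-homo-* (q R.^ b) β₀ (length J ℕ.* β₀)) ⟨
          (q R.^ b) R.^ (β₀ ℕ.+ length J ℕ.* β₀) R.* Q R.^ after i J
            ≡⟨ ≡.cong (λ a → (q R.^ b) R.^ (β₀ ℕ.+ length J ℕ.* β₀) R.* Q R.^ a) (after-≮ J i≮j) ⟨
          (q R.^ b) R.^ (β₀ ℕ.+ length J ℕ.* β₀) R.* Q R.^ after i (j ∷ J) ∎

    -- The factors `q ^ b` from `y ^ t` and from the values p_{ijb}(0) combine to the exponent n = t
    -- + (l - 1)β, where l is the length of I; `Σα` then carries out the sum over b.
    term-sum : lookup k i ≡ + t →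
      R.Σ[] (upTo (β i)) term R.≈
        Eᴵ I R.* (R.h (upTo β₀) (q R.^_) (t ℕ.+ length I′ ℕ.* β₀) R.* Q R.^ after i I′ R.* coef I′ k′ μ)
    term-sum k≡t = begin
      R.Σ[] (upTo (β i)) term
        ≈⟨ R.Σ-cong (upTo (β i)) (λ b → R.trans (term-equal k≡t b) (R.*-congˡ (R.*-congˡ (R.*-congʳ (leading≈ b))))) ⟩
      R.Σ[] (upTo (β i)) (λ b → (q R.^ b) R.^ t R.* (κ b R.* ((q R.^ b) R.^ m R.* Q R.^ after i I′ R.* c′)))
        ≈⟨ R.Σ-cong (upTo (β i)) (λ b → R.trans
             (RS.solve 6 (λ x a e x′ w c → x RS.:* ((a RS.:* e) RS.:* (x′ RS.:* w RS.:* c)) RS.:= (a RS.:* (x RS.:* x′)) RS.:* (e RS.:* w RS.:* c))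
               R.refl _ _ _ _ _ _)
             (R.*-congʳ (R.*-congˡ (R.sym (R.^-homo-* (q R.^ b) t m))))) ⟩
      R.Σ[] (upTo (β i)) (λ b → R.α (β i) b R.* (q R.^ b) R.^ (t ℕ.+ m) R.* (Eᴵ I′ R.* Q R.^ after i I′ R.* c′))
        ≈⟨ R.Σ-* (upTo (β i)) _ _ ⟨
      R.Σ[] (upTo (β i)) (λ b → R.α (β i) b R.* (q R.^ b) R.^ (t ℕ.+ m)) R.* (Eᴵ I′ R.* Q R.^ after i I′ R.* c′)
        ≈⟨ R.*-congʳ (R.Σα (β i) (t ℕ.+ m) (1≤β i) (β≤n̂ i)) ⟩
      R.E R.^ β i R.* R.h (upTo (β i)) (q R.^_) (t ℕ.+ m) R.* (Eᴵ I′ R.* Q R.^ after i I′ R.* c′)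
        ≈⟨ RS.solve 5 (λ e h e′ w c → e RS.:* h RS.:* (e′ RS.:* w RS.:* c) RS.:= (e RS.:* e′) RS.:* (h RS.:* w RS.:* c)) R.refl _ _ _ _ _ ⟩
      R.E R.^ β i R.* Eᴵ I′ R.* (R.h (upTo (β i)) (q R.^_) (t ℕ.+ m) R.* Q R.^ after i I′ R.* c′)
        ≈⟨ R.*-cong (R.sym (R.Π-↭ _ (↭-∖ uI i∈I)))
             (R.*-congʳ (R.*-congʳ (R.reflexive (≡.cong (λ b → R.h (upTo b) (q R.^_) (t ℕ.+ m)) (β≡β₀ i))))) ⟩
      Eᴵ I R.* (R.h (upTo β₀) (q R.^_) (t ℕ.+ m) R.* Q R.^ after i I′ R.* c′) ∎
      where
      open SetoidReasoning R.setoid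
      m  = length I′ ℕ.* β₀
      c′ = coef I′ k′ μ

  after-∖ : ∀ i I → after i (I ∖ i) ≡ after i I
  after-∖ i [] = ≡.refl
  after-∖ i (j ∷ I) = by-cases (j Fin.≟ i) (i Fin.<? j)
    where
    by-cases : Dec (j ≡ i) → Dec (i Fin.< j) → after i ((j ∷ I) ∖ i) ≡ after i (j ∷ I)
    by-cases (yes ≡.refl) _ = ≡.trans (≡.cong (after i) (List.filter-reject (λ x → ¬? (x Fin.≟ i)) (λ i≢i → i≢i ≡.refl)))
      (≡.trans (after-∖ i I) (≡.sym (after-≮ I (Fin.<-irrefl ≡.refl))))
    by-cases (no j≢i) (yes i<j) = ≡.trans (≡.cong (after i) (∖-there j≢i))
      (≡.trans (after-< (I ∖ i) i<j) (≡.trans (≡.cong suc (after-∖ i I)) (≡.sym (after-< I i<j))))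
    by-cases (no j≢i) (no i≮j) = ≡.trans (≡.cong (after i) (∖-there j≢i))
      (≡.trans (after-≮ (I ∖ i) i≮j) (≡.trans (after-∖ i I) (≡.sym (after-≮ I i≮j))))

  infix 8 [_≟_]_
  [_≟_]_ : ℤ → ℕ → R.Carrier → R.Carrier
  [ a ≟ t ] x = if ⌊ a ℤ.≟ + t ⌋ then x else R.0#

  Values : Vec ℤ s → List (Fin s) → List ℕ → Set
  Values k I μ = List.map (lookup k) I ≡ List.map +_ μ

  value-∈ : ∀ {k I μ i} → Values k I μ → i ∈ I → ∃ λ x → x ∈ μ × lookup k i ≡ + x
  value-∈ {k} {I} {μ} {i} vals i∈I = ∈-map⁻ +_ (≡.subst (lookup k i ∈_) vals (∈-map⁺ (lookup k) i∈I))

  -- As t is the largest value and the values decrease, they equal t exactly on an initial segment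
  -- of I. Deleting any position of the segment leaves the same list of values as deleting the head.
  Values-∖ : ∀ {k} I {t μ i} → Values k I (t ∷ μ) → AllPairs ℕ._≥_ (t ∷ μ) → Unique I → i ∈ I → lookup k i ≡ + t → Values k (I ∖ i) μ
  Values-∖ {k} (j ∷ I) {t} {μ} {i} vals dec uI i∈I k≡t with j Fin.≟ i
  Values-∖ {k} (j ∷ I) vals dec uI i∈I k≡t | yes ≡.refl rewrite ∖-∉ (Unique-∉ uI) = List.∷-injectiveʳ vals
  Values-∖ (j ∷ I) vals dec uI (here ≡.refl) k≡t | no j≢i = ⊥-elim (j≢i ≡.refl)
  Values-∖ {k} (j ∷ I) {t} {[]} {i} vals dec uI (there i∈I) k≡t | no j≢i with value-∈ {k} {I} {[]} (List.∷-injectiveʳ vals) i∈I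
  ... | ()
  Values-∖ {k} (j ∷ I) {t} {t′ ∷ μ} {i} vals ((t≥t′ ∷ _) ∷ dec@(t′≥ ∷ _)) (_ ∷ uI) (there i∈I) k≡t | no j≢i =
    ≡.cong₂ _∷_ (≡.trans (List.∷-injectiveˡ vals) (≡.cong +_ t≡t′))
      (Values-∖ {k} I (List.∷-injectiveʳ vals) dec uI i∈I (≡.trans k≡t (≡.cong +_ t≡t′)))
    where
    t≤t′ : t ℕ.≤ t′
    t≤t′ with value-∈ {k} {I} {t′ ∷ μ} (List.∷-injectiveʳ vals) i∈I
    ... | x , here ≡.refl , k≡x = ℕ.≤-reflexive (ℤ.+-injective (≡.trans (≡.sym k≡t) k≡x))
    ... | x , there x∈μ   , k≡x = ≡.subst (ℕ._≤ t′) (ℤ.+-injective (≡.trans (≡.sym k≡x) k≡t)) (All.lookup t′≥ x∈μ)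
    t≡t′ : t ≡ t′
    t≡t′ = ℕ.≤-antisym t≤t′ t≥t′

  -- The indices of value t form an initial segment of the increasing list I, so the exponents
  -- `after i I` run through all integers from `others t ν` to `length ν - 1`; multiplied by 1 - Q,
  -- the geometric sum telescopes. If the head is below t, both sides are 0.
  Σ-after : ∀ {k t} I ν → Values k I ν → AllPairs Fin._<_ I → AllPairs ℕ._≥_ ν → All (ℕ._≤ t) ν →
    (R.1# R.- Q) R.* R.Σ[] I (λ i → [ lookup k i ≟ t ] (Q R.^ after i I)) R.≈ Q R.^ others t ν R.- Q R.^ length ν
  Σ-after [] [] vals sorted dec bounds = R.trans (R.zeroʳ _) (R.sym (R.-‿inverseʳ _))
  Σ-after {k} {t} I₁@(j ∷ I) ν₁@(x ∷ ν) vals (j<I ∷ sorted) (x≥ν ∷ dec) (x≤t ∷ bounds) with t ℕ.≟ x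
  ... | no  t≢x = begin
    (R.1# R.- Q) R.* R.Σ[] I₁ (λ i → [ lookup k i ≟ t ] (Q R.^ after i I₁))
      ≈⟨ R.*-congˡ (R.trans (R.Σ-cong-∈ I₁ vanish) (R.Σ-0 I₁)) ⟩
    (R.1# R.- Q) R.* R.0#                   ≈⟨ R.zeroʳ _ ⟩
    R.0#                                    ≈⟨ R.-‿inverseʳ _ ⟨
    Q R.^ length ν₁ R.- Q R.^ length ν₁     ≡⟨ ≡.cong (λ n → Q R.^ n R.- Q R.^ length ν₁) (≡.cong length (List.filter-all (λ x → ¬? (t ℕ.≟ x)) (t≢x ∷ All.map below x≥ν))) ⟨
    Q R.^ others t ν₁ R.- Q R.^ length ν₁   ∎
    where
    open SetoidReasoning R.setoid
    below : ∀ {x′} → x ℕ.≥ x′ → t ≢ x′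
    below x≥x′ ≡.refl = t≢x (ℕ.≤-antisym x≥x′ x≤t)
    vanish : ∀ {i} → i ∈ I₁ → [ lookup k i ≟ t ] (Q R.^ after i I₁) R.≈ R.0#
    vanish {i} i∈ with lookup k i ℤ.≟ + t
    ... | no  _   = R.refl
    ... | yes k≡t with value-∈ {k} {I₁} {ν₁} vals i∈
    ...   | x′ , here ≡.refl , k≡x = ⊥-elim (t≢x (ℤ.+-injective (≡.trans (≡.sym k≡t) k≡x)))
    ...   | x′ , there x′∈ν  , k≡x = ⊥-elim (below (All.lookup x≥ν x′∈ν) (ℤ.+-injective (≡.trans (≡.sym k≡t) k≡x)))
  ... | yes ≡.refl = begin
    (R.1# R.- Q) R.* ([ lookup k j ≟ t ] (Q R.^ after j I₁) R.+ R.Σ[] I (λ i → [ lookup k i ≟ t ] (Q R.^ after i I₁)))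
      ≈⟨ R.*-congˡ (R.+-cong first (R.Σ-cong-∈ I (λ {i} i∈I → R.reflexive (≡.cong (λ n → [ lookup k i ≟ t ] (Q R.^ n)) (after-tail i∈I))))) ⟩
    (R.1# R.- Q) R.* (Q R.^ length ν R.+ R.Σ[] I (λ i → [ lookup k i ≟ t ] (Q R.^ after i I)))
      ≈⟨ R.trans (R.distribˡ _ _ _) (R.+-congˡ (Σ-after {k} I ν (List.∷-injectiveʳ vals) sorted dec bounds)) ⟩
    (R.1# R.- Q) R.* Q R.^ length ν R.+ (Q R.^ others t ν R.- Q R.^ length ν)
      ≈⟨ RS.solve 3 (λ q l r → (RS.con 1ℤ RS.:- q) RS.:* l RS.:+ (r RS.:- l) RS.:= r RS.:- q RS.:* l) R.refl _ _ _ ⟩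
    Q R.^ others t ν R.- Q R.^ suc (length ν)
      ≡⟨ ≡.cong (λ n → Q R.^ n R.- Q R.^ suc (length ν)) (≡.cong length (List.filter-reject (λ x → ¬? (t ℕ.≟ x)) {xs = ν} (λ t≢t → t≢t ≡.refl))) ⟨
    Q R.^ others t ν₁ R.- Q R.^ suc (length ν) ∎
    where
    open SetoidReasoning R.setoid
    first : [ lookup k j ≟ t ] (Q R.^ after j I₁) R.≈ Q R.^ length ν
    first with lookup k j ℤ.≟ + t
    ... | no  k≢t = ⊥-elim (k≢t (List.∷-injectiveˡ vals))
    ... | yes _   = R.reflexive (≡.cong (Q R.^_) (≡.trans
      (≡.cong length (≡.trans (List.filter-reject (j Fin.<?_) (Fin.<-irrefl ≡.refl)) (List.filter-all (j Fin.<?_) j<I)))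
      (≡.trans (≡.sym (List.length-map (lookup k) I)) (≡.trans (≡.cong length (List.∷-injectiveʳ vals)) (List.length-map +_ ν)))))
    after-tail : ∀ {i} → i ∈ I → after i I₁ ≡ after i I
    after-tail {i} i∈I = ≡.cong length (List.filter-reject (i Fin.<?_) (Fin.<-asym (All.lookup j<I i∈I)))

  -- Only indices of value t survive in the recursion, the others being below t. The order on I is
  -- kept for `Σ-after`, and k is required to vanish off I so that the constant term is what remains
  -- when all variables have been removed.
  leadingCoefficient : ∀ μ I k → AllPairs Fin._<_ I → Values k I μ → (∀ {l} → l ∉ I → lookup k l ≡ 0ℤ) →
    AllPairs ℕ._≥_ μ → den μ R.* coef I k μ R.≈ num μ
  leadingCoefficient [] [] k sorted vals off dec = R.trans (R.*-identityˡ _) (R.trans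
    (coeff-cong (*-identityˡ _)) (R.trans (R.reflexive (≡.cong (λ k → coeff k 1#)
      (lookup-ext (λ l → ≡.trans (off (λ ())) (≡.sym (Vec.lookup-replicate l 0ℤ)))))) coeff-1))
  leadingCoefficient (t ∷ μ) I@(i₀ ∷ I₀) k sorted vals off dec@(t≥μ ∷ decμ) = begin
    (R.1# R.- Q) R.* qₙ R.* den μ R.* coef I k (t ∷ μ)
      ≈⟨ R.*-congˡ coef≈ ⟩
    (R.1# R.- Q) R.* qₙ R.* den μ R.* R.Σ[] I contribution
      ≈⟨ RS.solve 4 (λ a b c d → a RS.:* b RS.:* c RS.:* d RS.:= a RS.:* b RS.:* (c RS.:* d)) R.refl _ _ _ _ ⟩
    (R.1# R.- Q) R.* qₙ R.* (den μ R.* R.Σ[] I contribution)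
      ≈⟨ R.*-congˡ (R.trans (R.*-Σ I _ _) (R.trans (R.Σ-cong-∈ I reduce) (R.sym (R.Σ-* I _ _)))) ⟩
    (R.1# R.- Q) R.* qₙ R.* (R.Σ[] I (λ i → [ lookup k i ≟ t ] (Q R.^ after i I)) R.* (hₙ R.* num μ))
      ≈⟨ RS.solve 5 (λ a b s h n → a RS.:* b RS.:* (s RS.:* (h RS.:* n)) RS.:= (a RS.:* s) RS.:* (b RS.:* h) RS.:* n) R.refl _ _ _ _ _ ⟩
    ((R.1# R.- Q) R.* R.Σ[] I (λ i → [ lookup k i ≟ t ] (Q R.^ after i I))) R.* (qₙ R.* hₙ) R.* num μ
      ≈⟨ R.*-congʳ (R.*-cong (Σ-after {k} I (t ∷ μ) vals sorted dec (ℕ.≤-refl ∷ t≥μ))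
           (R.trans (R.*-congʳ (R.reflexive (R.qPoch≡pp q n))) (R.trans (R.q-binomial β₀ n) (R.reflexive (≡.sym (R.qPoch≡pp Q n)))))) ⟩
    (Q R.^ others t (t ∷ μ) R.- Q R.^ suc (length μ)) R.* QPochhammer.qPoch R.rawRing Q q n R.* num μ
      ≡⟨ ≡.cong (λ r → (Q R.^ r R.- Q R.^ suc (length μ)) R.* QPochhammer.qPoch R.rawRing Q q n R.* num μ)
           (≡.cong length (List.filter-reject (λ x → ¬? (t ℕ.≟ x)) {xs = μ} (λ t≢t → t≢t ≡.refl))) ⟩
    num (t ∷ μ) ∎
    where
    open SetoidReasoning R.setoid
    n  = t ℕ.+ length μ ℕ.* β₀
    qₙ = QPochhammer.qPoch R.rawRing q q n
    hₙ = R.h (upTo β₀) (q R.^_) n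
    uI : Unique I
    uI = AllPairs.map (λ { i<j ≡.refl → Fin.<-irrefl ≡.refl i<j }) sorted
    contribution : Fin s → R.Carrier
    contribution i = [ lookup k i ≟ t ] (hₙ R.* Q R.^ after i I R.* coef (I ∖ i) (k ⊖ ((+ t) ·ε i)) μ)

    length-∖ : ∀ {i} → i ∈ I → length (I ∖ i) ≡ length μ
    length-∖ i∈I = ℕ.suc-injective (≡.trans (≡.sym (↭-length (↭-∖ uI i∈I)))
      (≡.trans (≡.sym (List.length-map (lookup k) I)) (≡.trans (≡.cong length vals) (List.length-map +_ (t ∷ μ)))))

    terms : ∀ {i} (i∈I : i ∈ I) → R.Σ[] (upTo (β i)) (Term.term uI i∈I k t μ) R.≈ Eᴵ I R.* contribution i
    terms {i} i∈I with lookup k i ℤ.≟ + t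
    ... | yes k≡t = R.trans (Term.term-sum uI i∈I k t μ k≡t) (R.*-congˡ (R.*-congʳ (R.reflexive
      (≡.cong₂ (λ l a → R.h (upTo β₀) (q R.^_) (t ℕ.+ l ℕ.* β₀) R.* Q R.^ a) (length-∖ i∈I) (after-∖ i I)))))
    ... | no  k≢t = R.trans (R.trans (R.Σ-cong (upTo (β i)) (Term.term-small uI i∈I k t μ k<t)) (R.Σ-0 (upTo (β i)))) (R.sym (R.zeroʳ _))
      where
      k≤t : lookup k i ℤ.≤ + t
      k≤t with value-∈ {k} {I} {t ∷ μ} vals i∈I
      ... | x , here ≡.refl , k≡x = ℤ.≤-reflexive k≡x
      ... | x , there x∈μ   , k≡x = ≡.subst (ℤ._≤ + t) (≡.sym k≡x) (ℤ.+≤+ (All.lookup t≥μ x∈μ))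
      k<t = ℤ.≤∧≢⇒< k≤t k≢t

    coef≈ : coef I k (t ∷ μ) R.≈ R.Σ[] I contribution
    coef≈ = R.Regular-cancel (Regular-Eᴵ I) (begin
      Eᴵ I R.* coef I k (t ∷ μ)                                ≈⟨ coeff-const-* k (Eᴵ I) _ ⟨
      coeff k (const (Eᴵ I) * (N I * (hᵂ I t * Π[] μ (hᵂ I))))
        ≈⟨ coeff-cong (trans (L.solve 4 (λ e n h p → e L.:* (n L.:* (h L.:* p)) L.:= e L.:* n L.:* h L.:* p) refl _ _ _ _)
             (trans (*-congʳ (recursion uI t)) (trans (Σ-* I _ _) (Σ-cong I (λ i → Σ-* (upTo (β i)) _ _))))) ⟩
      coeff k (Σ[] I (λ i → Σ[] (upTo (β i)) (λ b → B I (i , b) * y (i , b) ^ t * Π[] μ (hᵂ I))))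
        ≈⟨ R.trans (coeff-Σ k I _) (R.Σ-cong I (λ i → coeff-Σ k (upTo (β i)) _)) ⟩
      R.Σ[] I (λ i → R.Σ[] (upTo (β i)) (λ b → coeff k (B I (i , b) * y (i , b) ^ t * Π[] μ (hᵂ I))))
        ≈⟨ R.Σ-cong-∈ I terms ⟩
      R.Σ[] I (λ i → Eᴵ I R.* contribution i)                  ≈⟨ R.*-Σ I _ _ ⟨
      Eᴵ I R.* R.Σ[] I contribution                            ∎)
      where module L = IntegerSolver ring

    reduce : ∀ {i} → i ∈ I → den μ R.* contribution i R.≈ [ lookup k i ≟ t ] (Q R.^ after i I) R.* (hₙ R.* num μ)
    reduce {i} i∈I with lookup k i ℤ.≟ + t
    ... | no  _   = R.trans (R.zeroʳ _) (R.sym (R.zeroˡ _))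
    ... | yes k≡t = R.trans
      (RS.solve 4 (λ d h w c → d RS.:* (h RS.:* w RS.:* c) RS.:= w RS.:* (h RS.:* (d RS.:* c))) R.refl _ _ _ _)
      (R.*-congˡ (R.*-congˡ (leadingCoefficient μ (I ∖ i) k′
        (AllPairs.filter⁺ (λ x → ¬? (x Fin.≟ i)) sorted) vals′ off′ decμ)))
      where
      k′ = k ⊖ ((+ t) ·ε i)
      k′-≢ : ∀ {l} → l ≢ i → lookup k′ l ≡ lookup k l
      k′-≢ {l} l≢i = ≡.trans (lookup-⊖ l k ((+ t) ·ε i)) (≡.trans (≡.cong (ℤ._-_ (lookup k l)) (lookup-·ε-≢ (+ t) l≢i)) (ℤ.+-identityʳ _))
      vals′ : Values k′ (I ∖ i) μ
      vals′ = ≡.trans (List.map-cong-local (All.tabulate (λ {l} l∈ → k′-≢ (λ { ≡.refl → ∉-∖ I l l∈ }))))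
        (Values-∖ {k} I vals dec uI i∈I k≡t)
      off′ : ∀ {l} → l ∉ I ∖ i → lookup k′ l ≡ 0ℤ
      off′ {l} l∉ with l Fin.≟ i
      ... | yes ≡.refl = ≡.trans (lookup-⊖ l k ((+ t) ·ε l)) (≡.trans (≡.cong₂ ℤ._-_ k≡t (lookup-·ε (+ t) l)) (ℤ.+-inverseʳ (+ t)))
      ... | no  l≢i    = ≡.trans (k′-≢ l≢i) (off (λ l∈I → l∉ (∈-filter⁺ (λ x → ¬? (x Fin.≟ i)) l∈I l≢i)))

-- The coefficients of F as products of complete homogeneous polynomials

⊕-isCommutativeMonoid : ∀ s → IsCommutativeMonoid _≡_ (_⊕_ {s}) 0⃗
⊕-isCommutativeMonoid s = record
  { isMonoid = record
    { isSemigroup = record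
      { isMagma = record { isEquivalence = ≡.isEquivalence ; ∙-cong = ≡.cong₂ _⊕_ }
      ; assoc   = Vec.zipWith-assoc ℤ.+-assoc
      }
    ; identity = Vec.zipWith-identityˡ ℤ.+-identityˡ , Vec.zipWith-identityʳ ℤ.+-identityʳ
    }
  ; comm = Vec.zipWith-comm ℤ.+-comm
  }

module LaurentPolynomials {c ℓ} (R : CommutativeRing c ℓ) (s : ℕ) where
  open CommutativeRing R hiding (zero)
  open MonoidRing R (Vec.≡-dec ℤ._≟_) _⊕_ (0⃗ {s}) (⊕-isCommutativeMonoid s) public
  open FormalSeries rawRing using (coeffᴸ)

  private
    ⊕-comm : ∀ (k l : Vec ℤ s) → k ⊕ l ≡ l ⊕ k
    ⊕-comm = Vec.zipWith-comm ℤ.+-comm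

    to : ∀ {k d : Vec ℤ s} e → d ⊕ e ≡ k → e ≡ k ⊖ d
    to {k} {d} e eq = ≡.trans (≡.sym (⊕-⊖ e d)) (≡.cong (_⊖ d) (≡.trans (⊕-comm e d) eq))

    from : ∀ (k d : Vec ℤ s) → d ⊕ (k ⊖ d) ≡ k
    from k d = ≡.trans (⊕-comm d (k ⊖ d)) (⊖-⊕ k d)

    bounded : ∀ p i → ∃ λ N → ∀ k → N ℤ.< lookup k i → coeff k p ≈ 0#
    bounded []            i = 0ℤ , λ _ _ → refl
    bounded ((a , e) ∷ p) i with N , small ← bounded p i = lookup e i ℤ.⊔ N , λ k N<k →
      trans (+-cong (trans (*-congˡ (δ-≢ {k} {e} (λ { ≡.refl → ℤ.<-irrefl ≡.refl (ℤ.≤-<-trans (ℤ.i≤i⊔j (lookup e i) N) N<k) }))) (zeroʳ a))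
                    (small k (ℤ.≤-<-trans (ℤ.i≤j⊔i (lookup e i) N) N<k))) (+-identityˡ 0#)

  laurentRing : LaurentRing R s
  laurentRing = record
    { ring         = ring⟨⟩
    ; mono         = mono
    ; coeff        = coeff
    ; mono-cong    = λ a≈b → mono-cong a≈b ≡.refl
    ; mono-1       = mk (λ _ → refl)
    ; mono-0       = mono-0
    ; mono-+       = mono-+
    ; mono-*       = λ a b e f → mk (λ _ → refl)
    ; coeff-cong   = λ {k} p≋r → at p≋r k
    ; coeff-ext    = mk
    ; coeff-0      = λ _ → refl
    ; coeff-+      = coeff-++
    ; coeff-1      = trans (+-identityʳ _) (trans (*-identityˡ _) (δ-≡ 0⃗))
    ; coeff-1-≢    = λ k≢0 → trans (+-identityʳ _) (trans (*-identityˡ _) (δ-≢ (k≢0 ∘ ≡.sym)))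
    ; coeff-mono-* = λ k a d → coeff-mono-⊛ {k} {k ⊖ d} {d} to (from k d) a
    ; coeff-*-0    = λ k p r zeros → trans (⟨⟩-⊛ (δ k) p r) (⟨⟩-vanish _ p (λ e →
        product-0 (zeros e) (⟨⟩-cong (δ-shift {k} {k ⊖ e} {e} to (from k e)) r)))
    ; bounded      = bounded
    }
    where
    product-0 : ∀ {a b b′} → a ≈ 0# ⊎ b′ ≈ 0# → b ≈ b′ → a * b ≈ 0#
    product-0 (inj₁ a≈0) b≈b′ = trans (*-congʳ a≈0) (zeroˡ _)
    product-0 (inj₂ b≈0) b≈b′ = trans (*-congˡ (trans b≈b′ b≈0)) (zeroʳ _)

  coeffᴸ≈coeff : ∀ k p → coeffᴸ k p ≈ coeff k p
  coeffᴸ≈coeff k []            = refl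
  coeffᴸ≈coeff k ((a , e) ∷ p) with Vec.≡-dec ℤ._≟_ e k
  ... | yes _ = +-cong (sym (*-identityʳ a)) (coeffᴸ≈coeff k p)
  ... | no  _ = trans (coeffᴸ≈coeff k p) (sym (trans (+-congʳ (zeroʳ a)) (+-identityˡ _)))

-- Lists of nodes attached to the variables w

module _ {a} {A : Set a} where

  cat : ∀ {n} → Vector (List A) n → List A
  cat = Vector.foldr _++_ []

  cat-[] : ∀ n → cat {n} (λ _ → []) ≡ []
  cat-[] zero    = ≡.refl
  cat-[] (suc n) = cat-[] n

  select : ∀ {t} → Fin t → List A → Vector (List A) t
  select Fin.zero    xs Fin.zero    = xs
  select Fin.zero    xs (Fin.suc l) = []
  select (Fin.suc j) xs Fin.zero    = []
  select (Fin.suc j) xs (Fin.suc l) = select j xs l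

  cat-select : ∀ {t} xs (l : Fin t) → cat (λ j → select j xs l) ≡ xs
  cat-select {suc t} xs Fin.zero    = ≡.trans (≡.cong (xs ++_) (cat-[] t)) (List.++-identityʳ xs)
  cat-select {suc t} xs (Fin.suc l) = cat-select xs l

  select-cat : ∀ {t n} (j l : Fin t) (xs : Vector (List A) n) → cat (λ b → select j (xs b) l) ≡ select j (cat xs) l
  select-cat         Fin.zero    Fin.zero    xs = ≡.refl
  select-cat {n = n} Fin.zero    (Fin.suc l) xs = cat-[] n
  select-cat {n = n} (Fin.suc j) Fin.zero    xs = cat-[] n
  select-cat         (Fin.suc j) (Fin.suc l) xs = select-cat j l xs

  cat-singletons : ∀ n (f : ℕ → A) → cat {n} (λ b → f (Fin.toℕ b) ∷ []) ≡ List.map f (upTo n)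
  cat-singletons zero    f = ≡.refl
  cat-singletons (suc n) f = ≡.cong (f 0 ∷_) (≡.trans (cat-singletons n (f ∘ suc))
    (≡.trans (List.map-upTo (f ∘ suc) n) (≡.sym (List.map-applyUpTo suc f n))))

  cat-concatMap : ∀ {b} {B : Set b} n (g : Fin n → B) (f : B → List A) → cat (f ∘ g) ≡ concatMap f (List.tabulate g)
  cat-concatMap zero    g f = ≡.refl
  cat-concatMap (suc n) g f = ≡.cong (f (g Fin.zero) ++_) (cat-concatMap n (g ∘ Fin.suc) f)

module SeriesProducts {c ℓ} (A : CommutativeRing c ℓ) {c′ ℓ′} (R : RawRing c′ ℓ′) {x} {X : Set x}
                      (y : X → CommutativeRing.Carrier A) where
  open CommutativeRing A hiding (zero)
  open BigRing A
  open CompleteHomogeneous A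
  open Exp semiring using (_^_)
  open FormalSeries R using (splits)
  open SetoidReasoning setoid

  hˢ : ∀ {t} → Vector (List X) t → Vec ℕ t → Carrier
  hˢ Y Vec.[]       = 1#
  hˢ Y (m Vec.∷ ms) = h (Y Fin.zero) y m * hˢ (Y ∘ Fin.suc) ms

  hˢ-cong : ∀ {t} {Y Y′ : Vector (List X) t} → (∀ l → Y l ≡ Y′ l) → ∀ m → hˢ Y m ≡ hˢ Y′ m
  hˢ-cong eq Vec.[]       = ≡.refl
  hˢ-cong eq (m Vec.∷ ms) = ≡.cong₂ (λ Y r → h Y y m * r) (eq Fin.zero) (hˢ-cong (eq ∘ Fin.suc) ms)

  hˢ-uniform : ∀ {t} Y (m : Vec ℕ t) → hˢ (λ _ → Y) m ≡ Π[] (Vec.toList m) (h Y y)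
  hˢ-uniform Y Vec.[]       = ≡.refl
  hˢ-uniform Y (m Vec.∷ ms) = ≡.cong (h Y y m *_) (hˢ-uniform Y ms)

  private
    Σ-cartesian : ∀ {a b d} {B : Set a} {C : Set b} {D : Set d} (f : B → C → D) xs ys (g : D → Carrier) →
      Σ[] (cartesianProductWith f xs ys) g ≈ Σ[] xs (λ x → Σ[] ys (λ y → g (f x y)))
    Σ-cartesian f []       ys g = refl
    Σ-cartesian f (x ∷ xs) ys g = trans (Σ-++ (List.map (f x) ys) _ g) (+-cong (Σ-map ys (f x) g) (Σ-cartesian f xs ys g))

  hˢ-++ : ∀ {t} (Y Y′ : Vector (List X) t) m →
          Σ[] (splits m) (λ ab → hˢ Y (proj₁ ab) * hˢ Y′ (proj₂ ab)) ≈ hˢ (λ l → Y l ++ Y′ l) m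
  hˢ-++ Y Y′ Vec.[]       = trans (+-identityʳ _) (*-identityˡ _)
  hˢ-++ Y Y′ (m Vec.∷ ms) = begin
    Σ[] (splits (m Vec.∷ ms)) (λ ab → hˢ Y (proj₁ ab) * hˢ Y′ (proj₂ ab))
      ≈⟨ Σ-cartesian _ (upTo (suc m)) (splits ms) _ ⟩
    Σ[] (upTo (suc m)) (λ i → Σ[] (splits ms) (λ ab →
      (h (Y Fin.zero) y i * hˢ (Y ∘ Fin.suc) (proj₁ ab)) * (h (Y′ Fin.zero) y (m ℕ.∸ i) * hˢ (Y′ ∘ Fin.suc) (proj₂ ab))))
      ≈⟨ Σ-cong (upTo (suc m)) (λ i → Σ-cong (splits ms) (λ ab → *-exchange _ _ _ _)) ⟩
    Σ[] (upTo (suc m)) (λ i → Σ[] (splits ms) (λ ab →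
      (h (Y Fin.zero) y i * h (Y′ Fin.zero) y (m ℕ.∸ i)) * (hˢ (Y ∘ Fin.suc) (proj₁ ab) * hˢ (Y′ ∘ Fin.suc) (proj₂ ab))))
      ≈⟨ Σ*Σ (upTo (suc m)) (splits ms) _ _ ⟨
    Σ[] (upTo (suc m)) (λ i → h (Y Fin.zero) y i * h (Y′ Fin.zero) y (m ℕ.∸ i))
      * Σ[] (splits ms) (λ ab → hˢ (Y ∘ Fin.suc) (proj₁ ab) * hˢ (Y′ ∘ Fin.suc) (proj₂ ab))
      ≈⟨ *-cong (sym (h-++ (Y Fin.zero) (Y′ Fin.zero) y m)) (hˢ-++ (Y ∘ Fin.suc) (Y′ ∘ Fin.suc) ms) ⟩
    hˢ (λ l → Y l ++ Y′ l) (m Vec.∷ ms) ∎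

  hˢ-[]-0 : ∀ t → hˢ {t} (λ _ → []) (replicate t 0) ≈ 1#
  hˢ-[]-0 zero    = refl
  hˢ-[]-0 (suc t) = trans (*-identityˡ _) (hˢ-[]-0 t)

  hˢ-[]-≢ : ∀ {t} (m : Vec ℕ t) → m ≢ replicate t 0 → hˢ (λ _ → []) m ≈ 0#
  hˢ-[]-≢ Vec.[]           m≢0 = ⊥-elim (m≢0 ≡.refl)
  hˢ-[]-≢ (zero Vec.∷ ms)  m≢0 = trans (*-congˡ (hˢ-[]-≢ ms (m≢0 ∘ ≡.cong (0 Vec.∷_)))) (zeroʳ _)
  hˢ-[]-≢ (suc _ Vec.∷ ms) m≢0 = zeroˡ _

  hˢ-select : ∀ {t} (j : Fin t) x r → hˢ (select j (x ∷ [])) (replicate t 0 [ j ]≔ r) ≈ y x ^ r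
  hˢ-select {suc t} Fin.zero    x r = trans (*-cong (h-singleton x y r) (hˢ-[]-0 t)) (*-identityʳ _)
  hˢ-select {suc t} (Fin.suc j) x r = trans (*-identityˡ _) (hˢ-select j x r)

  hˢ-select-≢ : ∀ {t} (j : Fin t) x m → m ≢ replicate t 0 [ j ]≔ lookup m j → hˢ (select j (x ∷ [])) m ≈ 0#
  hˢ-select-≢ Fin.zero    x (m Vec.∷ ms)     m≢ = trans (*-congˡ (hˢ-[]-≢ ms (m≢ ∘ ≡.cong (m Vec.∷_)))) (zeroʳ _)
  hˢ-select-≢ (Fin.suc j) x (zero Vec.∷ ms)  m≢ = trans (*-congˡ (hˢ-select-≢ j x ms (m≢ ∘ ≡.cong (0 Vec.∷_)))) (zeroʳ _)
  hˢ-select-≢ (Fin.suc j) x (suc _ Vec.∷ ms) m≢ = zeroˡ _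

module Reduction {c ℓ} (R : CommutativeRing c ℓ) (q : CommutativeRing.Carrier R) (s : ℕ) (β : Vec ℕ s) where
  private module R = Exp (CommutativeRing.semiring R)
  open FormalSeries (CommutativeRing.rawRing R) hiding (coeff; z; z⁻¹)
  open QDyson (CommutativeRing.rawRing R) q
  open LaurentPolynomials R s using (laurentRing; coeffᴸ≈coeff)
  open Laurent laurentRing hiding (mono)
  open Factors laurentRing q (lookup β)
  open CompleteHomogeneous ring
  open SeriesProducts ring (CommutativeRing.rawRing R) y
  private
    module D where
      open RawRing (laurent s) public
      open RawSemiringDefs rawSemiring public using (_^_; product)
      open QPochhammer (laurent s) public using (qPoch)
    module N′ = QPochhammer rawRing

    ^-agree : ∀ x n → x D.^ n ≡ x ^ n
    ^-agree x zero    = ≡.refl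
    ^-agree x (suc n) = ≡.cong (x *_) (^-agree x n)

    qPoch-agree : ∀ x p n → D.qPoch x p n ≡ N′.qPoch x p n
    qPoch-agree x p zero    = ≡.refl
    qPoch-agree x p (suc n) = ≡.cong₂ (λ a b → a * (1# - b * x)) (qPoch-agree x p n) (^-agree p n)

    product-agree : ∀ {a} {A : Set a} n (g : Fin n → A) {f : Vector Carrier n} {F : A → Carrier} →
      (∀ i → f i ≈ F (g i)) → D.product f ≈ Π[] (List.tabulate g) F
    product-agree zero    g eq = refl
    product-agree (suc n) g {f} {F} eq = *-cong {f Fin.zero} {F (g Fin.zero)} (eq Fin.zero) (product-agree n (g ∘ Fin.suc) (eq ∘ Fin.suc))

  numerator≈N : numerator β ≈ N (allFin s)
  numerator≈N = product-agree s (λ i → i) (λ i → product-agree s (λ j → j) (λ j → reflexive (pair-agree i j)))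
    where
    pair-agree : ∀ i j → (if ⌊ i Fin.<? j ⌋
        then D.qPoch (z i * z⁻¹ j) (const q) (lookup β i) * D.qPoch (const q * (z j * z⁻¹ i)) (const q) (lookup β j)
        else 1#) ≡ pair₁ i j
    pair-agree i j = ≡.cong₂ (λ a b → if ⌊ i Fin.<? j ⌋ then a * b else 1#)
      (qPoch-agree (z i * z⁻¹ j) (const q) (lookup β i)) (qPoch-agree (const q * (z j * z⁻¹ i)) (const q) (lookup β j))

  private
    variable
      t : ℕ

    infix 4 _≈ˢ_
    _≈ˢ_ : Series s t → Vector (List Index) t → Set _
    f ≈ˢ Y = ∀ m → f m ≈ hˢ Y m

    -- Addition of Laurent polynomials is concatenation, so both sides are the same list.
    concatMap≡Σ : ∀ {a} {A : Set a} (f : A → Carrier) xs → concatMap f xs ≡ Σ[] xs f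
    concatMap≡Σ f []       = ≡.refl
    concatMap≡Σ f (x ∷ xs) = ≡.cong (f x ++_) (concatMap≡Σ f xs)

    const-≈ˢ : ∀ p (m : Vec ℕ t) → constˢ p m ≈ p * hˢ (λ _ → []) m
    const-≈ˢ {t} p m with Vec.≡-dec ℕ._≟_ m (replicate t 0)
    ... | yes ≡.refl = sym (trans (*-congˡ {p} (hˢ-[]-0 t)) (*-identityʳ p))
    ... | no  m≢0    = sym (trans (*-congˡ {p} (hˢ-[]-≢ m m≢0)) (zeroʳ p))

    *ˢ-≈ˢ : ∀ {f g : Series s t} {Y Y′} → f ≈ˢ Y → g ≈ˢ Y′ → f *ˢ g ≈ˢ (λ l → Y l ++ Y′ l)
    *ˢ-≈ˢ {f = f} {g} {Y} {Y′} f≈ g≈ m = trans (reflexive (concatMap≡Σ _ (splits m)))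
      (trans (Σ-cong (splits m) (λ ab → *-cong {f (proj₁ ab)} {hˢ Y (proj₁ ab)} (f≈ (proj₁ ab)) (g≈ (proj₂ ab)))) (hˢ-++ Y Y′ m))

    Πˢ-≈ˢ : ∀ n {f : Vector (Series s t) n} (Y : Fin n → Vector (List Index) t) → (∀ v → f v ≈ˢ Y v) → Πˢ f ≈ˢ (λ l → cat (λ v → Y v l))
    Πˢ-≈ˢ zero    Y eq m = trans (const-≈ˢ 1# m) (*-identityˡ (hˢ (λ _ → []) m))
    Πˢ-≈ˢ (suc n) Y eq   = *ˢ-≈ˢ {Y = Y Fin.zero} (eq Fin.zero) (Πˢ-≈ˢ n (Y ∘ Fin.suc) (eq ∘ Fin.suc))

    geometric-≈ˢ : ∀ b i (j : Fin t) → geometric (q R.^ b) i j ≈ˢ select j ((i , b) ∷ [])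
    geometric-≈ˢ {t} b i j m with Vec.≡-dec ℕ._≟_ m (replicate t 0 [ j ]≔ lookup m j)
    ... | yes eq = sym (trans (reflexive (≡.cong (hˢ (select j ((i , b) ∷ []))) eq))
      (trans (hˢ-select j (i , b) (lookup m j)) (mono-^ (q R.^ b) i (lookup m j))))
    ... | no  m≢ = sym (hˢ-select-≢ j (i , b) m m≢)

    qPochInverse-≈ˢ : ∀ i (j : Fin t) n → qPochInverse i j n ≈ˢ select j (List.map (i ,_) (upTo n))
    qPochInverse-≈ˢ i j n m = trans (Πˢ-≈ˢ n (λ b → select j ((i , Fin.toℕ b) ∷ [])) (λ b → geometric-≈ˢ (Fin.toℕ b) i j) m) (reflexive (hˢ-cong (λ l →
      ≡.trans (select-cat j l (λ (b : Fin n) → (i , Fin.toℕ b) ∷ [])) (≡.cong (λ xs → select j xs l) (cat-singletons n (i ,_)))) m))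

    denominator-≈ˢ : Πˢ {s} {t} (λ i → Πˢ λ j → qPochInverse i j (lookup β i)) ≈ˢ (λ _ → W (allFin s))
    denominator-≈ˢ {t} m = trans
      (Πˢ-≈ˢ s (λ i _ → block i) (λ i m → trans
        (Πˢ-≈ˢ t (λ j → select j (block i)) (λ j → qPochInverse-≈ˢ i j (lookup β i)) m)
        (reflexive (hˢ-cong (cat-select (block i)) m))) m)
      (reflexive (hˢ-cong {Y = λ _ → cat block} (λ l → cat-concatMap s (λ i → i) block) m))
      where
      block : Fin s → List Index
      block i = List.map (i ,_) (upTo (lookup β i))

  F≈ : ∀ (m : Vec ℕ t) → F s t β m ≈ N (allFin s) * Π[] (Vec.toList m) (h (W (allFin s)) y)
  F≈ {t} m = begin
    F s t β m
      ≡⟨ concatMap≡Σ _ (splits m) ⟩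
    Σ[] (splits m) (λ ab → constˢ (numerator β) (proj₁ ab) * Πˢ (λ i → Πˢ λ j → qPochInverse i j (lookup β i)) (proj₂ ab))
      ≈⟨ Σ-cong (splits m) (λ ab → trans
           (*-cong {constˢ (numerator β) (proj₁ ab)} (const-≈ˢ (numerator β) (proj₁ ab)) (denominator-≈ˢ (proj₂ ab)))
           (*-assoc (numerator β) (hˢ (λ _ → []) (proj₁ ab)) _)) ⟩
    Σ[] (splits m) (λ ab → numerator β * (hˢ (λ _ → []) (proj₁ ab) * hˢ (λ _ → W (allFin s)) (proj₂ ab)))
      ≈⟨ *-Σ (splits m) (numerator β) _ ⟨
    numerator β * Σ[] (splits m) (λ ab → hˢ (λ _ → []) (proj₁ ab) * hˢ (λ _ → W (allFin s)) (proj₂ ab))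
      ≈⟨ *-cong {numerator β} {N (allFin s)} numerator≈N (trans (hˢ-++ (λ _ → []) (λ _ → W (allFin s)) m) (reflexive (hˢ-uniform (W (allFin s)) m))) ⟩
    N (allFin s) * Π[] (Vec.toList m) (h (W (allFin s)) y) ∎
    where open SetoidReasoning setoid

-- Specialisation of q

-- The coefficients of F are obtained from q by ring operations, the case distinctions concerning
-- exponents only. A relation that respects the operations therefore relates the coefficients over A
-- to those over B, even at the level of unreduced lists of terms.
record Compatible {a ℓa b ℓb r} (A : RawRing a ℓa) (B : RawRing b ℓb)
                  (_~_ : REL (RawRing.Carrier A) (RawRing.Carrier B) r) : Set (a ⊔ b ⊔ r) where
  private
    module A = RawRing A
    module B = RawRing B
  field
    0~ : A.0# ~ B.0#
    1~ : A.1# ~ B.1#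
    +~ : ∀ {x x′ y y′} → x ~ y → x′ ~ y′ → (x A.+ x′) ~ (y B.+ y′)
    *~ : ∀ {x x′ y y′} → x ~ y → x′ ~ y′ → (x A.* x′) ~ (y B.* y′)
    -~ : ∀ {x y} → x ~ y → (A.- x) ~ (B.- y)

module RelatedRings {a ℓa b ℓb r} {A : RawRing a ℓa} {B : RawRing b ℓb}
                    {_~_ : REL (RawRing.Carrier A) (RawRing.Carrier B) r} (compatible : Compatible A B _~_) where
  open Compatible compatible public
  private
    module A = RawRing A
    module B = RawRing B
    module A′ where
      open RawSemiringDefs A.rawSemiring public
      open QPochhammer A public
    module B′ where
      open RawSemiringDefs B.rawSemiring public
      open QPochhammer B public

  ^~ : ∀ n {x y} → x ~ y → (x A′.^ n) ~ (y B′.^ n)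
  ^~ zero    x~y = 1~
  ^~ (suc n) x~y = *~ x~y (^~ n x~y)

  qPoch~ : ∀ n {x y p r} → x ~ y → p ~ r → A′.qPoch x p n ~ B′.qPoch y r n
  qPoch~ zero    x~y p~r = 1~
  qPoch~ (suc n) x~y p~r = *~ (qPoch~ n x~y p~r) (+~ 1~ (-~ (*~ (^~ n p~r) x~y)))

  product~ : ∀ n {f : Vector A.Carrier n} {g : Vector B.Carrier n} → (∀ i → f i ~ g i) → A′.product f ~ B′.product g
  product~ zero    f~g = 1~
  product~ (suc n) f~g = *~ (f~g Fin.zero) (product~ n (f~g ∘ Fin.suc))

  if~ : ∀ c {x x′ y y′} → x ~ y → x′ ~ y′ → (if c then x else x′) ~ (if c then y else y′)
  if~ true  x~y _ = x~y
  if~ false _ x~y = x~y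

  module _ {p r} (p~r : p ~ r) (β : ℕ) where
    private
      module RA = Ratio A p β
      module RB = Ratio B r β

    den~ : ∀ μ → RA.den μ ~ RB.den μ
    den~ []      = 1~
    den~ (t ∷ μ) = *~ (*~ (+~ 1~ (-~ (^~ β p~r))) (qPoch~ (t ℕ.+ length μ ℕ.* β) p~r p~r)) (den~ μ)

    num~ : ∀ μ → RA.num μ ~ RB.num μ
    num~ []      = 1~
    num~ (t ∷ μ) = *~ (*~ (+~ (^~ (RA.others t μ) (^~ β p~r)) (-~ (^~ (suc (length μ)) (^~ β p~r)))) (qPoch~ (t ℕ.+ length μ ℕ.* β) (^~ β p~r) p~r)) (num~ μ)

module RelatedSeries {a ℓa b ℓb r} {A : RawRing a ℓa} {B : RawRing b ℓb}
                     {_~_ : REL (RawRing.Carrier A) (RawRing.Carrier B) r} (compatible : Compatible A B _~_) where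
  open RelatedRings compatible
  private
    module A = RawRing A
    module B = RawRing B
    module FA = FormalSeries A
    module FB = FormalSeries B

    module _ {s : ℕ} where

      _~ᵀ_ : REL (A.Carrier × Vec ℤ s) (B.Carrier × Vec ℤ s) r
      x ~ᵀ y = proj₁ x ~ proj₁ y × proj₂ x ≡ proj₂ y

      infix 4 _~ᴸ_
      _~ᴸ_ : REL (FA.Laurent s) (FB.Laurent s) _
      _~ᴸ_ = Pointwise _~ᵀ_

      *ᴸ~ : ∀ {x x′ y y′} → x ~ᴸ y → x′ ~ᴸ y′ → x FA.*ᴸ x′ ~ᴸ y FB.*ᴸ y′
      *ᴸ~ []           _   = []
      *ᴸ~ ((a~b , e≡f) ∷ xs) ys = Pointwise.++⁺
        (Pointwise.map⁺ _ _ (Pointwise.map (λ { (c~d , g≡h) → *~ a~b c~d , ≡.cong₂ _⊕_ e≡f g≡h }) ys)) (*ᴸ~ xs ys)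

      neg~ : ∀ {x y} → x ~ᴸ y → RawRing.-_ (FA.laurent s) x ~ᴸ RawRing.-_ (FB.laurent s) y
      neg~ xs = Pointwise.map⁺ _ _ (Pointwise.map (λ { (a~b , e≡f) → -~ a~b , e≡f }) xs)

      coeff~ : ∀ k {x y} → x ~ᴸ y → FA.coeffᴸ k x ~ FB.coeffᴸ k y
      coeff~ k []                            = 0~
      coeff~ k (_∷_ {x = x} (a~b , ≡.refl) xs) = if~ ⌊ Vec.≡-dec ℤ._≟_ (proj₂ x) k ⌋ (+~ a~b (coeff~ k xs)) (coeff~ k xs)

      const~ : ∀ {a b} → a ~ b → FA.constᴸ a ~ᴸ FB.constᴸ b
      const~ a~b = (a~b , ≡.refl) ∷ []

    laurent-compatible : ∀ s → Compatible (FA.laurent s) (FB.laurent s) _~ᴸ_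
    laurent-compatible s = record { 0~ = [] ; 1~ = const~ 1~ ; +~ = Pointwise.++⁺ ; *~ = *ᴸ~ ; -~ = neg~ }

    module Lᴿ {s : ℕ} = RelatedRings (laurent-compatible s)

    _~ˢ_ : ∀ {s t} → REL (FA.Series s t) (FB.Series s t) _
    f ~ˢ g = ∀ m → f m ~ᴸ g m

    splits-agree : ∀ {t} (m : Vec ℕ t) → FA.splits m ≡ FB.splits m
    splits-agree Vec.[]       = ≡.refl
    splits-agree (m Vec.∷ ms) = ≡.cong (cartesianProductWith _ (upTo (suc m))) (splits-agree ms)

    concatMap~ : ∀ {d} {D : Set d} {s} {f : D → FA.Laurent s} {g} → (∀ x → f x ~ᴸ g x) → ∀ xs → concatMap f xs ~ᴸ concatMap g xs
    concatMap~ f~g []       = []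
    concatMap~ f~g (x ∷ xs) = Pointwise.++⁺ (f~g x) (concatMap~ f~g xs)

    *ˢ~ : ∀ {s t} {f f′ : FA.Series s t} {g g′} → f ~ˢ g → f′ ~ˢ g′ → (f FA.*ˢ f′) ~ˢ (g FB.*ˢ g′)
    *ˢ~ f~g f′~g′ m rewrite splits-agree m = concatMap~ (λ ab → *ᴸ~ (f~g (proj₁ ab)) (f′~g′ (proj₂ ab))) (FB.splits m)

    constˢ~ : ∀ {s t x y} → x ~ᴸ y → FA.constˢ {s} {t} x ~ˢ FB.constˢ y
    constˢ~ {t = t} x~y m = Lᴿ.if~ ⌊ Vec.≡-dec ℕ._≟_ m (replicate t 0) ⌋ x~y []

    Πˢ~ : ∀ {s t} n {f : Vector (FA.Series s t) n} {g} → (∀ v → f v ~ˢ g v) → FA.Πˢ f ~ˢ FB.Πˢ g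
    Πˢ~ zero    f~g = constˢ~ (const~ 1~)
    Πˢ~ (suc n) f~g = *ˢ~ (f~g Fin.zero) (Πˢ~ n (f~g ∘ Fin.suc))

    geometric~ : ∀ {s t a b} → a ~ b → (i : Fin s) (j : Fin t) → FA.geometric a i j ~ˢ FB.geometric b i j
    geometric~ {t = t} a~b i j m =
      Lᴿ.if~ ⌊ Vec.≡-dec ℕ._≟_ m (replicate t 0 [ j ]≔ lookup m j) ⌋ ((^~ (lookup m j) a~b , ≡.refl) ∷ []) []


  module _ {p r} (p~r : p ~ r) where
    private
      module QA = QDyson A p
      module QB = QDyson B r

      numerator~ : ∀ {s} (β : Vec ℕ s) → QA.numerator β ~ᴸ QB.numerator β
      numerator~ {s} β = Lᴿ.product~ s (λ i → Lᴿ.product~ s (λ j → Lᴿ.if~ ⌊ i Fin.<? j ⌋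
        (*ᴸ~ (Lᴿ.qPoch~ (lookup β i) (*ᴸ~ z~ z~) (const~ p~r)) (Lᴿ.qPoch~ (lookup β j) (*ᴸ~ (const~ p~r) (*ᴸ~ z~ z~)) (const~ p~r)))
        (const~ 1~)))
        where
        z~ : ∀ {e : Vec ℤ s} → ((A.1# , e) ∷ []) ~ᴸ ((B.1# , e) ∷ [])
        z~ = (1~ , ≡.refl) ∷ []

      qPochInverse~ : ∀ {s t} (i : Fin s) (j : Fin t) n → QA.qPochInverse i j n ~ˢ QB.qPochInverse i j n
      qPochInverse~ i j n = Πˢ~ n (λ b → geometric~ (^~ (Fin.toℕ b) p~r) i j)

    F~ : ∀ s t (β : Vec ℕ s) k m → FA.coeff k m (QA.F s t β) ~ FB.coeff k m (QB.F s t β)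
    F~ s t β k m = coeff~ k (*ˢ~ (constˢ~ (numerator~ β)) (Πˢ~ s (λ i → Πˢ~ t (λ j → qPochInverse~ i j (lookup β i)))) m)

-- Polynomials in an indeterminate q and their evaluation

module GenericParameter {c ℓ} (K : CommutativeRing c ℓ) where
  open CommutativeRing K hiding (zero)
  open Exp semiring using (_^_; ^-homo-*)
  open MonoidRing K ℕ._≟_ ℕ._+_ 0 ℕ.+-0-isCommutativeMonoid public
  private
    module P where
      open CommutativeRing ring⟨⟩ public
      open BigRing ring⟨⟩ public
      open Exp (CommutativeRing.semiring ring⟨⟩) public using (_^_)

  x : Poly
  x = mono 1# 1

  private
    x^≋ : ∀ n → x P.^ n ≋ mono 1# n
    x^≋ zero    = P.refl
    x^≋ (suc n) = P.trans (P.*-congˡ {x} (x^≋ n)) (mono-cong (*-identityˡ 1#) ≡.refl)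

  Regular-x : P.Regular x
  Regular-x f eq = mk (λ k → trans (sym (*-identityˡ _))
    (trans (sym (coeff-mono-⊛ {suc k} {k} {1} (λ e → ℕ.suc-injective) ≡.refl 1# f)) (at eq (suc k))))

  -- From f = x^{n+1} f, the coefficient of f at k is 0 for k ≤ n and otherwise equals the one at k
  -- - (n+1); strong induction on k applies.
  Regular-1-x^ : ∀ n → P.Regular (P.1# P.- x P.^ suc n)
  Regular-1-x^ n f eq = mk (<-rec _ step)
    where
    f≋ : f ≋ mono 1# (suc n) ⊛ f
    f≋ = P.x-y≈0⇒x≈y f (mono 1# (suc n) ⊛ f) (P.trans
      (P.+-cong {f} {P.1# P.* f} (P.sym (P.*-identityˡ f)) (P.-‿cong (P.*-congʳ {f} (P.sym (x^≋ (suc n))))))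
      (P.trans (P.sym ([y-z]x≈yx-zx f P.1# (x P.^ suc n))) eq))
      where open RingProperties P.ring using ([y-z]x≈yx-zx)
    step : ∀ k → (∀ {l} → l ℕ.< k → coeff l f ≈ 0#) → coeff k f ≈ 0#
    step k IH with suc n ℕ.≤? k
    ... | no  n≮k = trans (at f≋ k) (coeff-mono-⊛-0 {k} {suc n} (λ e → λ { ≡.refl → n≮k (ℕ.m≤m+n (suc n) e) }) 1# f)
    ... | yes n<k = trans (at f≋ k) (trans (coeff-mono-⊛ {k} {k ℕ.∸ suc n} {suc n}
      (λ e → λ { ≡.refl → ≡.sym (ℕ.m+n∸m≡n (suc n) e) }) (ℕ.m+[n∸m]≡n n<k) 1# f)
      (trans (*-congˡ (IH (ℕ.∸-monoʳ-< (ℕ.s≤s ℕ.z≤n) n<k))) (zeroʳ 1#)))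

  generic-x : Generic ring⟨⟩ x
  generic-x = record { reg-q = Regular-x ; reg-1-q = Regular-1-x^ }

  module Evaluation (q : Carrier) where

    eval : Poly → Carrier
    eval p = ⟨ (q ^_) , p ⟩

    _⇝_ : Poly → Carrier → Set ℓ
    p ⇝ a = eval p ≈ a

    eval-compatible : Compatible P.rawRing rawRing _⇝_
    eval-compatible = record
      { 0~ = refl
      ; 1~ = trans (+-identityʳ _) (*-identityˡ _)
      ; +~ = λ {p} {p′} p⇝ p′⇝ → trans (⟨⟩-++ _ p p′) (+-cong p⇝ p′⇝)
      ; *~ = λ {p} {p′} p⇝ p′⇝ → trans (eval-⊛ p p′) (*-cong p⇝ p′⇝)
      ; -~ = λ {p} p⇝ → trans (⟨⟩-neg _ p) (-‿cong p⇝)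
      }
      where
      eval-⊛ : ∀ p p′ → eval (p ⊛ p′) ≈ eval p * eval p′
      eval-⊛ p p′ = trans (⟨⟩-⊛ _ p p′) (trans (⟨⟩-cong (λ e → trans (⟨⟩-cong (λ f → ^-homo-* q e f) p′)
        (trans (⟨⟩-* (q ^ e) _ p′) (*-comm _ _))) p) (trans (⟨⟩-* (eval p′) _ p) (*-comm _ _)))

    x⇝q : x ⇝ q
    x⇝q = trans (+-identityʳ _) (trans (*-identityˡ _) (*-identityʳ q))

  module Specialization (q : Carrier) (s t : ℕ) (β : Vec ℕ s) where
    open Evaluation q
    open LaurentPolynomials ring⟨⟩ s using (laurentRing; coeffᴸ≈coeff)
    open Reduction ring⟨⟩ x s β using (F≈)
    open Laurent laurentRing using (Π[]; coeff-cong) renaming (_*_ to _*ˣ_; coeff to coeffˣ; ring to ringˣ)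
    open Factors laurentRing x (lookup β)
    open CompleteHomogeneous ringˣ using (h)

    reduced : Vec ℤ s → List ℕ → Poly
    reduced k ms = coeffˣ k (N (allFin s) *ˣ Π[] ms (h (W (allFin s)) y))

    F-specializes : ∀ k m → reduced k (Vec.toList m) ⇝ FormalSeries.coeff rawRing k m (QDyson.F rawRing q s t β)
    F-specializes k m = trans (⟨⟩-resp _ (P.sym (P.trans
      (coeffᴸ≈coeff k (QDyson.F P.rawRing x s t β m)) (coeff-cong {k} (F≈ m)))))
      (RelatedSeries.F~ eval-compatible x⇝q s t β k m)

-- Decreasing rearrangements and their partial sums

module Sorting where
  open SumsOfExponents using (big)

  Σℤ : List ℤ → ℤ
  Σℤ = List.foldr ℤ._+_ 0ℤ

  Σℤ-↭ : ∀ {xs ys} → xs ↭ ys → Σℤ xs ≡ Σℤ ys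
  Σℤ-↭ {xs} {ys} p = ≡.trans (fold xs) (≡.trans (SumsOfExponents.big-↭ (λ x → x) p) (≡.sym (fold ys)))
    where
    fold : ∀ xs → Σℤ xs ≡ big xs (λ x → x)
    fold []       = ≡.refl
    fold (x ∷ xs) = ≡.cong (ℤ._+_ x) (fold xs)

  -- The largest entry y either belongs to the chosen entries and is removed from them, or it
  -- belongs to the rest, where it takes the place of a chosen entry u ≤ y.
  initial-sum-max : ∀ ys us vs → AllPairs ℤ._≥_ ys → ys ↭ us ++ vs → Σℤ us ℤ.≤ Σℤ (List.take (length us) ys)
  initial-sum-max ys []       vs dec p = ℤ.≤-refl
  initial-sum-max [] (u ∷ us) vs dec p with () ← Perm.↭-empty-inv (↭-sym p)
  initial-sum-max (y ∷ ys) us₁@(u ∷ us) vs (y≥ ∷ dec) p with ∈-++⁻ us₁ (∈-resp-↭ p (here ≡.refl))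
  ... | inj₁ y∈us with as , bs , eq ← ∈-∃++ y∈us = ≡.subst (ℤ._≤ Σℤ (y ∷ List.take (length us) ys)) (≡.sym (Σℤ-↭ us↭))
      (ℤ.+-monoʳ-≤ y (≡.subst (λ n → Σℤ (as ++ bs) ℤ.≤ Σℤ (List.take n ys)) (ℕ.suc-injective (≡.sym (↭-length us↭)))
        (initial-sum-max ys (as ++ bs) vs dec (drop-∷ (↭-trans p (Perm.++⁺ʳ vs us↭))))))
    where
    us↭ : us₁ ↭ y ∷ as ++ bs
    us↭ = ↭-trans (↭-reflexive eq) (Perm.shift y as bs)
  ... | inj₂ y∈vs with as , bs , ≡.refl ← ∈-∃++ y∈vs =
    ℤ.+-mono-≤ u≤y (initial-sum-max ys us (u ∷ as ++ bs) dec (↭-trans ys↭ (↭-sym (Perm.shift u us (as ++ bs)))))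
    where
    ys↭ : ys ↭ us₁ ++ (as ++ bs)
    ys↭ = drop-∷ (↭-trans p (↭-trans (Perm.++⁺ˡ us₁ (Perm.shift y as bs)) (Perm.shift y us₁ (as ++ bs))))
    u≤y : u ℤ.≤ y
    u≤y = All.lookup y≥ (∈-resp-↭ (↭-sym ys↭) (here ≡.refl))

  take-⊓ : ∀ {a} {A : Set a} n (xs : List A) → List.take (n ℕ.⊓ length xs) xs ≡ List.take n xs
  take-⊓ zero    xs       = ≡.refl
  take-⊓ (suc n) []       = ≡.refl
  take-⊓ (suc n) (x ∷ xs) = ≡.cong (x ∷_) (take-⊓ n xs)

  module S = Sort (decTotalOrder ℤ.≤-decTotalOrder)

  ⁺-dec : ∀ {n} (k : Vec ℤ n) → AllPairs ℤ._≥_ (k ⁺)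
  ⁺-dec k = Linked⇒AllPairs (λ x≥y y≥z → ℤ.≤-trans y≥z x≥y) (S.sort-↗ (Vec.toList k))

  ⁺-↭ : ∀ {n} (k : Vec ℤ n) → k ⁺ ↭ Vec.toList k
  ⁺-↭ k = S.sort-↭ (Vec.toList k)

  toList≡map : ∀ {a} {A : Set a} {n} (k : Vec A n) → Vec.toList k ≡ List.map (lookup k) (allFin n)
  toList≡map Vec.[]       = ≡.refl
  toList≡map (x Vec.∷ xs) = ≡.cong (x ∷_) (≡.trans (toList≡map xs)
    (≡.trans (List.map-tabulate (λ i → i) (lookup xs)) (≡.sym (List.map-tabulate Fin.suc (lookup (x Vec.∷ xs))))))

  -- Marks the first n entries. Past the end it appends marked zeros, which contribute the factor
  -- h_0 = 1 and match the padding of the vectors, so that exactly n entries are marked.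
  flags : ℕ → List ℕ → List (Bool × ℕ)
  flags zero    xs       = List.map (false ,_) xs
  flags (suc n) []       = (true , 0) ∷ flags n []
  flags (suc n) (x ∷ xs) = (true , x) ∷ flags n xs

  count-flags : ∀ n xs → count (flags n xs) ≡ n
  count-flags zero    []       = ≡.refl
  count-flags zero    (x ∷ xs) = count-flags zero xs
  count-flags (suc n) []       = ≡.cong suc (count-flags n [])
  count-flags (suc n) (x ∷ xs) = ≡.cong suc (count-flags n xs)

  total-flags : ∀ n xs → + total (flags n xs) ≡ partialSum n (List.map +_ xs)
  total-flags zero    []       = ≡.refl
  total-flags zero    (x ∷ xs) = total-flags zero xs
  total-flags (suc n) []       = ≡.trans (total-flags n []) (≡.cong Σℤ (take-[] n))
    where
    take-[] : ∀ n → List.take n (List.map +_ []) ≡ []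
    take-[] zero    = ≡.refl
    take-[] (suc n) = ≡.refl
  total-flags (suc n) (x ∷ xs) = ≡.cong (ℤ._+_ (+ x)) (total-flags n xs)

-- Both assertions for arbitrary q, without division

module _ {c ℓ} (K : CommutativeRing c ℓ) (q : CommutativeRing.Carrier K) where
  open CommutativeRing K using (_≈_; 0#; rawRing)
  open FormalSeries rawRing using (coeff)
  open QDyson rawRing q using (F)
  open GenericParameter K hiding (coeff)
  open Sorting

  coefficient-vanishes : ∀ s t (β : Vec ℕ s) → (∀ i → 1 ℕ.≤ lookup β i) → ∀ k (m : Vec ℕ t) n →
    ¬ (partialSum n (Vec.map +_ m ⁺) ℤ.≤ partialSum n (k ⁺)) → coeff k m (F s t β) ≈ 0#
  coefficient-vanishes s t β 1≤β k m n ¬≤ = K.trans (K.sym (F-specializes k m)) (⟨⟩-resp _ vanishes)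
    where
    module K = CommutativeRing K
    open Evaluation q
    open Specialization q s t β
    open LaurentPolynomials ring⟨⟩ s using (laurentRing)
    open Laurent laurentRing using (Π[]; Π-↭; Π-map)
      renaming (_≈_ to _≈ˣ_; coeff-cong to coeffˣ-cong; *-congˡ to *-congˡˣ; ring to ringˣ)
    module L = CommutativeRing ringˣ
    open CompleteHomogeneous ringˣ using (h-0)
    -- Any common bound of the β_i serves.
    n̂ = Vec.sum β
    β≤n̂ : ∀ i → lookup β i ℕ.≤ n̂
    β≤n̂ = bound β
      where
      bound : ∀ {s} (β : Vec ℕ s) i → lookup β i ℕ.≤ Vec.sum β
      bound (b Vec.∷ β) Fin.zero    = ℕ.m≤m+n b _
      bound (b Vec.∷ β) (Fin.suc i) = ℕ.≤-trans (bound β i) (ℕ.m≤n+m _ b)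
    open DominanceSupport laurentRing x generic-x (lookup β) 1≤β n̂ β≤n̂
    open Recursion laurentRing x generic-x (lookup β) 1≤β n̂ β≤n̂ using (N)

    -- Sorting takes place among the integers; τ is the sorted list read back as natural numbers,
    -- which the arguments of `h` have to be.
    sorted : ∃ λ τ → Vec.map +_ m ⁺ ≡ List.map +_ τ × Vec.toList m ↭ τ
    sorted = Perm.↭-map-inv +_ (↭-trans (↭-reflexive (≡.sym (Vec.toList-map +_ m))) (↭-sym (⁺-↭ (Vec.map +_ m))))
    τ = proj₁ sorted
    ms = flags n τ

    Π-flags : ∀ n xs → Π[] (flags n xs) (hᵂ (allFin s) ∘ proj₂) ≈ˣ Π[] xs (hᵂ (allFin s))
    Π-flags zero    xs       = Π-map xs (false ,_) _
    Π-flags (suc n) []       = L.trans (L.*-cong {hᵂ (allFin s) 0} {L.1#} (L.reflexive (h-0 (W (allFin s)) y)) (Π-flags n [])) (L.*-identityˡ L.1#)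
      where open Recursion laurentRing x generic-x (lookup β) 1≤β n̂ β≤n̂ using (W; y)
    Π-flags (suc n) (x ∷ xs) = L.*-congˡ {hᵂ (allFin s) x} (Π-flags n xs)

    ¬Dom : ¬ Dom (allFin s) (count ms) (total ms) k
    ¬Dom (dom S S′ perm size large) = ¬≤ (begin
      partialSum n (Vec.map +_ m ⁺)       ≡⟨ ≡.cong (partialSum n) (proj₁ (proj₂ sorted)) ⟩
      partialSum n (List.map +_ τ)        ≡⟨ total-flags n τ ⟨
      + total ms                          ≤⟨ large ⟩
      SumsOfExponents.sumAt S k           ≡⟨ sumAt≡ S ⟩
      Σℤ (List.map (lookup k) S)          ≤⟨ initial-sum-max (k ⁺) (List.map (lookup k) S) (List.map (lookup k) S′) (⁺-dec k) k⁺↭ ⟩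
      Σℤ (List.take (length (List.map (lookup k) S)) (k ⁺)) ≡⟨ ≡.cong Σℤ (≡.trans (≡.cong (λ l → List.take l (k ⁺)) len) (take-⊓ n (k ⁺))) ⟩
      partialSum n (k ⁺)                  ∎)
      where
      open ℤ.≤-Reasoning
      sumAt≡ : ∀ S → SumsOfExponents.sumAt S k ≡ Σℤ (List.map (lookup k) S)
      sumAt≡ []      = ≡.refl
      sumAt≡ (i ∷ S) = ≡.cong (ℤ._+_ (lookup k i)) (sumAt≡ S)
      k⁺↭ : k ⁺ ↭ List.map (lookup k) S ++ List.map (lookup k) S′
      k⁺↭ = ↭-trans (⁺-↭ k) (↭-trans (↭-reflexive (toList≡map k)) (↭-trans (Perm.map⁺ (lookup k) (↭-sym perm))
        (↭-reflexive (List.map-++ (lookup k) S S′))))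
      len : length (List.map (lookup k) S) ≡ n ℕ.⊓ length (k ⁺)
      len = ≡.trans (List.length-map (lookup k) S) (≡.trans size (≡.cong₂ ℕ._⊓_ (count-flags n τ)
        (≡.sym (≡.trans (↭-length (⁺-↭ k)) (≡.trans (≡.cong length (toList≡map k)) (List.length-map (lookup k) (allFin s)))))))

    vanishes : reduced k (Vec.toList m) ≋ []
    vanishes = L′.trans (coeffˣ-cong {k} (*-congˡˣ {N (allFin s)} (L.trans (Π-↭ _ (proj₂ (proj₂ sorted))) (L.sym (Π-flags n τ)))))
      (support (Unique.allFin⁺ s) ms k ¬Dom)
      where module L′ = CommutativeRing ring⟨⟩

  -- Cleared of denominators, the formula is an identity over K[x] and can be evaluated at every q;
  -- the quotient is formed only afterwards.
  den*coeff≈num : ∀ s t (b : ℕ) → 1 ℕ.≤ b → (μ : List ℕ) → AllPairs ℕ._≥_ μ →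
    (k : Vec ℤ s) (m : Vec ℕ t) → Vec.toList k ≡ List.map +_ μ → Vec.toList m ≡ μ →
    CommutativeRing._*_ K (Ratio.den rawRing q b μ) (coeff k m (F s t (replicate s b))) ≈ Ratio.num rawRing q b μ
  den*coeff≈num s t b 1≤b μ dec k m k≡μ m≡μ =
    K.trans (K.sym (*~ {p} {reduced k (Vec.toList m)} (den~ x⇝q b μ) (F-specializes k m)))
      (K.trans (⟨⟩-resp _ leading) (num~ x⇝q b μ))
    where
    module K = CommutativeRing K
    module P = CommutativeRing ring⟨⟩
    open Evaluation q
    open Specialization q s t (replicate s b)
    open RelatedRings eval-compatible
    open LaurentPolynomials ring⟨⟩ s using (laurentRing)
    β≡b : ∀ i → lookup (replicate s b) i ≡ b
    β≡b i = Vec.lookup-replicate i b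
    open LeadingCoefficient laurentRing x generic-x (lookup (replicate s b))
      (λ i → ≡.subst (1 ℕ.≤_) (≡.sym (β≡b i)) 1≤b) b β≡b
    p = Ratio.den P.rawRing x b μ
    leading : p ⊛ reduced k (Vec.toList m) ≋ Ratio.num P.rawRing x b μ
    leading = P.trans (P.reflexive (≡.cong (λ ms → p ⊛ reduced k ms) m≡μ))
      (leadingCoefficient μ (allFin s) k (AllPairs.tabulate⁺-< (λ i<j → i<j))
        (≡.trans (≡.sym (toList≡map k)) k≡μ) (λ l∉ → ⊥-elim (l∉ (∈-allFin _))) dec)

-- The formula for c_λ

nth : List ℕ → ℕ → ℕ
nth []       _       = 0
nth (x ∷ _)  zero    = x
nth (_ ∷ xs) (suc i) = nth xs i

module _ where
  open Partition

  -- The left-hand side of part-go is the local function of `part`, which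
  -- cannot be named; it is inferred from the call in part≡nth.
  part-go   : ∀ (lam : Partition) xs i → _ ≡ nth xs i
  part≡nth  : ∀ lam i → part lam i ≡ nth (parts lam) i
  part≡nth lam i with parts lam
  ... | xs = part-go lam xs i
  part-go lam []       i       = ≡.refl
  part-go lam (x ∷ xs) zero    = ≡.refl
  part-go lam (x ∷ xs) (suc i) = part-go lam xs i

  toList-firstParts : ∀ lam s → s ≡ ℓ lam → Vec.toList (firstParts lam s) ≡ parts lam
  toList-firstParts lam s ≡.refl =
    ≡.trans (≡.cong Vec.toList (Vec.tabulate-cong (λ i → part≡nth lam (Fin.toℕ i)))) (go (parts lam))
    where
    go : ∀ xs → Vec.toList (Vec.tabulate {n = length xs} (λ i → nth xs (Fin.toℕ i))) ≡ xs
    go []       = ≡.refl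
    go (x ∷ xs) = ≡.cong (x ∷_) (go xs)

-- Multiplicities of parts

multiplicity : List ℕ → ℕ → ℕ
multiplicity μ i = length (filter (i ℕ.≟_) μ)

multiplicity-≡ : ∀ t μ → multiplicity (t ∷ μ) t ≡ suc (multiplicity μ t)
multiplicity-≡ t μ = ≡.cong length (List.filter-accept (t ℕ.≟_) {xs = μ} ≡.refl)

multiplicity-≢ : ∀ {t i} μ → i ≢ t → multiplicity (t ∷ μ) i ≡ multiplicity μ i
multiplicity-≢ {t} {i} μ i≢t = ≡.cong length (List.filter-reject (i ℕ.≟_) {xs = μ} i≢t)

module BigMultiplicity {c ℓ} (M : CommutativeMonoid c ℓ) where
  open CommutativeMonoid M
  open BigOperator M
  open Removal ℕ._≟_

  byMultiplicity : ℕ → (ℕ → Carrier) → List ℕ → Carrier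
  byMultiplicity T g μ = big (upTo T) (λ v → g (multiplicity μ (suc v)))

  byMultiplicity-[] : ∀ T {g : ℕ → Carrier} → g 0 ≈ ε → byMultiplicity T g [] ≈ ε
  byMultiplicity-[] T g0 = trans (big-cong (upTo T) (λ _ → g0)) (big-ε (upTo T))

  -- Prepending t changes only the multiplicity of t, and φ records the effect of the step from m to
  -- m + 1. The additive case yields the sum of the m_i², the multiplicative one the products of
  -- (Q;Q)_{m_i} and of (1 - Q)^{m_i}.
  byMultiplicity-∷ : ∀ {T} {g φ : ℕ → Carrier} → (∀ m → g (suc m) ≈ φ m ∙ g m) → ∀ {t} μ → 1 ℕ.≤ t → t ℕ.≤ T →
                     byMultiplicity T g (t ∷ μ) ≈ φ (multiplicity μ t) ∙ byMultiplicity T g μ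
  byMultiplicity-∷ {T} {g} {φ} step {suc t} μ _ t≤T = begin
    big (upTo T) (λ v → g (multiplicity (suc t ∷ μ) (suc v)))
      ≈⟨ big-↭ _ T↭ ⟩
    g (multiplicity (suc t ∷ μ) (suc t)) ∙ big rest (λ v → g (multiplicity (suc t ∷ μ) (suc v)))
      ≈⟨ ∙-cong (trans (reflexive (≡.cong g (multiplicity-≡ (suc t) μ))) (step _))
           (big-cong-∈ rest (λ {v} v∈ → reflexive (≡.cong g (multiplicity-≢ {suc t} {suc v} μ (λ { ≡.refl → ∉-∖ (upTo T) t v∈ }))))) ⟩
    (φ (multiplicity μ (suc t)) ∙ g (multiplicity μ (suc t))) ∙ big rest (λ v → g (multiplicity μ (suc v)))
      ≈⟨ assoc _ _ _ ⟩
    φ (multiplicity μ (suc t)) ∙ (g (multiplicity μ (suc t)) ∙ big rest (λ v → g (multiplicity μ (suc v))))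
      ≈⟨ ∙-congˡ (big-↭ _ T↭) ⟨
    φ (multiplicity μ (suc t)) ∙ byMultiplicity T g μ ∎
    where
    open SetoidReasoning setoid
    rest = upTo T ∖ t
    T↭ : upTo T ↭ t ∷ rest
    T↭ = ↭-∖ (Unique.upTo⁺ T) (∈-upTo⁺ t≤T)

multiplicity+others : ∀ t μ → multiplicity μ t ℕ.+ length (filter (λ x → ¬? (t ℕ.≟ x)) μ) ≡ length μ
multiplicity+others t []      = ≡.refl
multiplicity+others t (x ∷ μ) = by-cases (t ℕ.≟ x)
  where
  by-cases : Dec (t ≡ x) → multiplicity (x ∷ μ) t ℕ.+ length (filter (λ x → ¬? (t ℕ.≟ x)) (x ∷ μ)) ≡ suc (length μ)
  by-cases (yes ≡.refl) = ≡.trans (≡.cong₂ ℕ._+_ (multiplicity-≡ t μ)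
    (≡.cong length (List.filter-reject (λ x → ¬? (t ℕ.≟ x)) {xs = μ} (λ t≢t → t≢t ≡.refl)))) (≡.cong suc (multiplicity+others t μ))
  by-cases (no t≢x) = ≡.trans (≡.cong₂ ℕ._+_ (multiplicity-≢ μ t≢x)
    (≡.cong length (List.filter-accept (λ x → ¬? (t ℕ.≟ x)) {xs = μ} t≢x))) (≡.trans (ℕ.+-suc _ _) (≡.cong suc (multiplicity+others t μ)))

-- The number of pairs of positions with unequal parts, which is (l² - Σ m_i²)/2 by `Σ-squares`.
inversions : List ℕ → ℕ
inversions []      = 0
inversions (t ∷ μ) = length (filter (λ x → ¬? (t ℕ.≟ x)) μ) ℕ.+ inversions μ

module _ where
  open BigMultiplicity ℕ.+-0-commutativeMonoid
  open BigOperator ℕ.+-0-commutativeMonoid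

  -- A new part t adds 1 + 2l to l² and 1 + 2m_t to the sum of the squares; the difference is twice
  -- the number of parts other than t.
  Σ-squares : ∀ T μ → All (λ p → 1 ℕ.≤ p × p ℕ.≤ T) μ →
    length μ ℕ.* length μ ≡ byMultiplicity T (λ m → m ℕ.* m) μ ℕ.+ inversions μ ℕ.* 2
  Σ-squares T []      []                     = ≡.sym (≡.cong (ℕ._+ 0) (byMultiplicity-[] T {λ m → m ℕ.* m} ≡.refl))
  Σ-squares T (t ∷ μ) ((1≤t , t≤T) ∷ bounds) = begin
    suc l ℕ.* suc l                                                      ≡⟨ square-suc l ⟩
    1 ℕ.+ 2 ℕ.* l ℕ.+ l ℕ.* l                                            ≡⟨ ≡.cong₂ (λ a b → 1 ℕ.+ 2 ℕ.* a ℕ.+ b) (≡.sym (multiplicity+others t μ)) (Σ-squares T μ bounds) ⟩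
    1 ℕ.+ 2 ℕ.* (m ℕ.+ r) ℕ.+ (S ℕ.+ inversions μ ℕ.* 2)                 ≡⟨ reorder m r S (inversions μ) ⟩
    (1 ℕ.+ 2 ℕ.* m ℕ.+ S) ℕ.+ (r ℕ.+ inversions μ) ℕ.* 2                 ≡⟨ ≡.cong (ℕ._+ (r ℕ.+ inversions μ) ℕ.* 2) (≡.sym
        (byMultiplicity-∷ {T} {λ m → m ℕ.* m} {λ m → 1 ℕ.+ 2 ℕ.* m} square-suc μ 1≤t t≤T)) ⟩
    byMultiplicity T (λ m → m ℕ.* m) (t ∷ μ) ℕ.+ inversions (t ∷ μ) ℕ.* 2 ∎
    where
    open ≡.≡-Reasoning
    l = length μ
    m = multiplicity μ t
    r = length (filter (λ x → ¬? (t ℕ.≟ x)) μ)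
    S = byMultiplicity T (λ m → m ℕ.* m) μ
    square-suc : ∀ m → suc m ℕ.* suc m ≡ 1 ℕ.+ 2 ℕ.* m ℕ.+ m ℕ.* m
    square-suc = ℕSolver.solve-∀
    reorder : ∀ m r S i → 1 ℕ.+ 2 ℕ.* (m ℕ.+ r) ℕ.+ (S ℕ.+ i ℕ.* 2) ≡ (1 ℕ.+ 2 ℕ.* m ℕ.+ S) ℕ.+ (r ℕ.+ i) ℕ.* 2
    reorder = ℕSolver.solve-∀

  sum-map : ∀ {a} {A : Set a} (f : A → ℕ) xs → ListAction.sum (List.map f xs) ≡ big xs f
  sum-map f []       = ≡.refl
  sum-map f (x ∷ xs) = ≡.cong (f x ℕ.+_) (sum-map f xs)

  exponent≡ : ∀ β T μ → All (λ p → 1 ℕ.≤ p × p ℕ.≤ T) μ →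
    (β ℕ.* (length μ ℕ.* length μ ℕ.∸ ListAction.sum (List.map (λ v → multiplicity μ (suc v) ℕ.* multiplicity μ (suc v)) (upTo T)))) ÷ 2
      ≡ β ℕ.* inversions μ
  exponent≡ β T μ bounds = begin
    (β ℕ.* (length μ ℕ.* length μ ℕ.∸ ListAction.sum (List.map square (upTo T)))) ÷ 2
      ≡⟨ ≡.cong₂ (λ a b → (β ℕ.* (a ℕ.∸ b)) ÷ 2) (Σ-squares T μ bounds) (sum-map square (upTo T)) ⟩
    (β ℕ.* (S ℕ.+ inversions μ ℕ.* 2 ℕ.∸ S)) ÷ 2
      ≡⟨ ≡.cong (λ a → (β ℕ.* a) ÷ 2) (ℕ.m+n∸m≡n S _) ⟩
    (β ℕ.* (inversions μ ℕ.* 2)) ÷ 2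
      ≡⟨ ≡.cong (_÷ 2) (≡.sym (ℕ.*-assoc β (inversions μ) 2)) ⟩
    (β ℕ.* inversions μ ℕ.* 2) ÷ 2
      ≡⟨ m*n/n≡m (β ℕ.* inversions μ) 2 ⟩
    β ℕ.* inversions μ ∎
    where
    open ≡.≡-Reasoning
    square = λ v → multiplicity μ (suc v) ℕ.* multiplicity μ (suc v)
    S = byMultiplicity T (λ m → m ℕ.* m) μ

module RatioProducts {c ℓ} (K : CommutativeRing c ℓ) (q : CommutativeRing.Carrier K) (β : ℕ) where
  open CommutativeRing K hiding (zero)
  open BigRing K
  open Exp semiring using (_^_; ^-homo-*; ^-assocʳ)
  open RawSemiringDefs (RawRing.rawSemiring rawRing) using (product)
  open QPochhammer rawRing using (qPoch)
  open Ratio rawRing q β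
  open BigMultiplicity *-commutativeMonoid
  open IntegerSolver K
  open SetoidReasoning setoid

  private
    Q = q ^ β

  product≈Π : ∀ n (f : ℕ → Carrier) → product {n} (λ i → f (Fin.toℕ i)) ≈ Π[] (upTo n) f
  product≈Π zero    f = refl
  product≈Π (suc n) f = *-congˡ (trans (product≈Π n (f ∘ suc))
    (trans (sym (Π-map (upTo n) suc f)) (reflexive (≡.cong (λ xs → Π[] xs f) (List.map-upTo suc n)))))

  product-* : ∀ n (f g : Vector Carrier n) → product (λ i → f i * g i) ≈ product f * product g
  product-* zero    f g = sym (*-identityˡ 1#)
  product-* (suc n) f g = trans (*-congˡ (product-* n (f ∘ Fin.suc) (g ∘ Fin.suc))) (*-exchange _ _ _ _)

  product-cong : ∀ n {f g : Vector Carrier n} → (∀ i → f i ≈ g i) → product f ≈ product g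
  product-cong zero    eq = refl
  product-cong (suc n) eq = *-cong (eq Fin.zero) (product-cong n (eq ∘ Fin.suc))

  byPosition : (ℕ → Carrier) → List ℕ → Carrier
  byPosition G μ = product {length μ} (λ i → G (nth μ (Fin.toℕ i) ℕ.+ (length μ ℕ.∸ suc (Fin.toℕ i)) ℕ.* β))

  den≈ : ∀ T μ → All (λ p → 1 ℕ.≤ p × p ℕ.≤ T) μ → den μ ≈ byMultiplicity T ((1# - Q) ^_) μ * byPosition (qPoch q q) μ
  den≈ T []      []                     = sym (trans (*-identityʳ _) (byMultiplicity-[] T {(1# - Q) ^_} refl))
  den≈ T (t ∷ μ) ((1≤t , t≤T) ∷ bounds) = begin
    (1# - Q) * qPoch q q n * den μ
      ≈⟨ *-congˡ (den≈ T μ bounds) ⟩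
    (1# - Q) * qPoch q q n * (byMultiplicity T ((1# - Q) ^_) μ * byPosition (qPoch q q) μ)
      ≈⟨ *-exchange _ _ _ _ ⟩
    ((1# - Q) * byMultiplicity T ((1# - Q) ^_) μ) * (qPoch q q n * byPosition (qPoch q q) μ)
      ≈⟨ *-congʳ (byMultiplicity-∷ {T} {(1# - Q) ^_} {λ _ → 1# - Q} (λ _ → refl) μ 1≤t t≤T) ⟨
    byMultiplicity T ((1# - Q) ^_) (t ∷ μ) * byPosition (qPoch q q) (t ∷ μ) ∎
    where n = t ℕ.+ length μ ℕ.* β

  -- Let m and r count the parts of μ that are equal to t and different from t. Then Q^r - Q^{1+m+r}
  -- = Q^r (1 - Q^{m+1}): the power Q^r adds r to the number of inversions, and the other factor
  -- extends (Q;Q)_m to (Q;Q)_{m+1}.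
  num≈ : ∀ T μ → All (λ p → 1 ℕ.≤ p × p ℕ.≤ T) μ →
         num μ ≈ Q ^ inversions μ * byMultiplicity T (qPoch Q Q) μ * byPosition (qPoch Q q) μ
  num≈ T []      []                     = sym (trans (*-identityʳ _) (trans (*-identityˡ _) (byMultiplicity-[] T {qPoch Q Q} refl)))
  num≈ T (t ∷ μ) ((1≤t , t≤T) ∷ bounds) = begin
    (Q ^ r - Q * Q ^ length μ) * qPoch Q q n * num μ
      ≈⟨ *-cong (*-congʳ (+-congˡ (-‿cong (*-congˡ (trans (reflexive (≡.cong (Q ^_) (≡.sym (multiplicity+others t μ)))) (^-homo-* Q m r)))))) (num≈ T μ bounds) ⟩
    (Q ^ r - Q * (Q ^ m * Q ^ r)) * qPoch Q q n * (Q ^ inversions μ * byMultiplicity T (qPoch Q Q) μ * byPosition (qPoch Q q) μ)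
      ≈⟨ solve 7 (λ qʳ x qᵐ p i M P → (qʳ :- x :* (qᵐ :* qʳ)) :* p :* (i :* M :* P)
           := (qʳ :* i) :* ((con 1ℤ :- qᵐ :* x) :* M) :* (p :* P)) refl _ _ _ _ _ _ _ ⟩
    (Q ^ r * Q ^ inversions μ) * ((1# - Q ^ m * Q) * byMultiplicity T (qPoch Q Q) μ) * (qPoch Q q n * byPosition (qPoch Q q) μ)
      ≈⟨ *-congʳ (*-cong (^-homo-* Q r (inversions μ)) (byMultiplicity-∷ {T} {qPoch Q Q} {λ m → 1# - Q ^ m * Q} (λ _ → *-comm _ _) μ 1≤t t≤T)) ⟨
    Q ^ inversions (t ∷ μ) * byMultiplicity T (qPoch Q Q) (t ∷ μ) * byPosition (qPoch Q q) (t ∷ μ) ∎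
    where
    n = t ℕ.+ length μ ℕ.* β
    m = multiplicity μ t
    r = others t μ

parts-bounded : ∀ xs → Linked ℕ._≥_ xs → All (1 ℕ.≤_) xs → All (λ p → 1 ℕ.≤ p × p ℕ.≤ nth xs 0) xs
parts-bounded []       dec pos = []
parts-bounded (x ∷ xs) dec pos with x≥ ∷ _ ← Linked⇒AllPairs (λ x≥y y≥z → ℕ.≤-trans y≥z x≥y) dec =
  All.zip (pos , ℕ.≤-refl ∷ x≥)

-- Division in a Heyting field

module _ {c ℓ₁ ℓ₂} (K : HeytingField c ℓ₁ ℓ₂) (q : HeytingField.Carrier K) where
  private
    K′ = HeytingCommutativeRing.commutativeRing (HeytingField.heytingCommutativeRing K)
  open HeytingField K using (_#_; #⇒invertible)
  open HeytingProperties (HeytingField.heytingCommutativeRing K) using (x-0≈x)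
  open Coefficient K q
  open CommutativeRing K′ hiding (zero; rawRing; _+_)
  open BigRing K′ using (Regular; Regular-*; Regular-1; Regular-cancel)
  open IntegerSolver K′
  open SetoidReasoning setoid

  /-* : ∀ x y (y#0 : y # 0#) → (x / y [ y#0 ]) * y ≈ x
  /-* x y y#0 with #⇒invertible y#0
  ... | y⁻¹ , inverseˡ , _ = begin
    x * y⁻¹ * y          ≈⟨ *-assoc _ _ _ ⟩
    x * (y⁻¹ * y)        ≈⟨ *-congˡ (*-congˡ (x-0≈x y)) ⟨
    x * (y⁻¹ * (y - 0#)) ≈⟨ *-congˡ inverseˡ ⟩
    x * 1#               ≈⟨ *-identityʳ x ⟩
    x                    ∎

  #0⇒Regular : ∀ {y} → y # 0# → Regular y
  #0⇒Regular {y} y#0 z yz≈0 = begin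
    z                       ≈⟨ *-identityˡ z ⟨
    1# * z                  ≈⟨ *-congʳ (/-* 1# y y#0) ⟨
    (1# / y [ y#0 ]) * y * z  ≈⟨ *-assoc _ _ _ ⟩
    (1# / y [ y#0 ]) * (y * z) ≈⟨ *-congˡ yz≈0 ⟩
    (1# / y [ y#0 ]) * 0#     ≈⟨ zeroʳ _ ⟩
    0#                      ∎

  module _ (nru : NotRootOfUnity) (b : ℕ) (1≤b : 1 ℕ.≤ b) where
    open Ratio rawRing q b
    open RatioProducts K′ q b
    open BigMultiplicity *-commutativeMonoid
    open Exp semiring using (^-assocʳ)

    Regular-den : ∀ μ → Regular (den μ)
    Regular-den []      = Regular-1
    Regular-den (t ∷ μ) = Regular-* (Regular-* (#0⇒Regular (x#y⇒x-y#0 (nru b 1≤b))) (#0⇒Regular (qPoch-#0 nru (t ℕ.+ length μ ℕ.* b)))) (Regular-den μ)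

    product-/ : ∀ n (f g : Fin n → Carrier) (g#0 : ∀ i → g i # 0#) → product (λ i → f i / g i [ g#0 i ]) * product g ≈ product f
    product-/ n f g g#0 = trans (sym (product-* n _ g)) (product-cong n (λ i → /-* (f i) (g i) (g#0 i)))

    den*c-λ : ∀ lam → den (Partition.parts lam) * c-λ nru lam b 1≤b ≈ num (Partition.parts lam)
    den*c-λ lam = begin
      den μ * (q ^ e * product {T} (λ i → x₁ i / y₁ i [ _ ]) * product {ℓ} (λ i → x₂ i / y₂ i [ _ ]))
        ≈⟨ *-congʳ (trans (den≈ (nth μ 0) μ bounds) (*-cong (multiplicities ((1# - q ^ b) ^_)) (positions (qPoch q q)))) ⟩
      product {T} y₁ * product {ℓ} y₂ * (q ^ e * product {T} (λ i → x₁ i / y₁ i [ _ ]) * product {ℓ} (λ i → x₂ i / y₂ i [ _ ]))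
        ≈⟨ solve 5 (λ y₁ y₂ e p₁ p₂ → y₁ :* y₂ :* (e :* p₁ :* p₂) := e :* (p₁ :* y₁) :* (p₂ :* y₂)) refl _ _ _ _ _ ⟩
      q ^ e * (product {T} (λ i → x₁ i / y₁ i [ _ ]) * product {T} y₁) * (product {ℓ} (λ i → x₂ i / y₂ i [ _ ]) * product {ℓ} y₂)
        ≈⟨ *-cong (*-congˡ (product-/ T x₁ y₁ _)) (product-/ ℓ x₂ y₂ _) ⟩
      q ^ e * product {T} x₁ * product {ℓ} x₂
        ≈⟨ *-cong (*-cong exponents (sym (multiplicities (qPoch (q ^ b) (q ^ b))))) (sym (positions (qPoch (q ^ b) q))) ⟩
      (q ^ b) ^ inversions μ * byMultiplicity (nth μ 0) (qPoch (q ^ b) (q ^ b)) μ * byPosition (qPoch (q ^ b) q) μ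
        ≈⟨ num≈ (nth μ 0) μ bounds ⟨
      num μ ∎
      where
      open Partition lam renaming (parts to μ)
      T = part 0
      T≡ : T ≡ nth μ 0
      T≡ = part≡nth lam 0
      bounds = parts-bounded μ decreasing positive
      e = (b ℕ.* (ℓ ℕ.* ℓ ℕ.∸ ListAction.sum (List.map (λ i → mult (suc i) ℕ.* mult (suc i)) (upTo T)))) ÷ 2
      n = λ (i : Fin ℓ) → part (Fin.toℕ i) ℕ.+ (ℓ ℕ.∸ suc (Fin.toℕ i)) ℕ.* b
      x₁ y₁ : Fin T → Carrier
      x₁ i = qPoch (q ^ b) (q ^ b) (mult (suc (Fin.toℕ i)))
      y₁ i = (1# - q ^ b) ^ mult (suc (Fin.toℕ i))
      x₂ y₂ : Fin ℓ → Carrier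
      x₂ i = qPoch (q ^ b) q (n i)
      y₂ i = qPoch q q (n i)
      multiplicities : ∀ g → byMultiplicity (nth μ 0) g μ ≈ product {T} (λ i → g (mult (suc (Fin.toℕ i))))
      multiplicities g = trans (sym (product≈Π (nth μ 0) (λ v → g (mult (suc v)))))
        (reflexive (≡.cong (λ T → product {T} (λ i → g (mult (suc (Fin.toℕ i))))) (≡.sym T≡)))
      positions : ∀ G → byPosition G μ ≈ product {ℓ} (λ i → G (n i))
      positions G = product-cong ℓ (λ i → reflexive
        (≡.cong (λ p → G (p ℕ.+ (ℓ ℕ.∸ suc (Fin.toℕ i)) ℕ.* b)) (≡.sym (part≡nth lam (Fin.toℕ i)))))
      exponents : q ^ e ≈ (q ^ b) ^ inversions μ
      exponents = trans (reflexive (≡.cong (q ^_) (≡.trans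
        (≡.cong (λ T → (b ℕ.* (ℓ ℕ.* ℓ ℕ.∸ ListAction.sum (List.map (λ i → mult (suc i) ℕ.* mult (suc i)) (upTo T)))) ÷ 2) T≡)
        (exponent≡ b (nth μ 0) μ bounds)))) (sym (^-assocʳ q b (inversions μ)))

    -- Both sides have the same product with `den`, whose factors 1 - q^β and (q;q)_n are apart from
    -- 0 because q is not a root of unity.
    leading≈c-λ : ∀ s t lam → s ≡ Partition.ℓ lam → t ≡ Partition.ℓ lam →
      FormalSeries.coeff rawRing (Vec.map +_ (Partition.firstParts lam s)) (Partition.firstParts lam t)
        (QDyson.F rawRing q s t (replicate s b)) ≈ c-λ nru lam b 1≤b
    leading≈c-λ s t lam s≡ t≡ = Regular-cancel (Regular-den (parts lam)) (trans
      (den*coeff≈num K′ q s t b 1≤b (parts lam) (Linked⇒AllPairs (λ x≥y y≥z → ℕ.≤-trans y≥z x≥y) (decreasing lam))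
        _ _ (≡.trans (Vec.toList-map +_ (firstParts lam s)) (≡.cong (List.map +_) (toList-firstParts lam s s≡))) (toList-firstParts lam t t≡))
      (sym (den*c-λ lam)))
      where open Partition

theorem4p7 : ∀ {c ℓ₁ ℓ₂} (K : HeytingField c ℓ₁ ℓ₂) (q : HeytingField.Carrier K) →
    let open HeytingField K using (_≈_)
        open HeytingField K using (0#)
        open Coefficient K q
        open FormalSeries rawRing using (coeff)
        open QDyson rawRing q using (F)
        open Partition
    in
    (s t : ℕ) → 1 ≤ s → 1 ≤ t →
    (β : Vec ℕ s) → (∀ i → 1 ≤ lookup β i) →
    ((k : Vec ℤ s) (m : Vec ℕ t) → ¬ (coeff k m (F s t β) ≈ 0#) → k ⁺ ⊵ (map +_ m) ⁺)
    ×
    ((nru : NotRootOfUnity) (b : ℕ) (1≤b : 1 ≤ b) → β ≡ replicate s b →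
    (lam : Partition) → s ≡ ℓ lam → t ≡ ℓ lam →
    coeff (map +_ (firstParts lam s)) (firstParts lam t) (F s t β) ≈ c-λ nru lam b 1≤b)
theorem4p7 K q s t 1≤s 1≤t β 1≤β =
    -- The order on the integers is decidable, so the inequality may be proved by contradiction,
    -- which suits a coefficient known only not to be 0.
    (λ k m coeff≉0 n → decidable-stable (partialSum n (map +_ m ⁺) ℤ.≤? partialSum n (k ⁺))
      (λ ¬≤ → coeff≉0 (coefficient-vanishes K′ q s t β 1≤β k m n ¬≤)))
  , (λ { nru b 1≤b ≡.refl lam s≡ t≡ → leading≈c-λ K q nru b 1≤b s t lam s≡ t≡ })
  where K′ = HeytingCommutativeRing.commutativeRing (HeytingField.heytingCommutativeRing K)
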